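{- Let $u,v$ be packed words of length $n$. Then $$\mathbf{N}_u*(\sigma_1^t)_n*\mathbf{N}_v=\sum_{w\in W(u,v)}\ \prod_{i=1}^{\max(u)}c_{m^{(i)}}(t)\ \mathbf{K}_w,$$ where $W(u,v)$ is the set of packed words $w$ of length $n$ which are finer than $u$ and weakly finer than $v$, $m^{(i)}=m(v^{(i)},w^{(i)})$ is the refinement word of the pair $(v^{(i)},w^{(i)})$, $v^{(i)}$ and $w^{(i)}$ being the packed words of the subwords of $v$ and $w$ formed by the letters at the positions of the letter $i$ in $u$, and $c_m(t)$ denotes the $t$-Goldberg coefficient of the packed word $m$.
   Context: $\mathbb{K}$ is a field of characteristic $0$, $t$ an indeterminate. A word over the positive integers is packed if its set of letters is $\{1,\dots,r\}$ for some $r$; then $r=\max(u)$. For a word $w$ over a totally ordered alphabet with distinct letters $b_1<\dots<b_r$, $\mathrm{pack}(w)$ is obtained by replacing each $b_i$ by $i$. A packed word $u=u_1\cdots u_n$ is identified with the set composition of $\{1,\dots,n\}$ whose $i$-th block is $\{j:u_j=i\}$. For packed words of length $n$: $w$ is finer than $u$ if the set composition $u$ is obtained from $w$ by merging some consecutive blocks (equivalently $w_i\le w_j\Rightarrow u_i\le u_j$ for all $i,j$); $w$ is weakly finer than $v$ if $w_i=w_j\Rightarrow v_i=v_j$ for all $i,j$. When $x$ is weakly finer than $v$, the refinement word $m(v,x)$ is the word of length $\max(x)$ whose $i$-th letter is $v_j$ for any $j$ with $x_j=i$. (Example: $m(12113,41223)=2131$.) $\mathbf{WQSym}^*_n$ is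 the $\mathbb{K}$-vector space with basis $\mathbf{N}_u$, $u$ running over packed words of length $n$, with (associative) internal product $\mathbf{N}_u*\mathbf{N}_v=\mathbf{N}_{\mathrm{pack}\binom{u}{v}}$, where $\binom{u}{v}$ is the word of biletters $\binom{u_1}{v_1}\cdots\binom{u_n}{v_n}$, ordered lexicographically with priority to the top letter; scalars are extended to $\mathbb{K}[t]$. The degree $n$ component of $\sigma_1^t$ is $$(\sigma_1^t)_n=\sum_{|u|=n}\binom{t}{\max(u)}\mathbf{N}_u=\sum_{k=1}^n t^kE_n^{[k]},$$ the first sum being over all packed words of length $n$; the second equality defines $E_n^{[k]}$. For a packed word $u$ of length $n$, $\mathbf{K}_u:=\mathbf{N}_u*E_n^{[\max(u)]}$. The $t$-Goldberg coefficients $c_u(t)$, $u$ packed, are the polynomials defined by $(e^{a_1}e^{a_2}\cdots)^t=\sum_u c_u(t)\mathbf{M}_u(A)$, where $a_1,a_2,\dots$ are noncommuting variables, $g=e^{a_1}e^{a_2}\cdots$ is viewed as a formal series of words, $g^t=\sum_{k\ge 0}\binom{t}{k}(g-1)^k$, and $\mathbf{M}_u(A)=\sum_{\mathrm{pack}(w)=u}w$ (so $c_u(t)$ is the coefficient in $g^t$ of any word $w$ with $\mathrm{pack}(w)=u$). -}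

module Defs where

open import Level using (Level)
open import Algebra.Bundles using (CommutativeRing)
open import Algebra.Bundles.Raw using (RawRing)
open import Algebra.Apartness.Bundles using (HeytingCommutativeRing; HeytingField)
import Algebra.Definitions.RawMonoid as RawMonoidDefs
open import Data.Bool.Base using (if_then_else_)
open import Data.Fin.Base using (Fin; toℕ)
import Data.Fin.Properties as Finₚ
open import Data.List.Base as List using (List; []; _∷_)
import Data.List.Relation.Unary.All as ListAll
open import Data.Maybe.Base as Maybe using (Maybe)
open import Data.Nat.Base using (ℕ; zero; suc; _≤_; _!; NonZero)
import Data.Nat.Base as ℕ
open import Data.Nat.Properties using (_≟_; _≤?_; _!≢0; <-strictTotalOrder)
open import Data.Product.Base using (_×_; _,_; proj₁)
open import Data.Product.Relation.Binary.Lex.Strict using (×-strictTotalOrder)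
open import Data.Vec.Base as Vec using (Vec; []; _∷_; lookup)
open import Data.Vec.Membership.Propositional using (_∈_)
open import Data.Vec.Membership.DecPropositional _≟_ using (_∈?_)
import Data.Vec.Properties as Vecₚ
import Data.Vec.Relation.Unary.All as VecAll
open import Relation.Binary.Bundles using (StrictTotalOrder)
open import Relation.Binary.PropositionalEquality using (_≡_)
open import Relation.Nullary.Decidable using (Dec; does; dec⇒maybe; _×-dec_; _→-dec_)

------------------------------------------------------------------------
-- Packed words

Word : ℕ → Set
Word n = Vec ℕ n

maxW : ∀ {n} → Word n → ℕ
maxW = Vec.foldr (λ _ → ℕ) ℕ._⊔_ 0

-- The set of letters is {1,…,r}; necessarily r = maxW w.
Packed : ∀ {n} → Word n → Set
Packed w = VecAll.All (1 ≤_) w × (∀ (i : Fin (maxW w)) → suc (toℕ i) ∈ w)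

packed? : ∀ {n} (w : Word n) → Dec (Packed w)
packed? w = VecAll.all? (1 ≤?_) w ×-dec Finₚ.all? (λ i → suc (toℕ i) ∈? w)

record PackedWord (n : ℕ) : Set where
  constructor mkPacked
  field
    word    : Word n
    .packed : Packed word

open PackedWord public using (word)

[1⋯_] : ℕ → List ℕ
[1⋯ n ] = List.map suc (List.upTo n)

wordsOver : List ℕ → ∀ n → List (Word n)
wordsOver A zero    = [] ∷ []
wordsOver A (suc n) = List.cartesianProductWith _∷_ A (wordsOver A n)

-- Each packed word of length n exactly once (its letters are at most n).
packedWords : ∀ n → List (PackedWord n)
packedWords n = List.mapMaybe asPacked (wordsOver [1⋯ n ] n)
  where
  asPacked : Word n → Maybe (PackedWord n)
  asPacked w = Maybe.map (λ p → mkPacked w p) (dec⇒maybe (packed? w))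

------------------------------------------------------------------------
-- Packing

module _ {a ℓ₁ ℓ₂ : Level} (O : StrictTotalOrder a ℓ₁ ℓ₂) where
  private module O = StrictTotalOrder O

  -- If b is the i-th smallest letter of w, then i is one more than the number
  -- of distinct letters of w below b.
  packOver : ∀ {n} → Vec O.Carrier n → Word n
  packOver w = Vec.map (λ b → suc (List.length (below b))) w
    where
    below : O.Carrier → List O.Carrier
    below b = List.deduplicate O._≟_ (List.filter (O._<? b) (Vec.toList w))

pack : ∀ {n} → Word n → Word n
pack = packOver <-strictTotalOrder

packBiword : ∀ {n} → Word n → Word n → Word n
packBiword u v = packOver (×-strictTotalOrder <-strictTotalOrder <-strictTotalOrder) (Vec.zip u v)

------------------------------------------------------------------------
-- Refinement of packed words

Finer : ∀ {n} → Word n → Word n → Set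
Finer w u = ∀ i j → lookup w i ≤ lookup w j → lookup u i ≤ lookup u j

WeaklyFiner : ∀ {n} → Word n → Word n → Set
WeaklyFiner w v = ∀ i j → lookup w i ≡ lookup w j → lookup v i ≡ lookup v j

finer? : ∀ {n} (w u : Word n) → Dec (Finer w u)
finer? w u = Finₚ.all? λ i → Finₚ.all? λ j →
  (lookup w i ≤? lookup w j) →-dec (lookup u i ≤? lookup u j)

weaklyFiner? : ∀ {n} (w v : Word n) → Dec (WeaklyFiner w v)
weaklyFiner? w v = Finₚ.all? λ i → Finₚ.all? λ j →
  (lookup w i ≟ lookup w j) →-dec (lookup v i ≟ lookup v j)

W : ∀ {n} → PackedWord n → PackedWord n → List (PackedWord n)
W {n} u v =
  List.filter (λ w → finer? (word w) (word u) ×-dec weaklyFiner? (word w) (word v))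
              (packedWords n)

-- v_j for the first j with x_j = i.  The value 0 is returned only when i does
-- not occur in x, which for packed x and 1 ≤ i ≤ max x never happens.
letterAbove : ∀ {n} → Word n → Word n → ℕ → ℕ
letterAbove []      []      i = 0
letterAbove (a ∷ v) (b ∷ x) i = if does (b ≟ i) then a else letterAbove v x i

-- The refinement word m(v,x); meaningful when x is weakly finer than v.
refinementWord : ∀ {n} (v x : Word n) → Word (maxW x)
refinementWord v x = Vec.tabulate (λ i → letterAbove v x (suc (toℕ i)))

occurrences : ∀ {n} → Word n → ℕ → List (Fin n)
occurrences {n} u i = List.filter (λ j → lookup u j ≟ i) (List.allFin n)

-- v⁽ⁱ⁾, relative to u: pack of the subword of v at the positions of i in u.
packedSubword : ∀ {n} (u : Word n) (i : ℕ) → Word n → Word (List.length (occurrences u i))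
packedSubword u i v = pack (Vec.map (lookup v) (Vec.fromList (occurrences u i)))

------------------------------------------------------------------------
-- Finite sums and products, polynomials, and the internal product

module FiniteSums {c ℓ : Level} (R : RawRing c ℓ) where
  open RawRing R

  ∑ : ∀ {a} {A : Set a} → List A → (A → Carrier) → Carrier
  ∑ xs f = List.foldr (λ x s → f x + s) 0# xs

  ∏ : ∀ {a} {A : Set a} → List A → (A → Carrier) → Carrier
  ∏ xs f = List.foldr (λ x p → f x * p) 1# xs

-- R[t], as lists of coefficients by increasing degree, up to trailing zeros.
module Polynomials {c ℓ : Level} (R : RawRing c ℓ) where
  open RawRing R

  Poly : Set c
  Poly = List Carrier

  coeff : Poly → ℕ → Carrier
  coeff []      _       = 0#
  coeff (a ∷ p) zero    = a
  coeff (a ∷ p) (suc k) = coeff p k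

  infix  4 _≈ᵖ_
  infixl 6 _+ᵖ_
  infixl 7 _*ᵖ_

  _≈ᵖ_ : Poly → Poly → Set ℓ
  p ≈ᵖ q = ∀ k → coeff p k ≈ coeff q k

  _+ᵖ_ : Poly → Poly → Poly
  []      +ᵖ q       = q
  (a ∷ p) +ᵖ []      = a ∷ p
  (a ∷ p) +ᵖ (b ∷ q) = (a + b) ∷ (p +ᵖ q)

  _*ᵖ_ : Poly → Poly → Poly
  []      *ᵖ q = []
  (a ∷ p) *ᵖ q = List.map (a *_) q +ᵖ (0# ∷ (p *ᵖ q))

  const : Carrier → Poly
  const a = a ∷ []

  t : Poly
  t = 0# ∷ 1# ∷ []

  polyRing : RawRing c ℓ
  polyRing = record
    { Carrier = Poly
    ; _≈_     = _≈ᵖ_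
    ; _+_     = _+ᵖ_
    ; _*_     = _*ᵖ_
    ; -_      = List.map -_
    ; 0#      = []
    ; 1#      = const 1#
    }

-- WQSym*ₙ with scalars in R: the free module on the packed words of length n.
-- An element is the family of its coordinates in the basis N.
module InternalProduct {c ℓ : Level} (R : RawRing c ℓ) where
  open RawRing R
  open FiniteSums R public

  WQSym* : ℕ → Set c
  WQSym* n = PackedWord n → Carrier

  infix  4 _≋_
  infixr 7 _•_
  infixl 7 _∗_

  _≋_ : ∀ {n} → WQSym* n → WQSym* n → Set ℓ
  f ≋ g = ∀ w → f w ≈ g w

  _•_ : ∀ {n} → Carrier → WQSym* n → WQSym* n
  (a • f) w = a * f w

  ∑ᵂ : ∀ {a} {A : Set a} {n} → List A → (A → WQSym* n) → WQSym* n
  ∑ᵂ xs f w = ∑ xs (λ x → f x w)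

  -- The basis element N_x of a packed word x.
  N : ∀ {n} → Word n → WQSym* n
  N x w = if does (Vecₚ.≡-dec _≟_ x (word w)) then 1# else 0#

  -- Bilinear extension of N_u ∗ N_v = N_{pack(u/v)}.
  _∗_ : ∀ {n} → WQSym* n → WQSym* n → WQSym* n
  _∗_ {n} f g =
    ∑ᵂ (packedWords n) λ u → ∑ᵂ (packedWords n) λ v →
      (f u * g v) • N (packBiword (word u) (word v))

------------------------------------------------------------------------
-- Fields of characteristic 0

fieldRawRing : ∀ {c ℓ₁ ℓ₂} → HeytingField c ℓ₁ ℓ₂ → RawRing c ℓ₁
fieldRawRing K = CommutativeRing.rawRing
  (HeytingCommutativeRing.commutativeRing (HeytingField.heytingCommutativeRing K))

-- In a Heyting field the invertible elements are those apart from 0#, so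
-- "n ≠ 0 in K" is read as apartness.
CharacteristicZero : ∀ {c ℓ₁ ℓ₂} → HeytingField c ℓ₁ ℓ₂ → Set ℓ₂
CharacteristicZero K = ∀ n → .{{_ : NonZero n}} → (n ℕ× 1#) # 0#
  where
  open HeytingField K
  open RawMonoidDefs (RawRing.+-rawMonoid (fieldRawRing K)) using () renaming (_×_ to _ℕ×_)

module CharZero {c ℓ₁ ℓ₂ : Level} (K : HeytingField c ℓ₁ ℓ₂) (char0 : CharacteristicZero K) where
  open HeytingField K
  open RawMonoidDefs (RawRing.+-rawMonoid (fieldRawRing K)) using () renaming (_×_ to _ℕ×_)

  -- The inverse of n in K.
  1/ : ∀ n → .{{_ : NonZero n}} → Carrier
  1/ n = proj₁ (#⇒invertible (char0 n))

  open Polynomials (fieldRawRing K) public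

  -- binom(t,k+1) = (t - k) / (k+1) · binom(t,k)
  binom : ℕ → Poly
  binom zero    = const 1#
  binom (suc k) = const (1/ (suc k)) *ᵖ ((t +ᵖ const (- (k ℕ× 1#))) *ᵖ binom k)

  ----------------------------------------------------------------------
  -- Goldberg coefficients

  -- Formal series in the noncommuting variables a₁, a₂, …; the word
  -- a_{i₁}⋯a_{iₙ} is written as the list i₁ ∷ ⋯ ∷ iₙ ∷ [].
  Series : Set c
  Series = List ℕ → Carrier

  open FiniteSums (fieldRawRing K) using () renaming (∑ to ∑ᴷ)

  oneˢ : Series
  oneˢ []      = 1#
  oneˢ (_ ∷ _) = 0#

  infixl 6 _-ˢ_
  infixl 7 _*ˢ_

  _-ˢ_ : Series → Series → Series
  (f -ˢ g) w = f w - g w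

  -- zip (inits w) (tails w) lists the factorisations of w into two words.
  _*ˢ_ : Series → Series → Series
  (f *ˢ g) w = ∑ᴷ (List.zip (List.inits w) (List.tails w)) λ (x , y) → f x * g y

  _^ˢ_ : Series → ℕ → Series
  f ^ˢ zero  = oneˢ
  f ^ˢ suc k = f *ˢ (f ^ˢ k)

  expVar : ℕ → Series
  expVar i w = if does (ListAll.all? (_≟ i) w)
               then 1/ (List.length w !) {{List.length w !≢0}}
               else 0#

  -- e^{a₁} ⋯ e^{a_N}
  expProduct : ℕ → Series
  expProduct zero    = oneˢ
  expProduct (suc N) = expProduct N *ˢ expVar (suc N)

  -- e^{a₁} e^{a₂} ⋯ : the factors beyond the largest letter of w do not affect
  -- the coefficient of w.
  g : Series
  g w = expProduct (List.foldr ℕ._⊔_ 0 w) w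

  open InternalProduct polyRing public

  -- The coefficient of w in g^t = Σ_{k ≥ 0} binom(t,k) (g - 1)^k.  As g - 1 has
  -- no constant term, the terms with k > |w| do not contribute.
  gᵗ : List ℕ → Poly
  gᵗ w = ∑ (List.upTo (suc (List.length w))) λ k → binom k *ᵖ const (((g -ˢ oneˢ) ^ˢ k) w)

  -- The t-Goldberg coefficient of a packed word.
  goldberg : ∀ {n} → Word n → Poly
  goldberg u = gᵗ (Vec.toList u)

  ----------------------------------------------------------------------
  -- σ₁ᵗ and the elements K_u

  σᵗ : ∀ n → WQSym* n
  σᵗ n = ∑ᵂ (packedWords n) λ u → binom (maxW (word u)) • N (word u)

  private module K-linear = InternalProduct (fieldRawRing K)

  -- E_n^{[k]}, with scalars in K: the coefficient of t^k in (σ₁ᵗ)_n.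
  E : ∀ n → ℕ → K-linear.WQSym* n
  E n k w = coeff (σᵗ n w) k

  extendScalars : ∀ {n} → K-linear.WQSym* n → WQSym* n
  extendScalars f w = const (f w)

  𝐊 : ∀ {n} → PackedWord n → K-linear.WQSym* n
  𝐊 {n} u = K-linear.N (word u) K-linear.∗ E n (maxW (word u))

{-# OPTIONS --safe #-}
module Submission where

-- Compare the coefficients of a packed word z on both sides.  They are polynomials in t, so by
-- characteristic 0 it suffices to evaluate them at t = m for all natural numbers m.
--
-- If z is not in W(u, v) both sides vanish.  Otherwise each letter of z carries the colour i and the
-- letter a of u and v at its positions, which spells a word α in the letters (i, a).  On the left, as
-- binom(m, max x) counts the words over {1,…,m} that pack to x, one counts the words x for which
-- (u, x, v) is ordered lexicographically like z; this is the coefficient of α in the product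
-- ∏ᵢ (∏ₐ (1 + (i, a)))ᵐ.
--
-- On the right w runs over the factorisations of α into powers.  The coordinate of K_w at z is the
-- product of the coefficients l k = (-1)^(k-1)/k of log(1 + x) at the exponents k, and the product of
-- the Goldberg coefficients is a coefficient of ∏ᵢ (∏ₐ e^(i, a))ᵐ.  So the right-hand side is the
-- coefficient of α in the series obtained from this product by substituting log(1 + (i, a)) for each
-- letter (i, a).  The substitution is multiplicative and turns e^(i, a) into 1 + (i, a).

open import Defs
open import Algebra.Apartness.Bundles using (HeytingField; HeytingCommutativeRing)
open import Algebra.Bundles using (CommutativeRing)
open import Data.Bool.Base using (true; false; if_then_else_)
open import Data.Empty using (⊥-elim)
open import Data.Fin.Base as Fin using (Fin; zero; suc; toℕ; fromℕ<)
import Data.Fin.Properties as Finₚ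
open import Data.List.Base as List using (List; []; _∷_; _++_; length; replicate)
open import Data.List.Membership.Propositional using (_∈_)
open import Data.List.Membership.Propositional.Properties using
  ( ∈-cartesianProductWith⁺; ∈-cartesianProductWith⁻; ∈-upTo⁺; ∈-upTo⁻; ∈-filter⁺; ∈-filter⁻
  ; ∈-map⁺; ∈-map⁻; ∈-allFin; ∈-++⁺ˡ; ∈-++⁺ʳ; ∈-++⁻)
import Data.List.Membership.Setoid as SetoidMembership
import Data.List.Membership.Setoid.Properties as Memₛ
import Data.List.Properties as Listₚ
open import Data.List.Relation.Unary.All as All using (All; []; _∷_)
import Data.List.Relation.Unary.All.Properties as Allₚ
open import Data.List.Relation.Unary.AllPairs as AllPairs using (AllPairs; []; _∷_; allPairs?)
import Data.List.Relation.Unary.AllPairs.Properties as AllPairsₚ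
open import Data.List.Relation.Unary.Any as Any using (Any; here; there; _─_)
import Data.List.Relation.Unary.Unique.DecSetoid.Properties as UniqueDec
open import Data.List.Relation.Unary.Unique.Propositional using (Unique)
import Data.List.Relation.Unary.Unique.Propositional.Properties as Uniqueₚ
import Data.List.Relation.Unary.Unique.Setoid as SetoidUnique
import Data.Maybe.Base as Maybe
open import Data.Nat.Base as ℕ using (ℕ; zero; suc; _≤_; _<_; z≤n; s≤s; NonZero; _!)
open import Data.Nat.Induction using (<-rec)
open import Data.Nat.Properties as ℕₚ using (_≟_; <-cmp; <-strictTotalOrder; _!≢0)
open import Data.Product.Base using (_×_; _,_; proj₁; proj₂; ∃)
open import Data.Product.Properties using (≡-dec)
open import Data.Product.Relation.Binary.Lex.Strict using (×-strictTotalOrder)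
open import Data.Sum.Base using (_⊎_; inj₁; inj₂)
open import Data.Unit.Base using (⊤; tt)
open import Data.Vec.Base as Vec using (Vec; []; _∷_; lookup; tabulate)
open import Data.Vec.Membership.Propositional using () renaming (_∈_ to _∈ᵛ_)
import Data.Vec.Membership.Propositional.Properties as VecMem
open import Data.Vec.Properties as Vecₚ using (lookup-map; lookup-zip; lookup-replicate; lookup∘tabulate; tabulate∘lookup; tabulate-cong)
import Data.Vec.Relation.Unary.All as VecAll
import Data.Vec.Relation.Unary.All.Properties as VecAllₚ
import Data.Vec.Relation.Unary.Any as VecAny
open import Function.Base using (_∘_; id; _on_)
open import Function.Bundles using (_⇔_; mk⇔; Equivalence)
open Equivalence using () renaming (to to to⇔; from to from⇔)
open import Function.Construct.Composition using (_⇔-∘_)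
open import Level using (Level)
open import Relation.Binary.Bundles using (Setoid; StrictTotalOrder)
open import Relation.Binary.Definitions using (DecidableEquality; tri<; tri≈; tri>)
open import Relation.Binary.PropositionalEquality as ≡ using (_≡_; _≢_)
open import Relation.Nullary using (Dec; yes; no; does; ¬_; contradiction)
open import Relation.Nullary.Decidable using (_×-dec_; ¬?; dec-true; dec-false; dec⇒maybe; recompute)

-- Two mismatches are removed before both sides meet in one coefficient. The refinement words see v
-- only after it has been packed over each letter of u, so the letter a of (i, a) is taken from
-- `blockwise v`. The left-hand side does not notice this, since v is compared only where u agrees.
-- Moreover the factorisations of a word into blocks correspond to all packed w that z is finer
-- than, not only to those in W(u, v); a w outside W(u, v) merges different letters (i, a), so one
-- of its blocks is not a power and it contributes nothing.
--
-- The logarithm enters through `E`. If z is finer than w, the coordinate of N_w ∗ σ₁ᵗ at z is the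
-- product over the letters j of w of binom(t, k_j), where k_j letters of z are merged into j. Every
-- factor is divisible by t and there are max w of them, so the coefficient of t^(max w) is the
-- product of the linear coefficients, and the linear coefficient of binom(t, k) is that of x^k in
-- log(1 + x).
--
-- That e^a becomes 1 + a rests on exp(log(1 + x)) = 1 + x, which comes from the differential
-- equation (1 + x) y′ = y.

-- Finite sums, products and indicators in a commutative ring.

module Sums {c ℓ} (R : CommutativeRing c ℓ) where
  open CommutativeRing R
  open FiniteSums rawRing public
  open import Algebra.Properties.CommutativeSemigroup +-commutativeSemigroup
    using () renaming (interchange to +-interchange)
  open import Relation.Binary.Reasoning.Setoid setoid

  private variable
    a b p q : Level
    P : Set p
    Q : Set q

  ∑-cong-∈ : ∀ {A : Set a} (xs : List A) {f g : A → Carrier} → (∀ {x} → x ∈ xs → f x ≈ g x) → ∑ xs f ≈ ∑ xs g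
  ∑-cong-∈ []       f≈g = refl
  ∑-cong-∈ (x ∷ xs) f≈g = +-cong (f≈g (here ≡.refl)) (∑-cong-∈ xs (λ x∈ → f≈g (there x∈)))

  ∑-cong : ∀ {A : Set a} (xs : List A) {f g : A → Carrier} → (∀ x → f x ≈ g x) → ∑ xs f ≈ ∑ xs g
  ∑-cong xs f≈g = ∑-cong-∈ xs (λ {x} _ → f≈g x)

  ∏-cong-∈ : ∀ {A : Set a} (xs : List A) {f g : A → Carrier} → (∀ {x} → x ∈ xs → f x ≈ g x) → ∏ xs f ≈ ∏ xs g
  ∏-cong-∈ []       f≈g = refl
  ∏-cong-∈ (x ∷ xs) f≈g = *-cong (f≈g (here ≡.refl)) (∏-cong-∈ xs (λ x∈ → f≈g (there x∈)))

  ∑-zero-∈ : ∀ {A : Set a} (xs : List A) {f : A → Carrier} → (∀ {x} → x ∈ xs → f x ≈ 0#) → ∑ xs f ≈ 0#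
  ∑-zero-∈ []       f≈0 = refl
  ∑-zero-∈ (x ∷ xs) f≈0 =
    trans (+-cong (f≈0 (here ≡.refl)) (∑-zero-∈ xs (λ x∈ → f≈0 (there x∈)))) (+-identityˡ 0#)

  ∑-zero : ∀ {A : Set a} (xs : List A) → ∑ xs (λ _ → 0#) ≈ 0#
  ∑-zero xs = ∑-zero-∈ xs (λ _ → refl)

  ∑-+ : ∀ {A : Set a} (xs : List A) (f g : A → Carrier) → ∑ xs (λ x → f x + g x) ≈ ∑ xs f + ∑ xs g
  ∑-+ []       f g = sym (+-identityˡ 0#)
  ∑-+ (x ∷ xs) f g = trans (+-congˡ (∑-+ xs f g)) (+-interchange _ _ _ _)

  ∑-*ˡ : ∀ {A : Set a} (xs : List A) k (f : A → Carrier) → ∑ xs (λ x → k * f x) ≈ k * ∑ xs f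
  ∑-*ˡ []       k f = sym (zeroʳ k)
  ∑-*ˡ (x ∷ xs) k f = trans (+-congˡ (∑-*ˡ xs k f)) (sym (distribˡ k _ _))

  ∑-*ʳ : ∀ {A : Set a} (xs : List A) k (f : A → Carrier) → ∑ xs (λ x → f x * k) ≈ ∑ xs f * k
  ∑-*ʳ xs k f = trans (∑-cong xs (λ x → *-comm _ _)) (trans (∑-*ˡ xs k f) (*-comm _ _))

  ∑-swap : ∀ {A : Set a} {B : Set b} (xs : List A) (ys : List B) (f : A → B → Carrier) →
           ∑ xs (λ x → ∑ ys (f x)) ≈ ∑ ys (λ y → ∑ xs (λ x → f x y))
  ∑-swap []       ys f = sym (∑-zero ys)
  ∑-swap (x ∷ xs) ys f = trans (+-congˡ (∑-swap xs ys f)) (sym (∑-+ ys (f x) _))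

  ∑-++ : ∀ {A : Set a} (xs ys : List A) (f : A → Carrier) → ∑ (xs ++ ys) f ≈ ∑ xs f + ∑ ys f
  ∑-++ []       ys f = sym (+-identityˡ _)
  ∑-++ (x ∷ xs) ys f = trans (+-congˡ (∑-++ xs ys f)) (sym (+-assoc _ _ _))

  ∑-map : ∀ {A : Set a} {B : Set b} (h : A → B) xs (f : B → Carrier) → ∑ (List.map h xs) f ≡ ∑ xs (λ x → f (h x))
  ∑-map h []       f = ≡.refl
  ∑-map h (x ∷ xs) f = ≡.cong (f (h x) +_) (∑-map h xs f)

  ∑-cartesianProductWith : ∀ {d} {A : Set a} {B : Set b} {D : Set d} (h : A → B → D) xs ys (f : D → Carrier) →
    ∑ (List.cartesianProductWith h xs ys) f ≈ ∑ xs (λ x → ∑ ys (λ y → f (h x y)))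
  ∑-cartesianProductWith h []       ys f = refl
  ∑-cartesianProductWith h (x ∷ xs) ys f = trans (∑-++ (List.map (h x) ys) _ f)
    (+-cong (reflexive (∑-map (h x) ys f)) (∑-cartesianProductWith h xs ys f))

  𝟙 : Dec P → Carrier
  𝟙 d = if does d then 1# else 0#

  𝟙-yes : (d : Dec P) → P → 𝟙 d ≈ 1#
  𝟙-yes (yes _) _ = refl
  𝟙-yes (no ¬p) p = contradiction p ¬p

  𝟙-no : (d : Dec P) → ¬ P → 𝟙 d ≈ 0#
  𝟙-no (yes p) ¬p = contradiction p ¬p
  𝟙-no (no _)  _  = refl

  𝟙-cong : (d : Dec P) (e : Dec Q) → (P → Q) → (Q → P) → 𝟙 d ≈ 𝟙 e
  𝟙-cong (yes p) e p→q q→p = sym (𝟙-yes e (p→q p))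
  𝟙-cong (no ¬p) e p→q q→p = sym (𝟙-no e (λ q → ¬p (q→p q)))

  𝟙-×-dec : (d : Dec P) (e : Dec Q) → 𝟙 (d ×-dec e) ≈ 𝟙 d * 𝟙 e
  𝟙-×-dec (yes p) (yes q) = sym (*-identityˡ 1#)
  𝟙-×-dec (yes p) (no ¬q) = sym (zeroʳ 1#)
  𝟙-×-dec (no ¬p) e       = sym (zeroˡ _)

  ∑-filter : ∀ {A : Set a} {P : A → Set p} (P? : ∀ x → Dec (P x)) xs (f : A → Carrier) →
             ∑ (List.filter P? xs) f ≈ ∑ xs (λ x → 𝟙 (P? x) * f x)
  ∑-filter P? []       f = refl
  ∑-filter P? (x ∷ xs) f with does (P? x)
  ... | true  = +-cong (sym (*-identityˡ _)) (∑-filter P? xs f)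
  ... | false = trans (∑-filter P? xs f) (trans (sym (+-identityˡ _)) (+-congʳ (sym (zeroˡ _))))

  ∑-single : ∀ {A : Set a} {xs : List A} {x} (f : A → Carrier) → Unique xs → x ∈ xs →
             (∀ {y} → y ∈ xs → y ≢ x → f y ≈ 0#) → ∑ xs f ≈ f x
  ∑-single f (x≢ ∷ u) (here ≡.refl) f≈0 =
    trans (+-congˡ (∑-zero-∈ _ (λ y∈ → f≈0 (there y∈) (λ y≡x → All.lookup x≢ y∈ (≡.sym y≡x))))) (+-identityʳ _)
  ∑-single f (x≢ ∷ u) (there x∈) f≈0 =
    trans (+-congʳ (f≈0 (here ≡.refl) (All.lookup x≢ x∈)))
          (trans (+-identityˡ _) (∑-single f u x∈ (λ y∈ → f≈0 (there y∈))))

  ∑-δ : ∀ {A : Set a} (_≟_ : DecidableEquality A) {xs : List A} {x} (f : A → Carrier) → Unique xs → x ∈ xs →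
        ∑ xs (λ y → 𝟙 (x ≟ y) * f y) ≈ f x
  ∑-δ _≟_ f u x∈ = trans
    (∑-single _ u x∈ (λ _ y≢x → trans (*-congʳ (𝟙-no (_ ≟ _) (λ x≡y → y≢x (≡.sym x≡y)))) (zeroˡ _)))
    (trans (*-congʳ (𝟙-yes (_ ≟ _) ≡.refl)) (*-identityˡ _))

  -- The indicator of `h y ≡ x` is inserted and the double sum is evaluated in both orders. The map
  -- `k` has to invert `h` only where `f` does not vanish, so the larger index set may contain terms
  -- with no counterpart.
  ∑-reindex : ∀ {A : Set a} {B : Set b} (_≟_ : DecidableEquality A) {xs : List A} {ys : List B} →
    Unique xs → Unique ys → (h : B → A) (k : A → B) (f : A → Carrier) →
    (∀ {y} → y ∈ ys → h y ∈ xs) → (∀ {y} → y ∈ ys → k (h y) ≡ y) →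
    (∀ {x} → x ∈ xs → f x ≈ 0# ⊎ (k x ∈ ys × h (k x) ≡ x)) →
    ∑ xs f ≈ ∑ ys (λ y → f (h y))
  ∑-reindex _≟_ {xs} {ys} xs! ys! h k f h∈ kh≡ hk≡ = begin
    ∑ xs f                                          ≈⟨ ∑-cong-∈ xs row ⟩
    ∑ xs (λ x → ∑ ys (λ y → 𝟙 (h y ≟ x) * f x))   ≈⟨ ∑-swap xs ys _ ⟩
    ∑ ys (λ y → ∑ xs (λ x → 𝟙 (h y ≟ x) * f x))   ≈⟨ ∑-cong-∈ ys (λ y∈ → ∑-δ _≟_ f xs! (h∈ y∈)) ⟩
    ∑ ys (λ y → f (h y))                            ∎
    where
    row : ∀ {x} → x ∈ xs → f x ≈ ∑ ys (λ y → 𝟙 (h y ≟ x) * f x)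
    row {x} x∈ with hk≡ x∈
    ... | inj₁ f≈0 = trans f≈0 (sym (∑-zero-∈ ys (λ _ → trans (*-congˡ f≈0) (zeroʳ _))))
    ... | inj₂ (k∈ , hk) = sym (trans
      (∑-single _ ys! k∈ (λ y∈ y≢ → trans
        (*-congʳ (𝟙-no (_ ≟ _) (λ hy≡x → y≢ (≡.trans (≡.sym (kh≡ y∈)) (≡.cong k hy≡x))))) (zeroˡ _)))
      (trans (*-congʳ (𝟙-yes (_ ≟ _) hk)) (*-identityˡ _)))

-- Packed words and the order of their letters.

∈⇒lookup : ∀ {n} {x : ℕ} {w : Word n} → x ∈ᵛ w → ∃ λ i → lookup w i ≡ x
∈⇒lookup (VecAny.here ≡.refl) = zero , ≡.refl
∈⇒lookup (VecAny.there x∈)    = let i , eq = ∈⇒lookup x∈ in suc i , eq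

lookup≤max : ∀ {n} (w : Word n) i → lookup w i ≤ maxW w
lookup≤max (a ∷ w) zero    = ℕₚ.m≤m⊔n a (maxW w)
lookup≤max (a ∷ w) (suc i) = ℕₚ.≤-trans (lookup≤max w i) (ℕₚ.m≤n⊔m a (maxW w))

lookup-ext : ∀ {a} {A : Set a} {n} {v w : Vec A n} → (∀ i → lookup v i ≡ lookup w i) → v ≡ w
lookup-ext {v = v} {w} eq = ≡.trans (≡.sym (tabulate∘lookup v)) (≡.trans (tabulate-cong eq) (tabulate∘lookup w))

max-attained : ∀ {n} (w : Word n) → maxW w ≡ 0 ⊎ ∃ λ i → lookup w i ≡ maxW w
max-attained []      = inj₁ ≡.refl
max-attained (a ∷ w) with ℕₚ.⊔-sel a (maxW w)
... | inj₁ eq = inj₂ (zero , ≡.sym eq)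
... | inj₂ eq with max-attained w
...   | inj₁ 0≡      = inj₁ (≡.trans eq 0≡)
...   | inj₂ (i , p) = inj₂ (suc i , ≡.trans p (≡.sym eq))

packed⇒letter : ∀ {n} {w : Word n} → Packed w → ∀ k → k < maxW w → ∃ λ i → lookup w i ≡ suc k
packed⇒letter (_ , occurs) k k<m =
  let i , eq = ∈⇒lookup (occurs (fromℕ< k<m))
  in  i , ≡.trans eq (≡.cong suc (Finₚ.toℕ-fromℕ< k<m))

packed⇒positive : ∀ {n} {w : Word n} → Packed w → ∀ i → 1 ≤ lookup w i
packed⇒positive {w = w} (pos , _) i = VecAll.lookup pos (VecMem.∈-lookup i w)

-- Every value from 1 to the maximum is reached from a position attaining the maximum by going down
-- one letter at a time.
packed-intro : ∀ {n} {w : Word n} → (∀ i → 1 ≤ lookup w i) →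
               (∀ i k → lookup w i ≡ suc (suc k) → ∃ λ j → lookup w j ≡ suc k) → Packed w
packed-intro {n} {w} positive pred = VecAllₚ.lookup⁻ positive , occurs
  where
  descend : ∀ d i k → lookup w i ≡ suc (d ℕ.+ k) → ∃ λ j → lookup w j ≡ suc k
  descend zero    i k eq = i , eq
  descend (suc d) i k eq = let j , eq′ = pred i _ eq in descend d j k eq′
  occurs : ∀ (a : Fin (maxW w)) → suc (toℕ a) ∈ᵛ w
  occurs a with max-attained w
  ... | inj₁ m≡0 = ⊥-elim (Finₚ.¬Fin0 (≡.subst Fin m≡0 a))
  ... | inj₂ (i , eq) =
    let d , p = ℕₚ.m≤n⇒∃[o]m+o≡n (Finₚ.toℕ<n a)
        j , q = descend d i (toℕ a) (≡.trans eq (≡.trans (≡.sym p) (≡.cong suc (ℕₚ.+-comm (toℕ a) d))))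
    in  ≡.subst (_∈ᵛ w) q (VecMem.∈-lookup j w)

-- All kinds of packing are described through this relation, because a packed word is determined by
-- the strict order which it induces on positions.
Orders : ∀ {n r} → Word n → (Fin n → Fin n → Set r) → Set r
Orders z R = ∀ i j → lookup z i < lookup z j ⇔ R i j

-- Below a letter k + 2 of one word there is a position with letter k + 1. Its letter in the other
-- word is at least k + 1 by induction and strictly smaller, so letters of either word are bounded
-- by those of the other.
packed-unique : ∀ {n} {y z : Word n} → Packed y → Packed z →
                Orders y (λ i j → lookup z i < lookup z j) → y ≡ z
packed-unique {n} {y} {z} y-packed z-packed y~z =
  lookup-ext (λ i → ℕₚ.≤-antisym (below y-packed z-packed (λ i j → to⇔ (y~z i j)) _ i ≡.refl)
                           (below z-packed y-packed (λ i j → from⇔ (y~z i j)) _ i ≡.refl))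
  where
  below : ∀ {y z : Word n} → Packed y → Packed z → (∀ i j → lookup y i < lookup y j → lookup z i < lookup z j) →
          ∀ k j → lookup y j ≡ k → k ≤ lookup z j
  below p q mono zero          j eq = z≤n
  below p q mono (suc zero)    j eq = packed⇒positive q j
  below {y} p q mono (suc (suc k)) j eq =
    let i , eq′ = packed⇒letter p k (ℕₚ.≤-trans (ℕₚ.n≤1+n _) (ℕₚ.≤-trans (ℕₚ.≤-reflexive (≡.sym eq)) (lookup≤max y j)))
    in  ℕₚ.≤-trans (s≤s (below p q mono (suc k) i eq′))
                (mono i j (≡.subst₂ _<_ (≡.sym eq′) (≡.sym eq) ℕₚ.≤-refl))

-- Packing over an arbitrary strict total order.

module _ {c ℓ} (S : Setoid c ℓ) where
  open Setoid S
  open SetoidMembership S using () renaming (_∈_ to _∈ₛ_)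
  open SetoidUnique S using () renaming (Unique to Uniqueₛ)

  ∈-─ : ∀ {x y ys} → y ∈ₛ ys → (p : x ∈ₛ ys) → ¬ (x ≈ y) → y ∈ₛ (ys ─ p)
  ∈-─ (here y≈z) (here x≈z) x≉y = contradiction (trans x≈z (sym y≈z)) x≉y
  ∈-─ (here y≈z) (there p)  x≉y = here y≈z
  ∈-─ (there q)  (here _)   x≉y = q
  ∈-─ (there q)  (there p)  x≉y = there (∈-─ q p x≉y)

  unique-⊆⇒length≤ : ∀ {xs ys} → Uniqueₛ xs → (∀ {x} → x ∈ₛ xs → x ∈ₛ ys) → length xs ≤ length ys
  unique-⊆⇒length≤ [] _ = z≤n
  unique-⊆⇒length≤ {x ∷ xs} {ys} (x≉ ∷ u) ⊆ys =
    ℕₚ.≤-trans (s≤s (unique-⊆⇒length≤ u λ y∈ → ∈-─ (⊆ys (there y∈)) (⊆ys (here refl)) (fresh y∈)))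
            (ℕₚ.≤-reflexive (≡.sym (Listₚ.length-removeAt′ ys (Any.index (⊆ys (here refl))))))
    where
    fresh : ∀ {y} → y ∈ₛ xs → ¬ (x ≈ y)
    fresh y∈ x≈y = let x≉z , y≈z = All.lookupAny x≉ y∈ in x≉z (trans x≈y y≈z)

module _ {a ℓ₁ ℓ₂} (O : StrictTotalOrder a ℓ₁ ℓ₂) where
  private module O = StrictTotalOrder O

  argmax : ∀ {n p} {P : Fin n → Set p} (w : Fin n → O.Carrier) → (∀ i → Dec (P i)) → ∃ P →
           ∃ λ m → P m × ∀ i → P i → ¬ (w m O.< w i)
  argmax {zero}          w P? (() , _)
  argmax {suc n} {P = P} w P? (i , pi) with Finₚ.any? (λ i → P? (suc i))
  ... | no ¬P = zero , P0 i pi , λ where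
      zero    _ → O.irrefl O.Eq.refl
      (suc j) p → contradiction (j , p) ¬P
    where
    P0 : ∀ i → P i → P zero
    P0 zero    p = p
    P0 (suc j) p = contradiction (j , p) ¬P
  ... | yes ∃P with argmax (λ i → w (suc i)) (λ i → P? (suc i)) ∃P
  ...   | m , pm , max with P? zero
  ...     | no ¬p0 = suc m , pm , λ where
              zero    p → contradiction p ¬p0
              (suc j) p → max j p
  ...     | yes p0 with w (suc m) O.<? w zero
  ...       | no m≮0 = suc m , pm , λ where
                zero    _ → m≮0
                (suc j) p → max j p
  ...       | yes m<0 = zero , p0 , λ where
                zero    _ → O.irrefl O.Eq.refl
                (suc j) p 0<j → max j p (O.trans m<0 0<j)

  module _ {n} (w : Vec O.Carrier n) where
    open SetoidMembership O.Eq.setoid using () renaming (_∈_ to _∈ₛ_)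
    open SetoidUnique O.Eq.setoid using () renaming (Unique to Uniqueₛ)

    -- Repeats the function local to `packOver`, so that `lookup-packOver` is an instance of
    -- `lookup-map`.
    lettersBelow : O.Carrier → List O.Carrier
    lettersBelow b = List.deduplicate O._≟_ (List.filter (O._<? b) (Vec.toList w))

    rank : O.Carrier → ℕ
    rank b = suc (length (lettersBelow b))

    lookup-packOver : ∀ i → lookup (packOver O w) i ≡ rank (lookup w i)
    lookup-packOver i = lookup-map i rank w

    private
      at : Fin n → O.Carrier
      at = lookup w

      toList⁺ : ∀ {m} (v : Vec O.Carrier m) i {b} → b O.≈ lookup v i → b ∈ₛ Vec.toList v
      toList⁺ (x ∷ v) zero    eq = here eq
      toList⁺ (x ∷ v) (suc i) eq = there (toList⁺ v i eq)

      toList⁻ : ∀ {m} (v : Vec O.Carrier m) {b} → b ∈ₛ Vec.toList v → ∃ λ i → b O.≈ lookup v i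
      toList⁻ (x ∷ v) (here eq) = zero , eq
      toList⁻ (x ∷ v) (there p) = let i , eq = toList⁻ v p in suc i , eq

      below-unique : ∀ b → Uniqueₛ (lettersBelow b)
      below-unique b = UniqueDec.deduplicate-! O.decSetoid _

      below⁺ : ∀ i {b c} → b O.≈ at i → b O.< c → b ∈ₛ lettersBelow c
      below⁺ i {b} {c} b≈ b<c = Memₛ.∈-deduplicate⁺ O.Eq.setoid O._≟_
        (λ z≈y x≈y → O.Eq.trans x≈y (O.Eq.sym z≈y))
        (Memₛ.∈-filter⁺ O.Eq.setoid (O._<? c) O.<-respˡ-≈ (toList⁺ w i b≈) b<c)

      below⁻ : ∀ {b c} → b ∈ₛ lettersBelow c → (∃ λ i → b O.≈ at i) × b O.< c
      below⁻ {b} {c} b∈ =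
        let p , b<c = Memₛ.∈-filter⁻ O.Eq.setoid (O._<? c) O.<-respˡ-≈ (Memₛ.∈-deduplicate⁻ O.Eq.setoid O._≟_ _ b∈)
        in  toList⁻ w p , b<c

      length≤ : ∀ {xs ys} → Uniqueₛ xs → (∀ {x} → x ∈ₛ xs → x ∈ₛ ys) → length xs ≤ length ys
      length≤ = unique-⊆⇒length≤ O.Eq.setoid

      unique-∷ : ∀ i → Uniqueₛ (at i ∷ lettersBelow (at i))
      unique-∷ i = All.tabulateₛ O.Eq.setoid (λ b∈ at≈b → O.irrefl (O.Eq.sym at≈b) (proj₂ (below⁻ b∈))) ∷ below-unique _

    -- The letters below `at i`, together with `at i` itself, are distinct letters below `c`.
    rank-mono : ∀ {i c} → at i O.< c → rank (at i) < rank c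
    rank-mono {i} {c} i<c = s≤s (length≤ (unique-∷ i) λ where
      (here b≈)  → below⁺ i b≈ (O.<-respˡ-≈ (O.Eq.sym b≈) i<c)
      (there b∈) → let (j , b≈) , b<i = below⁻ b∈ in below⁺ j b≈ (O.trans b<i i<c))

    rank-cong : ∀ {b c} → b O.≈ c → rank b ≡ rank c
    rank-cong b≈c = ≡.cong suc (ℕₚ.≤-antisym (half b≈c) (half (O.Eq.sym b≈c)))
      where
      half : ∀ {b c} → b O.≈ c → length (lettersBelow b) ≤ length (lettersBelow c)
      half b≈c = length≤ (below-unique _) λ x∈ →
        let (j , x≈) , x<b = below⁻ x∈ in below⁺ j x≈ (O.<-respʳ-≈ b≈c x<b)

    rank-reflects : ∀ i j → rank (at i) < rank (at j) → at i O.< at j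
    rank-reflects i j r<r with O.compare (at i) (at j)
    ... | tri< lt _ _ = lt
    ... | tri≈ _ eq _ = contradiction r<r (ℕₚ.<-irrefl (rank-cong eq))
    ... | tri> _ _ gt = contradiction r<r (ℕₚ.<-asym (rank-mono {j} gt))

    rank-injective : ∀ i j → rank (at i) ≡ rank (at j) → at i O.≈ at j
    rank-injective i j eq with O.compare (at i) (at j)
    ... | tri< lt _ _ = contradiction (rank-mono {i} lt) (ℕₚ.<-irrefl eq)
    ... | tri≈ _ e _  = e
    ... | tri> _ _ gt = contradiction (rank-mono {j} gt) (ℕₚ.<-irrefl (≡.sym eq))

    -- The largest letter below at i has the preceding rank.
    rank-pred : ∀ i k → rank (at i) ≡ suc (suc k) → ∃ λ j → rank (at j) ≡ suc k
    rank-pred i k eq with lettersBelow (at i) in below≡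
    ... | b ∷ bs = m , ≡.cong suc (ℕₚ.suc-injective (≡.trans (≡.sym (ℕₚ.≤-antisym upper lower)) (ℕₚ.suc-injective eq)))
      where
      below-i : ∃ λ j → at j O.< at i
      below-i = let (j , b≈) , b<i = below⁻ (≡.subst (b ∈ₛ_) (≡.sym below≡) (here O.Eq.refl))
                in  j , O.<-respˡ-≈ b≈ b<i
      maximal = argmax at (λ j → at j O.<? at i) below-i
      m : Fin n
      m = proj₁ maximal
      m<i : at m O.< at i
      m<i = proj₁ (proj₂ maximal)
      upper : suc (length bs) ≤ suc (length (lettersBelow (at m)))
      upper = ≡.subst (λ l → length l ≤ suc (length (lettersBelow (at m)))) below≡ (length≤ (below-unique (at i)) ⊆m∷)
        where
        ⊆m∷ : ∀ {x} → x ∈ₛ lettersBelow (at i) → x ∈ₛ at m ∷ lettersBelow (at m)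
        ⊆m∷ {x} x∈ with below⁻ x∈
        ... | (j , x≈) , x<i with O.compare x (at m)
        ...   | tri< x<m _ _ = there (below⁺ j x≈ x<m)
        ...   | tri≈ _ x≈m _ = here x≈m
        ...   | tri> _ _ m<x = contradiction (O.<-respʳ-≈ x≈ m<x) (proj₂ (proj₂ maximal) j (O.<-respˡ-≈ x≈ x<i))
      lower : suc (length (lettersBelow (at m))) ≤ suc (length bs)
      lower = ≡.subst (λ l → suc (length (lettersBelow (at m))) ≤ length l) below≡ (ℕ.s≤s⁻¹ (rank-mono {m} m<i))

    packOver-orders : Orders (packOver O w) (λ i j → at i O.< at j)
    packOver-orders i j rewrite lookup-packOver i | lookup-packOver j = mk⇔ (rank-reflects i j) (rank-mono {i})

    packOver-≡⇔ : ∀ i j → lookup (packOver O w) i ≡ lookup (packOver O w) j ⇔ at i O.≈ at j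
    packOver-≡⇔ i j rewrite lookup-packOver i | lookup-packOver j = mk⇔ (rank-injective i j) rank-cong

    packOver-packed : Packed (packOver O w)
    packOver-packed = packed-intro
      (λ i → ≡.subst (1 ≤_) (≡.sym (lookup-packOver i)) (s≤s z≤n))
      (λ i k eq → let j , p = rank-pred i k (≡.trans (≡.sym (lookup-packOver i)) eq)
                  in  j , ≡.trans (lookup-packOver j) p)

    packOver≡⇔ : ∀ {z} → Packed z → packOver O w ≡ z ⇔ Orders z (λ i j → at i O.< at j)
    packOver≡⇔ {z} z-packed = mk⇔ (λ { ≡.refl → packOver-orders }) λ z~ →
      packed-unique packOver-packed z-packed λ i j → mk⇔
        (λ lt → from⇔ (z~ i j) (to⇔ (packOver-orders i j) lt))
        (λ lt → from⇔ (packOver-orders i j) (to⇔ (z~ i j) lt))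

-- Packed biwords and the lexicographic order.

Lex : ∀ {n} → Word n → (Fin n → Fin n → Set) → Fin n → Fin n → Set
Lex u R i j = lookup u i < lookup u j ⊎ (lookup u i ≡ lookup u j × R i j)

LetterLt : ∀ {n} → Word n → Fin n → Fin n → Set
LetterLt v i j = lookup v i < lookup v j

pack≡⇔ : ∀ {n} (w : Word n) {z} → Packed z → pack w ≡ z ⇔ Orders z (LetterLt w)
pack≡⇔ w = packOver≡⇔ <-strictTotalOrder w

packBiword-packed : ∀ {n} (u v : Word n) → Packed (packBiword u v)
packBiword-packed u v = packOver-packed (×-strictTotalOrder <-strictTotalOrder <-strictTotalOrder) (Vec.zip u v)

packBiword≡⇔ : ∀ {n} (u v : Word n) {z} → Packed z → packBiword u v ≡ z ⇔ Orders z (Lex u (LetterLt v))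
packBiword≡⇔ u v {z} z-packed = mk⇔
  (λ eq i j → ≡.subst₂ (rel i j) (lookup-zip i u v) (lookup-zip j u v) (to⇔ E eq i j))
  (λ z~ → from⇔ E λ i j → ≡.subst₂ (rel i j) (≡.sym (lookup-zip i u v)) (≡.sym (lookup-zip j u v)) (z~ i j))
  where
  O₂ = ×-strictTotalOrder <-strictTotalOrder <-strictTotalOrder
  E = packOver≡⇔ O₂ (Vec.zip u v) z-packed
  rel : Fin _ → Fin _ → ℕ × ℕ → ℕ × ℕ → Set
  rel i j p q = lookup z i < lookup z j ⇔ StrictTotalOrder._<_ O₂ p q

packBiword-orders : ∀ {n} (u v : Word n) → Orders (packBiword u v) (Lex u (LetterLt v))
packBiword-orders u v = to⇔ (packBiword≡⇔ u v (packBiword-packed u v)) ≡.refl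

packBiword-≡⇔ : ∀ {n} (u v : Word n) i j →
  lookup (packBiword u v) i ≡ lookup (packBiword u v) j ⇔ (lookup u i ≡ lookup u j × lookup v i ≡ lookup v j)
packBiword-≡⇔ u v i j = ≡.subst₂
  (λ p q → lookup (packBiword u v) i ≡ lookup (packBiword u v) j ⇔ StrictTotalOrder._≈_ O₂ p q)
  (lookup-zip i u v) (lookup-zip j u v)
  (packOver-≡⇔ O₂ (Vec.zip u v) i j)
  where O₂ = ×-strictTotalOrder <-strictTotalOrder <-strictTotalOrder

-- Coefficients and values of polynomials.

module Evaluation {c ℓ} (R : CommutativeRing c ℓ) where
  open CommutativeRing R
  open Polynomials rawRing
  open Sums R
  open import Algebra.Properties.Ring (CommutativeRing.ring R) using (-0#≈0#; -‿+-comm; -‿distribʳ-*)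
  open import Algebra.Solver.Ring.NaturalCoefficients.Default commutativeSemiring
  private
    module Sᵖ = FiniteSums polyRing
  open import Relation.Binary.Reasoning.Setoid setoid

  coeff-+ᵖ : ∀ p q k → coeff (p +ᵖ q) k ≈ coeff p k + coeff q k
  coeff-+ᵖ []      q       k       = sym (+-identityˡ _)
  coeff-+ᵖ (a ∷ p) []      k       = sym (+-identityʳ _)
  coeff-+ᵖ (a ∷ p) (b ∷ q) zero    = refl
  coeff-+ᵖ (a ∷ p) (b ∷ q) (suc k) = coeff-+ᵖ p q k

  coeff-map-* : ∀ a p k → coeff (List.map (a *_) p) k ≈ a * coeff p k
  coeff-map-* a []      k       = sym (zeroʳ a)
  coeff-map-* a (b ∷ p) zero    = refl
  coeff-map-* a (b ∷ p) (suc k) = coeff-map-* a p k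

  coeff-map-neg : ∀ p k → coeff (List.map -_ p) k ≈ - coeff p k
  coeff-map-neg []      k       = sym -0#≈0#
  coeff-map-neg (b ∷ p) zero    = refl
  coeff-map-neg (b ∷ p) (suc k) = coeff-map-neg p k

  coeff-∷*ᵖ : ∀ a p q k → coeff ((a ∷ p) *ᵖ q) k ≈ a * coeff q k + coeff (0# ∷ p *ᵖ q) k
  coeff-∷*ᵖ a p q k = trans (coeff-+ᵖ (List.map (a *_) q) _ k) (+-congʳ (coeff-map-* a q k))

  coeff-const-*ᵖ : ∀ a q k → coeff (const a *ᵖ q) k ≈ a * coeff q k
  coeff-const-*ᵖ a q k = trans (coeff-∷*ᵖ a [] q k) (trans (+-congˡ (zero-tail k)) (+-identityʳ _))
    where
    zero-tail : ∀ k → coeff (0# ∷ []) k ≈ 0#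
    zero-tail zero    = refl
    zero-tail (suc k) = refl

  coeff-∑ : ∀ {a} {A : Set a} (xs : List A) (f : A → Poly) k → coeff (Sᵖ.∑ xs f) k ≈ ∑ xs (λ x → coeff (f x) k)
  coeff-∑ []       f k = refl
  coeff-∑ (x ∷ xs) f k = trans (coeff-+ᵖ (f x) _ k) (+-congˡ (coeff-∑ xs f k))

  -- Orders of vanishing at 0 add up and the lowest coefficients multiply. Both claims are kept
  -- together, because the second is what an induction over a product needs.
  coeff-*ᵖ-low : ∀ p q r → coeff p 0 ≈ 0# → (∀ i → i ℕ.< r → coeff q i ≈ 0#) →
                 coeff (p *ᵖ q) (suc r) ≈ coeff p 1 * coeff q r × (∀ i → i ℕ.< suc r → coeff (p *ᵖ q) i ≈ 0#)
  coeff-*ᵖ-low p q r p0 q< = top p p0 , low p p0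
    where
    vanish : ∀ p i → i ℕ.< r → coeff (p *ᵖ q) i ≈ 0#
    vanish []      i       i< = refl
    vanish (a ∷ p) zero    i< = trans (coeff-∷*ᵖ a p q 0) (trans (+-identityʳ _) (trans (*-congˡ (q< 0 i<)) (zeroʳ a)))
    vanish (a ∷ p) (suc i) i< = trans (coeff-∷*ᵖ a p q (suc i))
      (trans (+-cong (trans (*-congˡ (q< _ i<)) (zeroʳ a)) (vanish p i (ℕₚ.<-trans (ℕₚ.n<1+n i) i<))) (+-identityʳ _))
    lead : ∀ p → coeff (p *ᵖ q) r ≈ coeff p 0 * coeff q r
    lead []      = sym (zeroˡ _)
    lead (a ∷ p) = trans (coeff-∷*ᵖ a p q r) (trans (+-congˡ (tail r ℕₚ.≤-refl)) (+-identityʳ _))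
      where
      tail : ∀ j → j ℕ.≤ r → coeff (0# ∷ p *ᵖ q) j ≈ 0#
      tail zero    _   = refl
      tail (suc j) j<r = vanish p j j<r
    top : ∀ p → coeff p 0 ≈ 0# → coeff (p *ᵖ q) (suc r) ≈ coeff p 1 * coeff q r
    top []      _   = sym (zeroˡ _)
    top (a ∷ p) a≈0 = trans (coeff-∷*ᵖ a p q (suc r))
      (trans (+-cong (trans (*-congʳ a≈0) (zeroˡ _)) (lead p)) (+-identityˡ _))
    low : ∀ p → coeff p 0 ≈ 0# → ∀ i → i ℕ.< suc r → coeff (p *ᵖ q) i ≈ 0#
    low []      _   i       _  = refl
    low (a ∷ p) a≈0 zero    i< = trans (coeff-∷*ᵖ a p q 0) (trans (+-identityʳ _) (trans (*-congʳ a≈0) (zeroˡ _)))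
    low (a ∷ p) a≈0 (suc i) i< = trans (coeff-∷*ᵖ a p q (suc i))
      (trans (+-cong (trans (*-congʳ a≈0) (zeroˡ _)) (vanish p i (ℕ.s≤s⁻¹ i<))) (+-identityˡ _))

  -- This extracts logarithm coefficients from a product of binomials: with as many factors as the
  -- exponent of t, each divisible by t, only the linear terms can contribute.
  coeff-∏-low : ∀ {a} {A : Set a} (xs : List A) (f : A → Poly) → (∀ {x} → x ∈ xs → coeff (f x) 0 ≈ 0#) →
                coeff (Sᵖ.∏ xs f) (length xs) ≈ ∏ xs (λ x → coeff (f x) 1)
  coeff-∏-low xs f f0 = proj₁ (go xs f0)
    where
    go : ∀ xs → (∀ {x} → x ∈ xs → coeff (f x) 0 ≈ 0#) →
         coeff (Sᵖ.∏ xs f) (length xs) ≈ ∏ xs (λ x → coeff (f x) 1) ×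
         (∀ i → i ℕ.< length xs → coeff (Sᵖ.∏ xs f) i ≈ 0#)
    go []       f0 = refl , λ _ ()
    go (x ∷ xs) f0 =
      let top , low = go xs (λ x∈ → f0 (there x∈))
          top′ , low′ = coeff-*ᵖ-low (f x) (Sᵖ.∏ xs f) (length xs) (f0 (here ≡.refl)) low
      in  trans top′ (*-congˡ top) , low′

  eval : Carrier → Poly → Carrier
  eval x []      = 0#
  eval x (a ∷ p) = a + x * eval x p

  eval-const : ∀ x a → eval x (const a) ≈ a
  eval-const x a = trans (+-congˡ (zeroʳ x)) (+-identityʳ a)

  eval-+ᵖ : ∀ x p q → eval x (p +ᵖ q) ≈ eval x p + eval x q
  eval-+ᵖ x []      q       = sym (+-identityˡ _)
  eval-+ᵖ x (a ∷ p) []      = sym (+-identityʳ _)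
  eval-+ᵖ x (a ∷ p) (b ∷ q) = trans (+-congˡ (*-congˡ (eval-+ᵖ x p q))) (lemma a b x (eval x p) (eval x q))
    where
    lemma : ∀ a b x p q → (a + b) + x * (p + q) ≈ (a + x * p) + (b + x * q)
    lemma = solve 5 (λ a b x p q → (a :+ b) :+ x :* (p :+ q) := (a :+ x :* p) :+ (b :+ x :* q)) refl

  eval-map-* : ∀ x a p → eval x (List.map (a *_) p) ≈ a * eval x p
  eval-map-* x a []      = sym (zeroʳ a)
  eval-map-* x a (b ∷ p) = trans (+-congˡ (*-congˡ (eval-map-* x a p))) (lemma a b x (eval x p))
    where
    lemma : ∀ a b x p → a * b + x * (a * p) ≈ a * (b + x * p)
    lemma = solve 4 (λ a b x p → a :* b :+ x :* (a :* p) := a :* (b :+ x :* p)) refl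

  eval-map-neg : ∀ x p → eval x (List.map -_ p) ≈ - eval x p
  eval-map-neg x []      = sym -0#≈0#
  eval-map-neg x (b ∷ p) =
    trans (+-congˡ (trans (*-congˡ (eval-map-neg x p)) (sym (-‿distribʳ-* x _)))) (-‿+-comm b _)

  eval-*ᵖ : ∀ x p q → eval x (p *ᵖ q) ≈ eval x p * eval x q
  eval-*ᵖ x []      q = sym (zeroˡ _)
  eval-*ᵖ x (a ∷ p) q = begin
    eval x (List.map (a *_) q +ᵖ (0# ∷ (p *ᵖ q)))                  ≈⟨ eval-+ᵖ x (List.map (a *_) q) _ ⟩
    eval x (List.map (a *_) q) + (0# + x * eval x (p *ᵖ q))        ≈⟨ +-cong (eval-map-* x a q) (+-congˡ (*-congˡ (eval-*ᵖ x p q))) ⟩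
    a * eval x q + (0# + x * (eval x p * eval x q))                ≈⟨ lemma a x (eval x p) (eval x q) ⟩
    (a + x * eval x p) * eval x q                                  ∎
    where
    lemma : ∀ a x p q → a * q + (0# + x * (p * q)) ≈ (a + x * p) * q
    lemma = solve 4 (λ a x p q → a :* q :+ (con 0 :+ x :* (p :* q)) := (a :+ x :* p) :* q) refl

  eval-∑ : ∀ {a} {A : Set a} x (xs : List A) (f : A → Poly) → eval x (Sᵖ.∑ xs f) ≈ ∑ xs (λ y → eval x (f y))
  eval-∑ x []       f = refl
  eval-∑ x (y ∷ xs) f = trans (eval-+ᵖ x (f y) _) (+-congˡ (eval-∑ x xs f))

  eval-∏ : ∀ {a} {A : Set a} x (xs : List A) (f : A → Poly) → eval x (Sᵖ.∏ xs f) ≈ ∏ xs (λ y → eval x (f y))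
  eval-∏ x []       f = eval-const x 1#
  eval-∏ x (y ∷ xs) f = trans (eval-*ᵖ x (f y) _) (*-congˡ (eval-∏ x xs f))

  -- The quotient of p by t - x.
  quotient : Carrier → Poly → Poly
  quotient x []          = []
  quotient x (a ∷ [])    = []
  quotient x (a ∷ b ∷ p) = eval x (b ∷ p) ∷ quotient x (b ∷ p)

  length-quotient : ∀ x a p → length (quotient x (a ∷ p)) ≡ length p
  length-quotient x a []      = ≡.refl
  length-quotient x a (b ∷ p) = ≡.cong suc (length-quotient x b p)

  -- (y - x) q(y) = p(y) - p(x), with both sides moved so that no subtraction occurs.
  quotient-* : ∀ x y p → y * eval y (quotient x p) + eval x p ≈ x * eval y (quotient x p) + eval y p
  quotient-* x y []          = +-congʳ (trans (zeroʳ y) (sym (zeroʳ x)))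
  quotient-* x y (a ∷ [])    =
    solve 3 (λ x y a → y :* con 0 :+ (a :+ x :* con 0) := x :* con 0 :+ (a :+ y :* con 0)) refl x y a
  quotient-* x y (a ∷ b ∷ p) = begin
    y * (r + y * s) + (a + x * r)
      ≈⟨ solve 5 (λ r s x y a → y :* (r :+ y :* s) :+ (a :+ x :* r) := (a :+ x :* r) :+ y :* (y :* s :+ r))
           refl r s x y a ⟩
    (a + x * r) + y * (y * s + r)  ≈⟨ +-congˡ (*-congˡ (quotient-* x y (b ∷ p))) ⟩
    (a + x * r) + y * (x * s + r′)
      ≈⟨ solve 6 (λ r s x y a r′ → (a :+ x :* r) :+ y :* (x :* s :+ r′) := x :* (r :+ y :* s) :+ (a :+ y :* r′))
           refl r s x y a r′ ⟩
    x * (r + y * s) + (a + y * r′) ∎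
    where
    r = eval x (b ∷ p)
    r′ = eval y (b ∷ p)
    s = eval y (quotient x (b ∷ p))

  -- The coefficients of the quotient are the values at `x` of the proper tails of `p`, as in
  -- Horner's scheme. Hence `q≈0` provides the vanishing value required for each tail in turn.
  quotient≈0 : ∀ x p → (∀ k → coeff (quotient x p) k ≈ 0#) → eval x p ≈ 0# → ∀ k → coeff p k ≈ 0#
  quotient≈0 x []          q≈0 p≈0 k       = refl
  quotient≈0 x (a ∷ [])    q≈0 p≈0 zero    = trans (sym (eval-const x a)) p≈0
  quotient≈0 x (a ∷ [])    q≈0 p≈0 (suc k) = refl
  quotient≈0 x (a ∷ b ∷ p) q≈0 p≈0 zero    =
    trans (sym (trans (+-congˡ (trans (*-congˡ (q≈0 0)) (zeroʳ x))) (+-identityʳ a))) p≈0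
  quotient≈0 x (a ∷ b ∷ p) q≈0 p≈0 (suc k) = quotient≈0 x (b ∷ p) (λ i → q≈0 (suc i)) (q≈0 0) k

-- Polynomials over a field of characteristic 0 are determined by their values at the natural
-- numbers.

module Characteristic0 {c ℓ₁ ℓ₂} (K : HeytingField c ℓ₁ ℓ₂) (char0 : CharacteristicZero K) where
  R : CommutativeRing c ℓ₁
  R = HeytingCommutativeRing.commutativeRing (HeytingField.heytingCommutativeRing K)
  open CommutativeRing R
  open CharZero K char0 using (1/)
  open Polynomials rawRing
  open Evaluation R
  open import Algebra.Properties.Semiring.Mult semiring using (×-homo-+; ×1-homo-*) renaming (_×_ to _ℕ×_)
  open import Algebra.Properties.Ring (CommutativeRing.ring R) using (-0#≈0#)
  open import Algebra.Properties.Group +-group using (x∙y⁻¹≈ε⇒x≈y) renaming (∙-cancelˡ to +-cancelˡ)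
  open import Relation.Binary.Reasoning.Setoid setoid

  ι : ℕ → Carrier
  ι n = n ℕ× 1#

  ι-+ : ∀ m n → ι (m ℕ.+ n) ≈ ι m + ι n
  ι-+ = ×-homo-+ 1#

  ι-* : ∀ m n → ι (m ℕ.* n) ≈ ι m * ι n
  ι-* = ×1-homo-*

  1/-inverse : ∀ n .{{_ : NonZero n}} → 1/ n * ι n ≈ 1#
  1/-inverse n = trans (*-congˡ (sym (lemma (ι n)))) (proj₁ (proj₂ (HeytingField.#⇒invertible K (char0 n))))
    where
    lemma : ∀ x → x - 0# ≈ x
    lemma x = trans (+-congˡ -0#≈0#) (+-identityʳ x)

  ι-cancelˡ : ∀ n .{{_ : NonZero n}} {x y} → ι n * x ≈ ι n * y → x ≈ y
  ι-cancelˡ n {x} {y} eq = trans (sym (absorb x)) (trans (*-congˡ eq) (absorb y))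
    where
    absorb : ∀ x → 1/ n * (ι n * x) ≈ x
    absorb x = trans (sym (*-assoc _ _ _)) (trans (*-congʳ (1/-inverse n)) (*-identityˡ x))

  -- Divide by t - k: the quotient vanishes at all numbers from k + 1 on, since their differences to
  -- k are positive integers and can be cancelled. This shift is why the roots start at an arbitrary
  -- `k`. The bound `d` carries the induction, the quotient being shorter but no part of `p`.
  vanishing : ∀ d p k → length p ≤ d → (∀ n → eval (ι (k ℕ.+ n)) p ≈ 0#) → ∀ i → coeff p i ≈ 0#
  vanishing d       []      k _         p≈0 i = refl
  vanishing (suc d) (a ∷ p) k (s≤s p≤d) p≈0 =
    quotient≈0 (ι k) (a ∷ p)
      (vanishing d (quotient (ι k) (a ∷ p)) (suc k) (≡.subst (_≤ d) (≡.sym (length-quotient (ι k) a p)) p≤d) q≈0)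
      (≡.subst (λ m → eval (ι m) (a ∷ p) ≈ 0#) (ℕₚ.+-identityʳ k) (p≈0 0))
    where
    q≈0 : ∀ n → eval (ι (suc k ℕ.+ n)) (quotient (ι k) (a ∷ p)) ≈ 0#
    q≈0 n = ι-cancelˡ (suc n) (trans (+-cancelˡ (ι k * q) _ _ (begin
      ι k * q + ι (suc n) * q                 ≈⟨ distribʳ q _ _ ⟨
      (ι k + ι (suc n)) * q                   ≈⟨ *-congʳ (ι-+ k (suc n)) ⟨
      ι (k ℕ.+ suc n) * q                     ≡⟨ ≡.cong (λ m → ι m * q) (ℕₚ.+-suc k n) ⟩
      ι (suc k ℕ.+ n) * q                     ≈⟨ +-identityʳ _ ⟨
      ι (suc k ℕ.+ n) * q + 0#                ≈⟨ +-congˡ (≡.subst (λ m → eval (ι m) (a ∷ p) ≈ 0#) (ℕₚ.+-identityʳ k) (p≈0 0)) ⟨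
      ι (suc k ℕ.+ n) * q + eval (ι k) (a ∷ p)  ≈⟨ quotient-* (ι k) (ι (suc k ℕ.+ n)) (a ∷ p) ⟩
      ι k * q + eval (ι (suc k ℕ.+ n)) (a ∷ p)  ≈⟨ +-congˡ (≡.subst (λ m → eval (ι m) (a ∷ p) ≈ 0#) (ℕₚ.+-suc k n) (p≈0 (suc n))) ⟩
      ι k * q + 0#                            ∎)) (sym (zeroʳ _)))
      where q = eval (ι (suc k ℕ.+ n)) (quotient (ι k) (a ∷ p))

  eval-injective : ∀ p q → (∀ n → eval (ι n) p ≈ eval (ι n) q) → p ≈ᵖ q
  eval-injective p q p≈q i = x∙y⁻¹≈ε⇒x≈y _ _ (trans
    (sym (trans (coeff-+ᵖ p (List.map -_ q) i) (+-congˡ (coeff-map-neg q i))))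
    (vanishing _ (p +ᵖ List.map -_ q) 0 ℕₚ.≤-refl (λ n → trans (eval-+ᵖ (ι n) p _)
      (trans (+-cong (p≈q n) (eval-map-neg (ι n) q)) (-‿inverseʳ _))) i))

-- Formal series in noncommuting letters and the substitution of power series.

module FormalSeries {c ℓ} (R : CommutativeRing c ℓ) {A : Set} (_≟_ : DecidableEquality A) where
  open CommutativeRing R
  open Sums R
  open import Algebra.Properties.CommutativeSemigroup *-commutativeSemigroup using (x∙yz≈y∙xz)
  open import Algebra.Properties.CommutativeSemigroup +-commutativeSemigroup using () renaming (interchange to +-interchange)
  open import Algebra.Solver.Ring.NaturalCoefficients.Default commutativeSemiring
  open import Relation.Binary.Reasoning.Setoid setoid

  Ser : Set c
  Ser = List A → Carrier

  infix  4 _≈ˢ_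
  infixl 7 _⋆_

  _≈ˢ_ : Ser → Ser → Set ℓ
  f ≈ˢ g = ∀ w → f w ≈ g w

  one : Ser
  one []      = 1#
  one (_ ∷ _) = 0#

  ∂ : A → Ser → Ser
  ∂ a f w = f (a ∷ w)

  -- The Cauchy product, written as a Leibniz rule for `∂` rather than as a sum over factorisations,
  -- so that its laws follow by induction on the word.
  _⋆_ : Ser → Ser → Ser
  (f ⋆ g) []      = f [] * g []
  (f ⋆ g) (a ∷ w) = f [] * g (a ∷ w) + (∂ a f ⋆ g) w

  ⋆-cong-on : ∀ {p} (P : A → Set p) {f f′ g g′ : Ser} →
              (∀ {w} → All P w → f w ≈ f′ w) → (∀ {w} → All P w → g w ≈ g′ w) →
              ∀ {w} → All P w → (f ⋆ g) w ≈ (f′ ⋆ g′) w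
  ⋆-cong-on P f≈ g≈ []         = *-cong (f≈ []) (g≈ [])
  ⋆-cong-on P f≈ g≈ (pa ∷ all) =
    +-cong (*-cong (f≈ []) (g≈ (pa ∷ all))) (⋆-cong-on P (λ all′ → f≈ (pa ∷ all′)) g≈ all)

  ⋆-cong : ∀ {f f′ g g′} → f ≈ˢ f′ → g ≈ˢ g′ → f ⋆ g ≈ˢ f′ ⋆ g′
  ⋆-cong f≈ g≈ []      = *-cong (f≈ []) (g≈ [])
  ⋆-cong f≈ g≈ (a ∷ w) = +-cong (*-cong (f≈ []) (g≈ (a ∷ w))) (⋆-cong (λ v → f≈ (a ∷ v)) g≈ w)

  ⋆-+ˡ : ∀ f f′ g → (λ w → f w + f′ w) ⋆ g ≈ˢ λ w → (f ⋆ g) w + (f′ ⋆ g) w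
  ⋆-+ˡ f f′ g []      = distribʳ _ _ _
  ⋆-+ˡ f f′ g (a ∷ w) = trans (+-cong (distribʳ _ _ _) (⋆-+ˡ (∂ a f) (∂ a f′) g w)) (+-interchange _ _ _ _)

  ⋆-+ʳ : ∀ f g g′ → f ⋆ (λ w → g w + g′ w) ≈ˢ λ w → (f ⋆ g) w + (f ⋆ g′) w
  ⋆-+ʳ f g g′ []      = distribˡ _ _ _
  ⋆-+ʳ f g g′ (a ∷ w) = trans (+-cong (distribˡ _ _ _) (⋆-+ʳ (∂ a f) g g′ w)) (+-interchange _ _ _ _)

  ⋆-*ˡ : ∀ k f g → (λ w → k * f w) ⋆ g ≈ˢ λ w → k * (f ⋆ g) w
  ⋆-*ˡ k f g []      = *-assoc _ _ _
  ⋆-*ˡ k f g (a ∷ w) = trans (+-cong (*-assoc _ _ _) (⋆-*ˡ k (∂ a f) g w)) (sym (distribˡ _ _ _))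

  ⋆-*ʳ : ∀ k f g → f ⋆ (λ w → k * g w) ≈ˢ λ w → k * (f ⋆ g) w
  ⋆-*ʳ k f g []      = x∙yz≈y∙xz _ _ _
  ⋆-*ʳ k f g (a ∷ w) = trans (+-cong (x∙yz≈y∙xz _ _ _) (⋆-*ʳ k (∂ a f) g w)) (sym (distribˡ _ _ _))

  ⋆-zeroˡ : ∀ {f} g → (∀ w → f w ≈ 0#) → ∀ w → (f ⋆ g) w ≈ 0#
  ⋆-zeroˡ g f≈0 []      = trans (*-congʳ (f≈0 [])) (zeroˡ _)
  ⋆-zeroˡ g f≈0 (a ∷ w) =
    trans (+-cong (trans (*-congʳ (f≈0 [])) (zeroˡ _)) (⋆-zeroˡ g (λ v → f≈0 (a ∷ v)) w)) (+-identityʳ _)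

  ⋆-assoc : ∀ f g h → (f ⋆ g) ⋆ h ≈ˢ f ⋆ (g ⋆ h)
  ⋆-assoc f g h []      = *-assoc _ _ _
  ⋆-assoc f g h (a ∷ w) = begin
    (f [] * g []) * h (a ∷ w) + (∂ a (f ⋆ g) ⋆ h) w
      ≈⟨ +-congˡ (trans (⋆-+ˡ _ _ h w) (+-cong (⋆-*ˡ (f []) (∂ a g) h w) (⋆-assoc (∂ a f) g h w))) ⟩
    (f [] * g []) * h (a ∷ w) + (f [] * (∂ a g ⋆ h) w + (∂ a f ⋆ (g ⋆ h)) w)
      ≈⟨ solve 5 (λ x y z s t → (x :* y) :* z :+ (x :* s :+ t) := x :* (y :* z :+ s) :+ t) refl _ _ _ _ _ ⟩
    f [] * (g [] * h (a ∷ w) + (∂ a g ⋆ h) w) + (∂ a f ⋆ (g ⋆ h)) w ∎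

  ⋆-identityˡ : ∀ f → one ⋆ f ≈ˢ f
  ⋆-identityˡ f []      = *-identityˡ _
  ⋆-identityˡ f (a ∷ w) = trans (+-cong (*-identityˡ _) (⋆-zeroˡ f (λ _ → refl) w)) (+-identityʳ _)

  ⋆-identityʳ : ∀ f → f ⋆ one ≈ˢ f
  ⋆-identityʳ f []      = *-identityʳ _
  ⋆-identityʳ f (a ∷ w) = trans (+-cong (zeroʳ _) (⋆-identityʳ (∂ a f) w)) (+-identityˡ _)

  ∏ˢ : ∀ {i} {I : Set i} → List I → (I → Ser) → Ser
  ∏ˢ is F = List.foldr (λ i G → F i ⋆ G) one is

  ∏ˢ-cong : ∀ {i} {I : Set i} (is : List I) {F G : I → Ser} → (∀ i → F i ≈ˢ G i) → ∏ˢ is F ≈ˢ ∏ˢ is G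
  ∏ˢ-cong []       F≈G w = refl
  ∏ˢ-cong (i ∷ is) F≈G w = ⋆-cong (F≈G i) (∏ˢ-cong is F≈G) w

  ∏ˢ-++ : ∀ {i} {I : Set i} (is js : List I) (F : I → Ser) → ∏ˢ (is ++ js) F ≈ˢ ∏ˢ is F ⋆ ∏ˢ js F
  ∏ˢ-++ []       js F w = sym (⋆-identityˡ _ w)
  ∏ˢ-++ (i ∷ is) js F w =
    trans (⋆-cong (λ _ → refl) (∏ˢ-++ is js F) w) (sym (⋆-assoc (F i) (∏ˢ is F) (∏ˢ js F) w))

  ∏ˢ-map : ∀ {i j} {I : Set i} {J : Set j} (h : I → J) is (F : J → Ser) → ∏ˢ (List.map h is) F ≡ ∏ˢ is (F ∘ h)
  ∏ˢ-map h []       F = ≡.refl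
  ∏ˢ-map h (i ∷ is) F = ≡.cong (F (h i) ⋆_) (∏ˢ-map h is F)

  ∏ˢ-cartesianProduct : ∀ {i j} {I : Set i} {J : Set j} (is : List I) (js : List J) (F : I × J → Ser) →
    ∏ˢ (List.cartesianProduct is js) F ≈ˢ ∏ˢ is (λ i → ∏ˢ js (λ j → F (i , j)))
  ∏ˢ-cartesianProduct []       js F w = refl
  ∏ˢ-cartesianProduct (i ∷ is) js F w = trans
    (∏ˢ-++ (List.map (i ,_) js) _ F w)
    (⋆-cong (λ v → reflexive (≡.cong (λ f → f v) (∏ˢ-map (i ,_) js F))) (∏ˢ-cartesianProduct is js F) w)

  power : Ser → ℕ → Ser
  power f zero    = one
  power f (suc m) = f ⋆ power f m

  ∏ˢ-const : ∀ {i} {I : Set i} (is : List I) f → ∏ˢ is (λ _ → f) ≡ power f (length is)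
  ∏ˢ-const []       f = ≡.refl
  ∏ˢ-const (i ∷ is) f = ≡.cong (f ⋆_) (∏ˢ-const is f)

  1+ : A → Ser
  1+ b []          = 1#
  1+ b (c ∷ [])    = 𝟙 (b ≟ c)
  1+ b (_ ∷ _ ∷ _) = 0#

  1+-⋆-∷ : ∀ b F c w → (1+ b ⋆ F) (c ∷ w) ≈ F (c ∷ w) + 𝟙 (b ≟ c) * F w
  1+-⋆-∷ b F c w = +-cong (*-identityˡ _) (trans (⋆-cong ∂1+ (λ _ → refl) w)
    (trans (⋆-*ˡ (𝟙 (b ≟ c)) one F w) (*-congˡ (⋆-identityˡ F w))))
    where
    ∂1+ : ∂ c (1+ b) ≈ˢ λ v → 𝟙 (b ≟ c) * one v
    ∂1+ []      = sym (*-identityʳ _)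
    ∂1+ (_ ∷ _) = sym (zeroʳ _)

  -- Substitution of l(a) = ∑ₖ≥₁ l k aᵏ for every letter a: the coefficient of w in the result is
  -- the sum over the factorisations of w into powers a₁^k₁ ⋯ aₛ^kₛ of l k₁ ⋯ l kₛ · f (a₁ ⋯ aₛ).
  -- In "run f a k w" a power of a is being read, of which k letters are already known.
  module Substitution (l : ℕ → Carrier) where

    run : Ser → A → ℕ → Ser
    run f a k []      = l k * f []
    run f a k (b ∷ w) = 𝟙 (a ≟ b) * run f a (suc k) w + l k * run (∂ b f) b 1 w

    sub : Ser → Ser
    sub f []      = f []
    sub f (a ∷ w) = run (∂ a f) a 1 w

    run-cong : ∀ {f g} → f ≈ˢ g → ∀ a k → run f a k ≈ˢ run g a k
    run-cong f≈g a k []      = *-congˡ (f≈g [])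
    run-cong f≈g a k (b ∷ w) =
      +-cong (*-congˡ (run-cong f≈g a (suc k) w)) (*-congˡ (run-cong (λ v → f≈g (b ∷ v)) b 1 w))

    -- The combination `x * f + g` is the shape of `∂ b (f ⋆ g)`, the series that has to be run
    -- after a letter of a product.
    run-linear : ∀ x f g a k → run (λ w → x * f w + g w) a k ≈ˢ λ w → x * run f a k w + run g a k w
    run-linear x f g a k []      = solve 4 (λ l x f g → l :* (x :* f :+ g) := x :* (l :* f) :+ l :* g) refl _ _ _ _
    run-linear x f g a k (b ∷ w) = trans
      (+-cong (*-congˡ (run-linear x f g a (suc k) w)) (*-congˡ (run-linear x (∂ b f) (∂ b g) b 1 w)))
      (solve 7 (λ e l x f g f′ g′ → e :* (x :* f :+ g) :+ l :* (x :* f′ :+ g′) :=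
                                    x :* (e :* f :+ l :* f′) :+ (e :* g :+ l :* g′)) refl _ _ _ _ _ _ _)

    run-zero : ∀ {f} → (∀ w → f w ≈ 0#) → ∀ a k w → run f a k w ≈ 0#
    run-zero f≈0 a k []      = trans (*-congˡ (f≈0 [])) (zeroʳ _)
    run-zero f≈0 a k (b ∷ w) = trans
      (+-cong (trans (*-congˡ (run-zero f≈0 a (suc k) w)) (zeroʳ _))
              (trans (*-congˡ (run-zero (λ v → f≈0 (b ∷ v)) b 1 w)) (zeroʳ _))) (+-identityʳ _)

    -- The power being read belongs to `f`. When it ends, either the next power also belongs to `f`,
    -- or `f` is closed by `f []` and the whole remaining word is left to `sub g`; a power never
    -- straddles the seam.
    run-⋆ : ∀ f g a k → run (f ⋆ g) a k ≈ˢ run f a k ⋆ sub g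
    run-⋆ f g a k []      = sym (*-assoc _ _ _)
    run-⋆ f g a k (b ∷ w) = begin
      e * run (f ⋆ g) a (suc k) w + l k * run (∂ b (f ⋆ g)) b 1 w
        ≈⟨ +-cong (*-congˡ (run-⋆ f g a (suc k) w))
                  (*-congˡ (trans (run-linear (f []) (∂ b g) (∂ b f ⋆ g) b 1 w) (+-congˡ (run-⋆ (∂ b f) g b 1 w)))) ⟩
      e * (run f a (suc k) ⋆ sub g) w + l k * (f [] * sub g (b ∷ w) + (run (∂ b f) b 1 ⋆ sub g) w)
        ≈⟨ solve 6 (λ e x l f s y → e :* x :+ l :* (f :* s :+ y) := (l :* f) :* s :+ (e :* x :+ l :* y)) refl _ _ _ _ _ _ ⟩
      (l k * f []) * sub g (b ∷ w) + (e * (run f a (suc k) ⋆ sub g) w + l k * (run (∂ b f) b 1 ⋆ sub g) w)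
        ≈⟨ +-congˡ (sym (trans (⋆-+ˡ _ _ (sub g) w) (+-cong (⋆-*ˡ _ _ (sub g) w) (⋆-*ˡ _ _ (sub g) w)))) ⟩
      (l k * f []) * sub g (b ∷ w) + (∂ b (run f a k) ⋆ sub g) w ∎
      where e = 𝟙 (a ≟ b)

    sub-⋆ : ∀ f g → sub (f ⋆ g) ≈ˢ sub f ⋆ sub g
    sub-⋆ f g []      = refl
    sub-⋆ f g (b ∷ w) = trans (run-linear (f []) (∂ b g) (∂ b f ⋆ g) b 1 w) (+-congˡ (run-⋆ (∂ b f) g b 1 w))

    sub-one : sub one ≈ˢ one
    sub-one []      = refl
    sub-one (a ∷ w) = run-zero (λ _ → refl) a 1 w

    sub-∏ˢ : ∀ {i} {I : Set i} (is : List I) (F : I → Ser) → sub (∏ˢ is F) ≈ˢ ∏ˢ is (λ i → sub (F i))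
    sub-∏ˢ []       F w = sub-one w
    sub-∏ˢ (i ∷ is) F w = trans (sub-⋆ (F i) _ w) (⋆-cong (λ _ → refl) (sub-∏ˢ is F) w)

-- Binomial coefficients, the logarithm and the exponential as power series.

module Binomials {c ℓ₁ ℓ₂} (K : HeytingField c ℓ₁ ℓ₂) (char0 : CharacteristicZero K) where
  open Characteristic0 K char0
  open CommutativeRing R
  open CharZero K char0 using (1/; binom)
  open Polynomials rawRing
  open Sums R
  open Evaluation R
  open import Algebra.Properties.Group +-group using () renaming (∙-cancelʳ to +-cancelʳ)
  open import Algebra.Solver.Ring.NaturalCoefficients.Default commutativeSemiring
  open import Relation.Binary.Reasoning.Setoid setoid

  private
    -- (k + 1) y = (x - k) p, with k p moved to the left.
    step : ∀ k x p y → y ≈ 1/ (suc k) * ((x - ι k) * p) → ι (suc k) * y + ι k * p ≈ x * p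
    step k x p y eq = begin
      ι (suc k) * y + ι k * p                                ≈⟨ +-congʳ (*-congˡ eq) ⟩
      ι (suc k) * (1/ (suc k) * ((x - ι k) * p)) + ι k * p
        ≈⟨ solve 6 (λ i n x m k p → i :* (n :* ((x :+ m) :* p)) :+ k :* p := (n :* i) :* ((x :+ m) :* p) :+ k :* p)
             refl (ι (suc k)) (1/ (suc k)) x (- ι k) (ι k) p ⟩
      (1/ (suc k) * ι (suc k)) * ((x - ι k) * p) + ι k * p   ≈⟨ +-congʳ (trans (*-congʳ (1/-inverse (suc k))) (*-identityˡ _)) ⟩
      (x - ι k) * p + ι k * p
        ≈⟨ solve 4 (λ x m k p → (x :+ m) :* p :+ k :* p := x :* p :+ (m :+ k) :* p)
             refl x (- ι k) (ι k) p ⟩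
      x * p + (- ι k + ι k) * p                              ≈⟨ +-congˡ (trans (*-congʳ (-‿inverseˡ _)) (zeroˡ p)) ⟩
      x * p + 0#                                             ≈⟨ +-identityʳ _ ⟩
      x * p                                                  ∎

  coeff-binom-zero : ∀ k → coeff (binom (suc k)) 0 ≈ 0#
  coeff-binom-zero k = trans (coeff-const-*ᵖ (1/ (suc k)) ((t +ᵖ const (- ι k)) *ᵖ binom k) 0)
    (trans (*-congˡ (trans (coeff-∷*ᵖ _ (1# ∷ []) (binom k) 0) (trans (+-identityʳ _) (factor k)))) (zeroʳ _))
    where
    factor : ∀ k → (0# + - ι k) * coeff (binom k) 0 ≈ 0#
    factor zero    = trans (*-congʳ (-‿inverseʳ 0#)) (zeroˡ _)
    factor (suc k) = trans (*-congˡ (coeff-binom-zero k)) (zeroʳ _)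

  -- The coefficients of log(1 + x).
  l : ℕ → Carrier
  l k = coeff (binom k) 1

  δ₀ : ℕ → Carrier
  δ₀ zero    = 1#
  δ₀ (suc _) = 0#

  coeff-binom-0 : ∀ k → coeff (binom k) 0 ≈ δ₀ k
  coeff-binom-0 zero    = refl
  coeff-binom-0 (suc k) = coeff-binom-zero k

  -- Coefficient by coefficient this is (1 + x) l′ = 1, the differential equation of log(1 + x). It
  -- is read off the linear coefficient in the recursion of `binom`: in (t - k) binom(t, k) that
  -- coefficient is -k · l k + binom(0, k).
  l-rec : ∀ k → ι (suc k) * l (suc k) + ι k * l k ≈ δ₀ k
  l-rec k = begin
    ι (suc k) * l (suc k) + ι k * l k                 ≈⟨ +-congʳ (*-congˡ coefficient) ⟩
    ι (suc k) * (1/ (suc k) * ((- ι k) * l k + δ₀ k)) + ι k * l k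
      ≈⟨ solve 6 (λ i n m k p d → i :* (n :* (m :* p :+ d)) :+ k :* p := (n :* i) :* (m :* p :+ d) :+ k :* p)
           refl (ι (suc k)) (1/ (suc k)) (- ι k) (ι k) (l k) (δ₀ k) ⟩
    (1/ (suc k) * ι (suc k)) * ((- ι k) * l k + δ₀ k) + ι k * l k ≈⟨ +-congʳ (trans (*-congʳ (1/-inverse (suc k))) (*-identityˡ _)) ⟩
    ((- ι k) * l k + δ₀ k) + ι k * l k
      ≈⟨ solve 4 (λ m k p d → (m :* p :+ d) :+ k :* p := (m :+ k) :* p :+ d)
           refl (- ι k) (ι k) (l k) (δ₀ k) ⟩
    (- ι k + ι k) * l k + δ₀ k                       ≈⟨ +-congʳ (trans (*-congʳ (-‿inverseˡ _)) (zeroˡ _)) ⟩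
    0# + δ₀ k                                        ≈⟨ +-identityˡ _ ⟩
    δ₀ k                                             ∎
    where
    coefficient : l (suc k) ≈ 1/ (suc k) * ((- ι k) * l k + δ₀ k)
    coefficient = trans (coeff-const-*ᵖ (1/ (suc k)) ((t +ᵖ const (- ι k)) *ᵖ binom k) 1)
      (*-congˡ (trans (coeff-∷*ᵖ _ (1# ∷ []) (binom k) 1)
        (+-cong (*-congʳ (+-identityˡ _)) (trans (coeff-const-*ᵖ 1# (binom k) 0) (trans (*-identityˡ _) (coeff-binom-0 k))))))

  eval-binom-rec : ∀ x k → ι (suc k) * eval x (binom (suc k)) + ι k * eval x (binom k) ≈ x * eval x (binom k)
  eval-binom-rec x k = step k x (eval x (binom k)) _
    (trans (eval-*ᵖ x (const (1/ (suc k))) ((t +ᵖ const (- ι k)) *ᵖ binom k))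
      (*-cong (eval-const x _) (trans (eval-*ᵖ x (t +ᵖ const (- ι k)) (binom k)) (*-congʳ linear))))
    where
    linear : eval x (t +ᵖ const (- ι k)) ≈ x - ι k
    linear = trans (eval-+ᵖ x t (const (- ι k))) (+-cong
      (trans (+-identityˡ _) (trans (*-congˡ (eval-const x 1#)) (*-identityʳ x))) (eval-const x _))

  choose : ℕ → ℕ → Carrier
  choose m k = eval (ι m) (binom k)

  choose-zero : ∀ m → choose m 0 ≈ 1#
  choose-zero m = eval-const (ι m) 1#

  choose-rec : ∀ m k → ι (suc k) * choose m (suc k) + ι k * choose m k ≈ ι m * choose m k
  choose-rec m k = eval-binom-rec (ι m) k

  choose-zero-suc : ∀ k → choose 0 (suc k) ≈ 0#
  choose-zero-suc k = ι-cancelˡ (suc k) (trans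
    (trans (sym (+-identityʳ _)) (trans (+-congˡ (sym (low k))) (choose-rec 0 k)))
    (trans (zeroˡ _) (sym (zeroʳ _))))
    where
    low : ∀ k → ι k * choose 0 k ≈ 0#
    low zero    = zeroˡ _
    low (suc k) = trans (*-congˡ (choose-zero-suc k)) (zeroʳ _)

  -- Induction on `k`. Multiplying by k + 1 clears the inverse contained in `binom`, after which
  -- `choose-rec` for m and for m + 1 reduces the claim to the previous one.
  pascal : ∀ m k → choose (suc m) (suc k) ≈ choose m k + choose m (suc k)
  pascal m k = ι-cancelˡ (suc k) (+-cancelʳ (ι k * choose (suc m) k) _ _
    (trans (choose-rec (suc m) k) (sym (go k))))
    where
    go : ∀ k → ι (suc k) * (choose m k + choose m (suc k)) + ι k * choose (suc m) k ≈ ι (suc m) * choose (suc m) k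
    go zero = begin
      ι 1 * (choose m 0 + choose m 1) + 0# * choose (suc m) 0
        ≈⟨ solve 3 (λ a b c → (con 1 :+ con 0) :* (a :+ b) :+ con 0 :* c := (con 1 :+ con 0) :* b :+ con 0 :* a :+ a) refl _ _ _ ⟩
      ι 1 * choose m 1 + 0# * choose m 0 + choose m 0  ≈⟨ +-congʳ (choose-rec m 0) ⟩
      ι m * choose m 0 + choose m 0                    ≈⟨ +-cong (*-congˡ (choose-zero m)) (choose-zero m) ⟩
      ι m * 1# + 1#                                    ≈⟨ solve 1 (λ m → m :* con 1 :+ con 1 := (con 1 :+ m) :* con 1) refl (ι m) ⟩
      ι (suc m) * 1#                                   ≈⟨ *-congˡ (choose-zero (suc m)) ⟨
      ι (suc m) * choose (suc m) 0                     ∎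
    go (suc k) = begin
      ι (2 ℕ.+ k) * (b₁ + b₂) + ι (suc k) * choose (suc m) (suc k)
        ≈⟨ +-congˡ (*-congˡ (pascal m k)) ⟩
      ι (2 ℕ.+ k) * (b₁ + b₂) + ι (suc k) * (b₀ + b₁)
        ≈⟨ solve 4 (λ k b₀ b₁ b₂ → (con 1 :+ (con 1 :+ k)) :* (b₁ :+ b₂) :+ (con 1 :+ k) :* (b₀ :+ b₁) :=
             ((con 1 :+ (con 1 :+ k)) :* b₂ :+ (con 1 :+ k) :* b₁) :+ b₁ :+ (((con 1 :+ k) :* b₁ :+ k :* b₀) :+ b₀)) refl (ι k) b₀ b₁ b₂ ⟩
      (ι (2 ℕ.+ k) * b₂ + ι (suc k) * b₁) + b₁ + ((ι (suc k) * b₁ + ι k * b₀) + b₀)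
        ≈⟨ +-cong (+-congʳ (choose-rec m (suc k))) (+-congʳ (choose-rec m k)) ⟩
      ι m * b₁ + b₁ + (ι m * b₀ + b₀)
        ≈⟨ solve 3 (λ m b₀ b₁ → m :* b₁ :+ b₁ :+ (m :* b₀ :+ b₀) := (con 1 :+ m) :* (b₀ :+ b₁)) refl (ι m) b₀ b₁ ⟩
      ι (suc m) * (b₀ + b₁)
        ≈⟨ *-congˡ (pascal m k) ⟨
      ι (suc m) * choose (suc m) (suc k) ∎
      where
      b₀ = choose m k
      b₁ = choose m (suc k)
      b₂ = choose m (2 ℕ.+ k)

  1/! : ℕ → Carrier
  1/! n = 1/ (n !) {{n !≢0}}

  1/!-zero : 1/! 0 ≈ 1#
  1/!-zero = trans (sym (trans (*-congˡ (+-identityʳ 1#)) (*-identityʳ _))) (1/-inverse 1)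

  1/!-suc : ∀ n → ι (suc n) * 1/! (suc n) ≈ 1/! n
  1/!-suc n = ι-cancelˡ (n !) {{n !≢0}} (begin
    ι (n !) * (ι (suc n) * 1/! (suc n))   ≈⟨ solve 3 (λ a b c → a :* (b :* c) := c :* (b :* a)) refl _ _ _ ⟩
    1/! (suc n) * (ι (suc n) * ι (n !))   ≈⟨ *-congˡ (ι-* (suc n) (n !)) ⟨
    1/! (suc n) * ι (suc n !)             ≈⟨ 1/-inverse (suc n !) {{suc n !≢0}} ⟩
    1#                                    ≈⟨ 1/-inverse (n !) {{n !≢0}} ⟨
    1/! n * ι (n !)                       ≈⟨ *-comm _ _ ⟩
    ι (n !) * 1/! n                       ∎)

  conv : (ℕ → Carrier) → (ℕ → Carrier) → ℕ → Carrier
  conv f g zero    = f 0 * g 0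
  conv f g (suc n) = f 0 * g (suc n) + conv (f ∘ suc) g n

  conv-cong : ∀ {f f′ g g′} → (∀ n → f n ≈ f′ n) → (∀ n → g n ≈ g′ n) → ∀ n → conv f g n ≈ conv f′ g′ n
  conv-cong f≈ g≈ zero    = *-cong (f≈ 0) (g≈ 0)
  conv-cong f≈ g≈ (suc n) = +-cong (*-cong (f≈ 0) (g≈ (suc n))) (conv-cong (f≈ ∘ suc) g≈ n)

  conv-linearˡ : ∀ x f f′ g n → conv (λ i → x * f i + f′ i) g n ≈ x * conv f g n + conv f′ g n
  conv-linearˡ x f f′ g zero    = solve 4 (λ x f f′ g → (x :* f :+ f′) :* g := x :* (f :* g) :+ f′ :* g) refl _ _ _ _
  conv-linearˡ x f f′ g (suc n) = trans (+-congˡ (conv-linearˡ x (f ∘ suc) (f′ ∘ suc) g n))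
    (solve 6 (λ x f f′ g c c′ → (x :* f :+ f′) :* g :+ (x :* c :+ c′) := x :* (f :* g :+ c) :+ (f′ :* g :+ c′)) refl _ _ _ _ _ _)

  conv-linearʳ : ∀ x f g g′ n → conv f (λ i → x * g i + g′ i) n ≈ x * conv f g n + conv f g′ n
  conv-linearʳ x f g g′ zero    = solve 4 (λ x f g g′ → f :* (x :* g :+ g′) := x :* (f :* g) :+ f :* g′) refl _ _ _ _
  conv-linearʳ x f g g′ (suc n) = trans (+-congˡ (conv-linearʳ x (f ∘ suc) g g′ n))
    (solve 6 (λ x f g g′ c c′ → f :* (x :* g :+ g′) :+ (x :* c :+ c′) := x :* (f :* g :+ c) :+ (f :* g′ :+ c′)) refl _ _ _ _ _ _)

  conv-suc : ∀ f g n → conv f g (suc n) ≈ f (suc n) * g 0 + conv f (g ∘ suc) n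
  conv-suc f g zero    = +-comm _ _
  conv-suc f g (suc n) = trans (+-congˡ (conv-suc (f ∘ suc) g n))
    (solve 3 (λ a b c → a :+ (b :+ c) := b :+ (a :+ c)) refl _ _ _)

  conv-δ₀ : ∀ g n → conv δ₀ g n ≈ g n
  conv-δ₀ g zero    = *-identityˡ _
  conv-δ₀ g (suc n) = trans (+-cong (*-identityˡ _) (zeros g n)) (+-identityʳ _)
    where
    zeros : ∀ g n → conv (λ _ → 0#) g n ≈ 0#
    zeros g zero    = zeroˡ _
    zeros g (suc n) = trans (+-cong (zeroˡ _) (zeros g n)) (+-identityʳ _)

  -- On sequences of coefficients `θ` is x d/dx and `D` is d/dx. As `D f n` is `θ f (suc n)`, the
  -- product rule for `D` is a shift of the one for `θ`.
  θ D Δ : (ℕ → Carrier) → ℕ → Carrier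
  θ f n = ι n * f n
  D f n = ι (suc n) * f (suc n)
  -- (1 + x) d/dx
  Δ f n = D f n + θ f n

  θ-conv : ∀ f g n → θ (conv f g) n ≈ conv (θ f) g n + conv f (θ g) n
  θ-conv f g zero    = solve 2 (λ f g → con 0 :* (f :* g) := con 0 :* f :* g :+ f :* (con 0 :* g)) refl _ _
  θ-conv f g (suc n) = begin
    ι (suc n) * (f 0 * g (suc n) + conv f⁺ g n)
      ≈⟨ solve 4 (λ n f g c → (con 1 :+ n) :* (f :* g :+ c) := f :* ((con 1 :+ n) :* g) :+ (n :* c :+ c)) refl _ _ _ _ ⟩
    f 0 * θ g (suc n) + (θ (conv f⁺ g) n + conv f⁺ g n)
      ≈⟨ +-congˡ (+-congʳ (θ-conv f⁺ g n)) ⟩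
    f 0 * θ g (suc n) + ((conv (θ f⁺) g n + conv f⁺ (θ g) n) + conv f⁺ g n)
      ≈⟨ solve 6 (λ a b c d f g → a :+ ((b :+ c) :+ d) := (con 0 :* f :* g :+ (con 1 :* d :+ b)) :+ (a :+ c))
           refl _ _ _ _ (f 0) (g (suc n)) ⟩
    (0# * f 0 * g (suc n) + (1# * conv f⁺ g n + conv (θ f⁺) g n)) + (f 0 * θ g (suc n) + conv f⁺ (θ g) n)
      ≈⟨ +-congʳ (+-congˡ (trans (sym (conv-linearˡ 1# f⁺ (θ f⁺) g n))
           (conv-cong (λ i → solve 2 (λ f i → con 1 :* f :+ i :* f := (con 1 :+ i) :* f) refl (f⁺ i) (ι i)) (λ _ → refl) n))) ⟩
    (0# * f 0 * g (suc n) + conv (θ f ∘ suc) g n) + (f 0 * θ g (suc n) + conv f⁺ (θ g) n) ∎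
    where f⁺ = f ∘ suc

  D-conv : ∀ f g n → D (conv f g) n ≈ conv (D f) g n + conv f (D g) n
  D-conv f g n = begin
    θ (conv f g) (suc n)                                ≈⟨ θ-conv f g (suc n) ⟩
    conv (θ f) g (suc n) + conv f (θ g) (suc n)         ≈⟨ +-cong refl (conv-suc f (θ g) n) ⟩
    (0# * f 0 * g (suc n) + conv (D f) g n) + (f (suc n) * (0# * g 0) + conv f (D g) n)
      ≈⟨ solve 6 (λ a b c d e f → (con 0 :* a :* b :+ c) :+ (d :* (con 0 :* e) :+ f) := c :+ f) refl _ _ _ _ _ _ ⟩
    conv (D f) g n + conv f (D g) n                     ∎

  Δ-conv : ∀ f g n → Δ (conv f g) n ≈ conv (Δ f) g n + conv f (Δ g) n
  Δ-conv f g n = begin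
    D (conv f g) n + θ (conv f g) n ≈⟨ +-cong (D-conv f g n) (θ-conv f g n) ⟩
    (conv (D f) g n + conv f (D g) n) + (conv (θ f) g n + conv f (θ g) n)
      ≈⟨ solve 4 (λ a b c d → (a :+ b) :+ (c :+ d) := (con 1 :* a :+ c) :+ (con 1 :* b :+ d)) refl _ _ _ _ ⟩
    (1# * conv (D f) g n + conv (θ f) g n) + (1# * conv f (D g) n + conv f (θ g) n)
      ≈⟨ +-cong (trans (sym (conv-linearˡ 1# (D f) (θ f) g n)) (conv-cong (λ i → +-congʳ (*-identityˡ _)) (λ _ → refl) n))
                (trans (sym (conv-linearʳ 1# f (D g) (θ g) n)) (conv-cong (λ _ → refl) (λ i → +-congʳ (*-identityˡ _)) n)) ⟩
    conv (Δ f) g n + conv f (Δ g) n ∎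

  -- The series y j = ∑ᵢ lⁱ / (i + j)!, characterised by y j = 1/j! + l · y (j + 1).
  module Exponential (y : ℕ → ℕ → Carrier) (y-rec : ∀ j n → y j n ≈ 1/! j * δ₀ n + conv l (y (suc j)) n) where

    -- (1 + x) dy/dx, where (1 + x) dl/dx = 1.
    Δ-y : ∀ n j → Δ (y j) n + ι j * y (suc j) n ≈ y j n
    Δ-y n j = <-rec (λ n → ∀ j → Δ (y j) n + ι j * y (suc j) n ≈ y j n) body n j
      where
      open import Data.Nat.Induction using (<-rec)
      l0 : l 0 ≈ 0#
      l0 = refl
      -- As `l 0` vanishes, coefficient n of l · g depends only on the coefficients of g below n. So
      -- the equation for `y j` at n needs that for `y (suc j)` only at smaller indices, and strong
      -- induction on n for all j at once closes.
      conv-l-on< : ∀ n {g g′ : ℕ → Carrier} → (∀ {i} → i ℕ.< n → g i ≈ g′ i) → conv l g n ≈ conv l g′ n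
      conv-l-on< zero    g≈ = trans (trans (*-congʳ l0) (zeroˡ _)) (sym (trans (*-congʳ l0) (zeroˡ _)))
      conv-l-on< (suc n) {g} {g′} g≈ = +-cong (trans (trans (*-congʳ l0) (zeroˡ _)) (sym (trans (*-congʳ l0) (zeroˡ _))))
        (go (l ∘ suc) n ℕₚ.≤-refl)
        where
        go : ∀ f m → m ℕ.≤ n → conv f g m ≈ conv f g′ m
        go f zero    m≤ = *-congˡ (g≈ (ℕ.s≤s m≤))
        go f (suc m) m≤ = +-cong (*-congˡ (g≈ (ℕ.s≤s m≤))) (go (f ∘ suc) m (ℕₚ.≤-trans (ℕₚ.n≤1+n m) m≤))
      Δδ : ∀ n → Δ δ₀ n ≈ 0#
      Δδ zero    = trans (+-cong (zeroʳ _) (zeroˡ _)) (+-identityʳ _)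
      Δδ (suc n) = trans (+-cong (zeroʳ _) (zeroʳ _)) (+-identityʳ _)
      body : ∀ n → (∀ {i} → i ℕ.< n → ∀ j → Δ (y j) i + ι j * y (suc j) i ≈ y j i) →
             ∀ j → Δ (y j) n + ι j * y (suc j) n ≈ y j n
      body n ih j = begin
        Δ (y j) n + ι j * y₁ n
          ≈⟨ +-cong (+-cong (*-congˡ (y-rec j (suc n))) (*-congˡ (y-rec j n))) refl ⟩
        (ι (suc n) * (1/! j * δ₀ (suc n) + conv l y₁ (suc n)) + ι n * (1/! j * δ₀ n + conv l y₁ n)) + ι j * y₁ n
          ≈⟨ solve 9 (λ i n f d e c c′ j y → (i :* (f :* d :+ c) :+ n :* (f :* e :+ c′)) :+ j :* y :=
               f :* (i :* d :+ n :* e) :+ (i :* c :+ n :* c′) :+ j :* y) refl (ι (suc n)) (ι n) (1/! j) _ _ _ _ _ _ ⟩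
        1/! j * Δ δ₀ n + Δ (conv l y₁) n + ι j * y₁ n
          ≈⟨ +-congʳ (+-cong (trans (*-congˡ (Δδ n)) (zeroʳ _)) (Δ-conv l y₁ n)) ⟩
        0# + (conv (Δ l) y₁ n + conv l (Δ y₁) n) + ι j * y₁ n
          ≈⟨ +-congʳ (+-congˡ (+-congʳ (trans (conv-cong l-rec (λ _ → refl) n) (conv-δ₀ y₁ n)))) ⟩
        0# + (y₁ n + conv l (Δ y₁) n) + ι j * y₁ n
          ≈⟨ solve 3 (λ y c j → con 0 :+ (y :+ c) :+ j :* y := c :+ (con 1 :+ j) :* y) refl _ _ _ ⟩
        conv l (Δ y₁) n + ι (suc j) * y₁ n
          ≈⟨ +-congˡ (*-congˡ (y-rec (suc j) n)) ⟩
        conv l (Δ y₁) n + ι (suc j) * (1/! (suc j) * δ₀ n + conv l y₂ n)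
          ≈⟨ solve 5 (λ a i f d c → a :+ i :* (f :* d :+ c) := i :* f :* d :+ (i :* c :+ a)) refl _ _ _ _ _ ⟩
        ι (suc j) * 1/! (suc j) * δ₀ n + (ι (suc j) * conv l y₂ n + conv l (Δ y₁) n)
          ≈⟨ +-cong (*-congʳ (1/!-suc j)) (trans (sym (conv-linearʳ (ι (suc j)) l y₂ (Δ y₁) n))
               (conv-l-on< n (λ i<n → trans (+-comm _ _) (ih i<n (suc j))))) ⟩
        1/! j * δ₀ n + conv l y₁ n
          ≈⟨ y-rec j n ⟨
        y j n ∎
        where
        y₁ = y (suc j)
        y₂ = y (suc (suc j))

    y₀-zero : y 0 0 ≈ 1#
    y₀-zero = trans (y-rec 0 0) (trans (+-cong (trans (*-identityʳ _) 1/!-zero) (zeroˡ _)) (+-identityʳ _))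

    private
      y₀-rec : ∀ n → ι (suc n) * y 0 (suc n) + ι n * y 0 n ≈ y 0 n
      y₀-rec n = trans (sym (trans (+-congˡ (zeroˡ _)) (+-identityʳ _))) (Δ-y n 0)

    y₀-one : y 0 1 ≈ 1#
    y₀-one = trans (sym lhs) (trans (y₀-rec 0) y₀-zero)
      where
      lhs : ι 1 * y 0 1 + ι 0 * y 0 0 ≈ y 0 1
      lhs = solve 2 (λ a b → (con 1 :+ con 0) :* a :+ con 0 :* b := a) refl _ _

    -- The equation (1 + x) y′ = y reads (n + 1) y_(n+1) = (1 - n) y_n. It kills the coefficient at
    -- 2 and then every later one.
    y₀-high : ∀ n → y 0 (2 ℕ.+ n) ≈ 0#
    y₀-high zero = ι-cancelˡ 2 (trans (+-cancelʳ (ι 1 * y 0 1) _ _ (trans (y₀-rec 1)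
      (solve 1 (λ a → a := con 0 :+ (con 1 :+ con 0) :* a) refl _))) (sym (zeroʳ _)))
    y₀-high (suc n) = ι-cancelˡ (3 ℕ.+ n) (trans (sym (trans (+-congˡ (trans (*-congˡ (y₀-high n)) (zeroʳ _))) (+-identityʳ _)))
      (trans (trans (y₀-rec (2 ℕ.+ n)) (y₀-high n)) (sym (zeroʳ _))))

-- Substituting the logarithm into the exponential of a letter.

module LogExp {c ℓ₁ ℓ₂} (K : HeytingField c ℓ₁ ℓ₂) (char0 : CharacteristicZero K)
              {A : Set} (_≟_ : DecidableEquality A) where
  open Characteristic0 K char0
  open CommutativeRing R
  open Sums R
  open Binomials K char0
  open FormalSeries R _≟_
  open Substitution l
  open import Relation.Binary.Reasoning.Setoid setoid

  all≡? : ∀ a (w : List A) → Dec (All (_≡ a) w)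
  all≡? a = All.all? (_≟ a)

  -- The j-fold derivative of eᵃ in a, in the sense of ∂: its coefficient at aⁿ is 1/(j + n)!.
  exp : ℕ → A → Ser
  exp j a w = 𝟙 (all≡? a w) * 1/! (j ℕ.+ length w)

  ∂-exp-≡ : ∀ j a → ∂ a (exp j a) ≈ˢ exp (suc j) a
  ∂-exp-≡ j a w = *-cong
    (𝟙-cong (all≡? a (a ∷ w)) (all≡? a w) (λ { (_ ∷ p) → p }) (≡.refl ∷_))
    (reflexive (≡.cong 1/! (ℕₚ.+-suc j (length w))))

  ∂-exp-≢ : ∀ j {a b} → b ≢ a → ∀ w → ∂ b (exp j a) w ≈ 0#
  ∂-exp-≢ j {a} {b} b≢a w = trans (*-congʳ (𝟙-no (all≡? a (b ∷ w)) (λ { (p ∷ _) → b≢a p }))) (zeroˡ _)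

  private
    y : A → ℕ → ℕ → Carrier
    y a j n = sub (exp j a) (replicate n a)

    exp-[] : ∀ j a → exp j a [] ≈ 1/! j
    exp-[] j a = trans (*-identityˡ _) (reflexive (≡.cong 1/! (ℕₚ.+-identityʳ j)))

    run-exp : ∀ j a k n → run (exp j a) a k (replicate n a) ≈ conv (λ i → l (k ℕ.+ i)) (y a j) n
    run-exp j a k zero    = *-congʳ (reflexive (≡.cong l (≡.sym (ℕₚ.+-identityʳ k))))
    run-exp j a k (suc n) = trans (+-comm _ _) (+-cong
      (*-congʳ (reflexive (≡.cong l (≡.sym (ℕₚ.+-identityʳ k)))))
      (trans (*-congʳ (𝟙-yes (a ≟ a) ≡.refl)) (trans (*-identityˡ _) (trans (run-exp j a (suc k) n)
        (conv-cong (λ i → reflexive (≡.cong l (≡.sym (ℕₚ.+-suc k i)))) (λ _ → refl) n)))))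

    -- The first power is split off from aⁿ. The convolution also contains an empty first power,
    -- which contributes nothing because `l 0` vanishes.
    y-rec : ∀ a j n → y a j n ≈ 1/! j * δ₀ n + conv l (y a (suc j)) n
    y-rec a j zero    = trans (exp-[] j a) (sym (trans (+-cong (*-identityʳ _) (zeroˡ _)) (+-identityʳ _)))
    y-rec a j (suc n) = trans (run-cong (∂-exp-≡ j a) a 1 (replicate n a)) (trans (run-exp (suc j) a 1 n)
      (sym (trans (+-cong (zeroʳ _) (trans (+-congʳ (zeroˡ _)) (+-identityˡ _))) (+-identityˡ _))))

    -- Any factorisation of such a word contains a power of a letter other than `a`, and `exp j a`
    -- vanishes on words containing that letter.
    run-exp-mixed : ∀ j a k w → ¬ All (_≡ a) w → run (exp j a) a k w ≈ 0#
    sub-exp-mixed : ∀ j a w → ¬ All (_≡ a) w → sub (exp j a) w ≈ 0#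
    run-exp-mixed j a k []      ¬all = contradiction [] ¬all
    run-exp-mixed j a k (b ∷ w) ¬all = trans (+-cong first (trans (*-congˡ (sub-exp-mixed j a (b ∷ w) ¬all)) (zeroʳ _))) (+-identityʳ _)
      where
      first : 𝟙 (a ≟ b) * run (exp j a) a (suc k) w ≈ 0#
      first with a ≟ b
      ... | yes ≡.refl = trans (*-congˡ (run-exp-mixed j a (suc k) w (λ all → ¬all (≡.refl ∷ all)))) (zeroʳ _)
      ... | no _       = zeroˡ _
    sub-exp-mixed j a []      ¬all = contradiction [] ¬all
    sub-exp-mixed j a (b ∷ w) ¬all = head (b ≟ a)
      where
      head : Dec (b ≡ a) → sub (exp j a) (b ∷ w) ≈ 0#
      head (yes ≡.refl) =
        trans (run-cong (∂-exp-≡ j a) a 1 w) (run-exp-mixed (suc j) a 1 w (λ all → ¬all (≡.refl ∷ all)))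
      head (no b≢a)     = run-zero (∂-exp-≢ j b≢a) b 1 w

    constant : ∀ {a} {w : List A} → All (_≡ a) w → w ≡ replicate (length w) a
    constant []             = ≡.refl
    constant (≡.refl ∷ all) = ≡.cong (_ ∷_) (constant all)

    1+-mixed : ∀ a w → ¬ All (_≡ a) w → 1+ a w ≈ 0#
    1+-mixed a []          ¬all = contradiction [] ¬all
    1+-mixed a (b ∷ [])    ¬all = 𝟙-no (a ≟ b) (λ a≡b → ¬all (≡.sym a≡b ∷ []))
    1+-mixed a (_ ∷ _ ∷ _) ¬all = refl

    powers : ∀ a n → sub (exp 0 a) (replicate n a) ≈ 1+ a (replicate n a)
    powers a zero          = Exponential.y₀-zero (y a) (y-rec a)
    powers a (suc zero)    = trans (Exponential.y₀-one (y a) (y-rec a)) (sym (𝟙-yes (a ≟ a) ≡.refl))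
    powers a (suc (suc n)) = Exponential.y₀-high (y a) (y-rec a) n

  -- On powers of `a` this is exp(log(1 + x)) = 1 + x; on all other words both sides vanish.
  sub-exp : ∀ a → sub (exp 0 a) ≈ˢ 1+ a
  sub-exp a w with all≡? a w
  ... | yes all = ≡.subst (λ w → sub (exp 0 a) w ≈ 1+ a w) (≡.sym (constant all)) (powers a (length w))
  ... | no ¬all = trans (sub-exp-mixed 0 a w ¬all) (sym (1+-mixed a w ¬all))

-- Goldberg coefficients at natural numbers as coefficients of powers of a product of exponentials.

module Goldberg {c ℓ₁ ℓ₂} (K : HeytingField c ℓ₁ ℓ₂) (char0 : CharacteristicZero K) where
  open Characteristic0 K char0
  open CommutativeRing R
  open Sums R
  open Evaluation R
  open Binomials K char0
  open FormalSeries R _≟_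
  open LogExp K char0 _≟_ using (exp; all≡?)
  open CharZero K char0 using (_*ˢ_; _-ˢ_; _^ˢ_; oneˢ; expVar; expProduct; g; gᵗ; binom; _*ᵖ_; const)
  open import Relation.Binary.Reasoning.Setoid setoid
  open import Algebra.Properties.CommutativeSemigroup +-commutativeSemigroup using (x∙yz≈y∙xz)

  factorisations-∷ : ∀ (a : ℕ) w → List.zip (List.inits (a ∷ w)) (List.tails (a ∷ w)) ≡
    ([] , a ∷ w) ∷ List.map (λ (x , y) → (a ∷ x) , y) (List.zip (List.inits w) (List.tails w))
  factorisations-∷ a w = ≡.cong (([] , a ∷ w) ∷_) (≡.trans (lemma (List.inits w) (List.tails w)) ≡.refl)
    where
    lemma : ∀ (xs ys : List (List ℕ)) → List.zip (List.map (a ∷_) xs) ys ≡ List.map (λ (x , y) → (a ∷ x) , y) (List.zip xs ys)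
    lemma []       ys       = ≡.refl
    lemma (x ∷ xs) []       = ≡.refl
    lemma (x ∷ xs) (y ∷ ys) = ≡.cong (((a ∷ x) , y) ∷_) (lemma xs ys)

  *ˢ≈⋆ : ∀ f h → f *ˢ h ≈ˢ f ⋆ h
  *ˢ≈⋆ f h []      = +-identityʳ _
  *ˢ≈⋆ f h (a ∷ w) = trans
    (reflexive (≡.cong (λ ps → ∑ ps (λ (x , y) → f x * h y)) (factorisations-∷ a w)))
    (+-congˡ (trans (reflexive (∑-map _ (List.zip (List.inits w) (List.tails w)) _)) (*ˢ≈⋆ (∂ a f) h w)))

  oneˢ≈one : oneˢ ≈ˢ one
  oneˢ≈one []      = refl
  oneˢ≈one (_ ∷ _) = refl

  expVar≈exp : ∀ i → expVar i ≈ˢ exp 0 i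
  expVar≈exp i w with does (all≡? i w)
  ... | true  = sym (*-identityˡ _)
  ... | false = sym (zeroˡ _)

  exps : ℕ → Ser
  exps N = ∏ˢ [1⋯ N ] (exp 0)

  exps-suc : ∀ N → exps (suc N) ≈ˢ exps N ⋆ exp 0 (suc N)
  exps-suc N w = trans
    (reflexive (≡.cong (λ is → ∏ˢ is (exp 0) w) (≡.trans (≡.cong (List.map suc) (≡.sym (Listₚ.upTo-∷ʳ N)))
                                                          (Listₚ.map-++ suc (List.upTo N) (N ∷ [])))))
    (trans (∏ˢ-++ [1⋯ N ] (suc N ∷ []) (exp 0) w) (⋆-cong (λ _ → refl) (⋆-identityʳ _) w))

  expProduct≈exps : ∀ N → expProduct N ≈ˢ exps N
  expProduct≈exps zero    w = oneˢ≈one w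
  expProduct≈exps (suc N) w = trans (*ˢ≈⋆ _ _ w) (trans (⋆-cong (expProduct≈exps N) (expVar≈exp (suc N)) w) (sym (exps-suc N w)))

  exps-stable : ∀ {M N} w → M ℕ.≤′ N → All (_≤ M) w → exps N w ≈ exps M w
  exps-stable w ℕ.≤′-refl               w≤M = refl
  exps-stable w (ℕ.≤′-step {n = N} M≤N) w≤M = trans (exps-suc N w) (trans
    (⋆-cong-on (_≤ N) (λ _ → refl) trivial (All.map (λ p → ℕₚ.≤-trans p (ℕₚ.≤′⇒≤ M≤N)) w≤M))
    (trans (⋆-identityʳ _ w) (exps-stable w M≤N w≤M)))
    where
    trivial : ∀ {v} → All (_≤ N) v → exp 0 (suc N) v ≈ one v
    trivial []        = trans (*-identityˡ _) 1/!-zero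
    trivial {b ∷ v} (b≤ ∷ _) = trans (*-congʳ (𝟙-no (all≡? (suc N) (b ∷ v))
      (λ { (≡.refl ∷ _) → ℕₚ.1+n≰n b≤ }))) (zeroˡ _)

  max-bound : ∀ w → All (_≤ List.foldr ℕ._⊔_ 0 w) w
  max-bound []      = []
  max-bound (a ∷ w) = ℕₚ.m≤m⊔n a _ ∷ All.map (λ p → ℕₚ.≤-trans p (ℕₚ.m≤n⊔m a _)) (max-bound w)

  max-least : ∀ {N} w → All (_≤ N) w → List.foldr ℕ._⊔_ 0 w ≤ N
  max-least []      []         = z≤n
  max-least (a ∷ w) (a≤ ∷ w≤N) = ℕₚ.⊔-lub a≤ (max-least w w≤N)

  -- In `g` the number of exponentials depends on the word. Fixing one `N` for all words over a
  -- bounded alphabet replaces it by a finite product, to which the substitution can be applied.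
  g≈exps : ∀ {N w} → All (_≤ N) w → g w ≈ exps N w
  g≈exps {N} {w} w≤N = trans (expProduct≈exps (List.foldr ℕ._⊔_ 0 w) w) (sym (exps-stable w (ℕₚ.≤⇒≤′ (max-least w w≤N)) (max-bound w)))

  ^ˢ≈power : ∀ f k → f ^ˢ k ≈ˢ power f k
  ^ˢ≈power f zero    w = oneˢ≈one w
  ^ˢ≈power f (suc k) w = trans (*ˢ≈⋆ f (f ^ˢ k) w) (⋆-cong (λ _ → refl) (^ˢ≈power f k) w)

  ⋆-cong-length : ∀ h {f f′} w → (∀ v → length v ≤ length w → f v ≈ f′ v) → (h ⋆ f) w ≈ (h ⋆ f′) w
  ⋆-cong-length h []      f≈ = *-congˡ (f≈ [] z≤n)
  ⋆-cong-length h (a ∷ w) f≈ = +-cong (*-congˡ (f≈ (a ∷ w) ℕₚ.≤-refl))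
    (⋆-cong-length (∂ a h) w (λ v p → f≈ v (ℕₚ.≤-trans p (ℕₚ.n≤1+n _))))

  ⋆-vanish : ∀ h {f} w → (∀ v → length v ≤ length w → f v ≈ 0#) → (h ⋆ f) w ≈ 0#
  ⋆-vanish h []      f≈ = trans (*-congˡ (f≈ [] z≤n)) (zeroʳ _)
  ⋆-vanish h (a ∷ w) f≈ = trans (+-cong (trans (*-congˡ (f≈ (a ∷ w) ℕₚ.≤-refl)) (zeroʳ _))
    (⋆-vanish (∂ a h) w (λ v p → f≈ v (ℕₚ.≤-trans p (ℕₚ.n≤1+n _))))) (+-identityʳ _)

  -- Each of the `k` factors must consume at least one letter.
  power-vanish : ∀ {d} → d [] ≈ 0# → ∀ k w → length w < k → power d k w ≈ 0#
  power-vanish d0 (suc k) []      _         = trans (*-congʳ d0) (zeroˡ _)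
  power-vanish d0 (suc k) (a ∷ w) (s≤s w<k) = trans (+-cong (trans (*-congʳ d0) (zeroˡ _))
    (⋆-vanish _ w (λ v p → power-vanish d0 k v (ℕₚ.≤-<-trans p w<k)))) (+-identityʳ _)

  ∑< : ℕ → (ℕ → Carrier) → Carrier
  ∑< n f = ∑ (List.upTo n) f

  ∑<-suc : ∀ n f → ∑< (suc n) f ≡ f 0 + ∑< n (f ∘ suc)
  ∑<-suc n f = ≡.cong (f 0 +_) (≡.trans (≡.cong (λ xs → ∑ xs f) (≡.sym (Listₚ.map-upTo suc n))) (∑-map suc (List.upTo n) f))

  ∑<-last : ∀ n f → ∑< (suc n) f ≈ ∑< n f + f n
  ∑<-last n f = trans (reflexive (≡.cong (λ xs → ∑ xs f) (≡.sym (Listₚ.upTo-∷ʳ n))))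
    (trans (∑-++ (List.upTo n) (n ∷ []) f) (+-congˡ (+-identityʳ _)))

  ⋆-∑ : ∀ {i} {I : Set i} (is : List I) f (F : I → Ser) → f ⋆ (λ w → ∑ is (λ i → F i w)) ≈ˢ λ w → ∑ is (λ i → (f ⋆ F i) w)
  ⋆-∑ []       f F w = ⋆-vanish f w (λ _ _ → refl)
  ⋆-∑ (i ∷ is) f F w = trans (⋆-+ʳ f (F i) _ w) (+-congˡ (⋆-∑ is f F w))

  module _ (f : Ser) (f0 : f [] ≈ 1#) where
    private
      d : Ser
      d = f -ˢ oneˢ

      d0 : d [] ≈ 0#
      d0 = trans (+-congʳ f0) (-‿inverseʳ 1#)

      f≈1+d : f ≈ˢ λ w → one w + d w
      f≈1+d w = sym (trans (+-cong (sym (oneˢ≈one w)) refl) (trans (x∙yz≈y∙xz _ _ _)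
        (trans (+-congˡ (-‿inverseʳ _)) (+-identityʳ _))))

    -- Induction on `m` with Pascal's rule, which needs only that `d` commutes with `one`. The
    -- cut-off `n` is independent of the length of `w`, because the induction hypothesis is applied
    -- to suffixes of `w` with the same `n`.
    binomial-expansion : ∀ m n w → length w ≤ n → ∑< (suc n) (λ k → choose m k * power d k w) ≈ power f m w
    binomial-expansion zero    n w _   = begin
      ∑< (suc n) (λ k → choose 0 k * power d k w)                       ≡⟨ ∑<-suc n _ ⟩
      choose 0 0 * one w + ∑< n (λ k → choose 0 (suc k) * power d (suc k) w) ≈⟨ +-cong
         (trans (*-congʳ (choose-zero 0)) (*-identityˡ _))
         (∑-zero-∈ (List.upTo n) (λ {k} _ → trans (*-congʳ (choose-zero-suc k)) (zeroˡ _))) ⟩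
      one w + 0#                                                        ≈⟨ +-identityʳ _ ⟩
      one w                                                             ∎
    binomial-expansion (suc m) n w w≤n = begin
      ∑< (suc n) (λ k → choose (suc m) k * power d k w)
        ≡⟨ ∑<-suc n _ ⟩
      choose (suc m) 0 * one w + ∑< n (λ k → choose (suc m) (suc k) * power d (suc k) w)
        ≈⟨ +-cong (*-congʳ (trans (choose-zero (suc m)) (sym (choose-zero m))))
             (trans (∑-cong (List.upTo n) (λ k → trans (*-congʳ (pascal m k)) (trans (distribʳ _ _ _) (+-comm _ _)))) (∑-+ (List.upTo n) _ _)) ⟩
      choose m 0 * one w + (∑< n (λ k → choose m (suc k) * power d (suc k) w) + ∑< n (λ k → choose m k * power d (suc k) w))
        ≈⟨ +-assoc _ _ _ ⟨
      (choose m 0 * one w + ∑< n (λ k → choose m (suc k) * power d (suc k) w)) + ∑< n (λ k → choose m k * power d (suc k) w)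
        ≈⟨ +-cong (trans (reflexive (≡.sym (∑<-suc n _))) (binomial-expansion m n w w≤n)) shifted ⟩
      power f m w + (d ⋆ power f m) w
        ≈⟨ +-congʳ (⋆-identityˡ (power f m) w) ⟨
      (one ⋆ power f m) w + (d ⋆ power f m) w
        ≈⟨ ⋆-+ˡ one d (power f m) w ⟨
      ((λ v → one v + d v) ⋆ power f m) w
        ≈⟨ ⋆-cong (λ v → sym (f≈1+d v)) (λ _ → refl) w ⟩
      (f ⋆ power f m) w ∎
      where
      shifted : ∑< n (λ k → choose m k * power d (suc k) w) ≈ (d ⋆ power f m) w
      shifted = begin
        ∑< n (λ k → choose m k * power d (suc k) w)
          -- The summand k = n may be added: it contains the power n + 1 of `d`, evaluated on a word
          -- of length at most n.
          ≈⟨ trans (∑<-last n _) (trans (+-congˡ (trans (*-congˡ (power-vanish d0 (suc n) w (s≤s w≤n))) (zeroʳ _))) (+-identityʳ _)) ⟨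
        ∑< (suc n) (λ k → choose m k * (d ⋆ power d k) w)
          ≈⟨ ∑-cong (List.upTo (suc n)) (λ k → ⋆-*ʳ (choose m k) d (power d k) w) ⟨
        ∑< (suc n) (λ k → (d ⋆ (λ v → choose m k * power d k v)) w)
          ≈⟨ ⋆-∑ (List.upTo (suc n)) d (λ k v → choose m k * power d k v) w ⟨
        (d ⋆ (λ v → ∑< (suc n) (λ k → choose m k * power d k v))) w
          ≈⟨ ⋆-cong-length d w (λ v v≤w → binomial-expansion m n v (ℕₚ.≤-trans v≤w w≤n)) ⟩
        (d ⋆ power f m) w ∎

  power-cong-on : ∀ {p} (P : ℕ → Set p) {f f′} → (∀ {w} → All P w → f w ≈ f′ w) → ∀ m {w} → All P w → power f m w ≈ power f′ m w
  power-cong-on P f≈ zero    all = refl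
  power-cong-on P f≈ (suc m) all = ⋆-cong-on P f≈ (power-cong-on P f≈ m) all

  eval-gᵗ : ∀ m {N w} → All (_≤ N) w → eval (ι m) (gᵗ w) ≈ power (exps N) m w
  eval-gᵗ m {N} {w} w≤N = begin
    eval (ι m) (gᵗ w)
      ≈⟨ eval-∑ (ι m) (List.upTo (suc (length w))) (λ k → binom k *ᵖ const (((g -ˢ oneˢ) ^ˢ k) w)) ⟩
    ∑< (suc (length w)) (λ k → eval (ι m) (binom k *ᵖ const (((g -ˢ oneˢ) ^ˢ k) w)))
      ≈⟨ ∑-cong (List.upTo (suc (length w))) (λ k → trans (eval-*ᵖ (ι m) (binom k) _)
           (*-congˡ (trans (eval-const (ι m) _) (^ˢ≈power (g -ˢ oneˢ) k w)))) ⟩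
    ∑< (suc (length w)) (λ k → choose m k * power (g -ˢ oneˢ) k w)
      ≈⟨ binomial-expansion g refl m (length w) w ℕₚ.≤-refl ⟩
    power g m w
      ≈⟨ power-cong-on (_≤ N) g≈exps m w≤N ⟩
    power (exps N) m w ∎

-- Enumerations of words, packed words and letters.

∈-wordsOver⁺ : ∀ {S n} (w : Word n) → (∀ i → lookup w i ∈ S) → w ∈ wordsOver S n
∈-wordsOver⁺ []      _  = here ≡.refl
∈-wordsOver⁺ (a ∷ w) ∈S = ∈-cartesianProductWith⁺ _∷_ (∈S zero) (∈-wordsOver⁺ w (λ i → ∈S (suc i)))

∈-wordsOver⁻ : ∀ {S n} {w : Word n} → w ∈ wordsOver S n → ∀ i → lookup w i ∈ S
∈-wordsOver⁻ {S} {suc n} w∈ i with ∈-cartesianProductWith⁻ _∷_ S (wordsOver S n) w∈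
∈-wordsOver⁻ {S} {suc n} w∈ zero    | a , v , a∈ , v∈ , ≡.refl = a∈
∈-wordsOver⁻ {S} {suc n} w∈ (suc i) | a , v , a∈ , v∈ , ≡.refl = ∈-wordsOver⁻ v∈ i

wordsOver-unique : ∀ {S} → Unique S → ∀ n → Unique (wordsOver S n)
wordsOver-unique u zero    = [] ∷ []
wordsOver-unique u (suc n) = Uniqueₚ.cartesianProductWith⁺ _∷_ Vecₚ.∷-injective u (wordsOver-unique u n)

∈-[1⋯]⁺ : ∀ {n k} → 1 ≤ k → k ≤ n → k ∈ [1⋯ n ]
∈-[1⋯]⁺ (s≤s _) k≤n = ∈-map⁺ suc (∈-upTo⁺ k≤n)

∈-[1⋯]⁻ : ∀ {n k} → k ∈ [1⋯ n ] → 1 ≤ k × k ≤ n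
∈-[1⋯]⁻ {n} k∈ with ∈-map⁻ suc k∈
... | i , i∈ , ≡.refl = s≤s z≤n , ∈-upTo⁻ i∈

[1⋯]-increasing : ∀ n → AllPairs _<_ [1⋯ n ]
[1⋯]-increasing n = AllPairsₚ.map⁺ (AllPairsₚ.applyUpTo⁺₁ id n (λ i<j _ → s≤s i<j))

increasing⇒unique : ∀ {xs} → AllPairs _<_ xs → Unique xs
increasing⇒unique = AllPairs.map ℕₚ.<⇒≢

length-[1⋯] : ∀ n → length [1⋯ n ] ≡ n
length-[1⋯] n = ≡.trans (Listₚ.length-map suc (List.upTo n)) (Listₚ.length-upTo n)

-- Letters are counted from 0 here: pos is a section of idx, which sends a position to its letter less one.
module Letters {n} {z : Word n} (z-packed : Packed z) where

  L : ℕ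
  L = maxW z

  pos : Fin L → Fin n
  pos a = proj₁ (∈⇒lookup (proj₂ z-packed a))

  lookup-pos : ∀ a → lookup z (pos a) ≡ suc (toℕ a)
  lookup-pos a = proj₂ (∈⇒lookup (proj₂ z-packed a))

  private
    bound : ∀ k → 1 ≤ k → k ≤ L → ℕ.pred k < L
    bound (suc k) _ k≤ = k≤

    suc-pred : ∀ k → 1 ≤ k → suc (ℕ.pred k) ≡ k
    suc-pred (suc k) _ = ≡.refl

  idx : Fin n → Fin L
  idx j = fromℕ< (bound (lookup z j) (packed⇒positive z-packed j) (lookup≤max z j))

  suc-idx : ∀ j → suc (toℕ (idx j)) ≡ lookup z j
  suc-idx j = ≡.trans (≡.cong suc (Finₚ.toℕ-fromℕ< _)) (suc-pred _ (packed⇒positive z-packed j))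

  idx-pos : ∀ a → idx (pos a) ≡ a
  idx-pos a = Finₚ.toℕ-injective (ℕₚ.suc-injective (≡.trans (suc-idx (pos a)) (lookup-pos a)))

  lookup-pos-idx : ∀ j → lookup z (pos (idx j)) ≡ lookup z j
  lookup-pos-idx j = ≡.trans (lookup-pos (idx j)) (suc-idx j)

  L≤n : L ≤ n
  L≤n = Finₚ.injective⇒≤ {f = pos} (λ {a} {b} eq → ≡.trans (≡.sym (idx-pos a)) (≡.trans (≡.cong idx eq) (idx-pos b)))

-- The words of `packedWords` without their irrelevant proofs. Sums are moved here, where equality
-- is that of plain words.
packedList : ∀ n → List (Word n)
packedList n = List.filter packed? (wordsOver [1⋯ n ] n)

∈-packedList⁺ : ∀ {n} {w : Word n} → Packed w → w ∈ packedList n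
∈-packedList⁺ {w = w} p = ∈-filter⁺ packed? (∈-wordsOver⁺ w (λ i →
  ∈-[1⋯]⁺ (packed⇒positive p i) (ℕₚ.≤-trans (lookup≤max w i) (Letters.L≤n p)))) p

∈-packedList⁻ : ∀ {n} {w : Word n} → w ∈ packedList n → Packed w
∈-packedList⁻ {n} w∈ = proj₂ (∈-filter⁻ packed? {xs = wordsOver [1⋯ n ] n} w∈)

packedList-unique : ∀ n → Unique (packedList n)
packedList-unique n = Uniqueₚ.filter⁺ packed? (wordsOver-unique (increasing⇒unique ([1⋯]-increasing n)) n)

-- Lexicographically ordered triples and words constant over the letters of z.

-- (letter of u, letter of x, letter of v)

Triple : Set
Triple = ℕ × (ℕ × ℕ)

tripleOrder : StrictTotalOrder _ _ _
tripleOrder = ×-strictTotalOrder <-strictTotalOrder (×-strictTotalOrder <-strictTotalOrder <-strictTotalOrder)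

private module T = StrictTotalOrder tripleOrder

_<₃_ : Triple → Triple → Set
_<₃_ = T._<_

_<₃?_ : ∀ s t → Dec (s <₃ t)
_<₃?_ = T._<?_

<₃-irrefl : ∀ t → ¬ (t <₃ t)
<₃-irrefl t = T.irrefl T.Eq.refl

outer : Triple → ℕ × ℕ
outer (i , (s , a)) = i , a

triple : ℕ × ℕ → ℕ → Triple
triple (i , a) s = i , (s , a)

triples : ∀ {L} → Vec (ℕ × ℕ) L → Word L → List Triple
triples []      []      = []
triples (c ∷ α) (s ∷ ξ) = triple c s ∷ triples α ξ

tripleAt : ∀ {L} → Vec (ℕ × ℕ) L → Word L → Fin L → Triple
tripleAt α ξ a = triple (lookup α a) (lookup ξ a)

All-triples : ∀ {p} {P : Triple → Set p} {L} (α : Vec (ℕ × ℕ) L) (ξ : Word L) →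
              All P (triples α ξ) ⇔ (∀ a → P (tripleAt α ξ a))
All-triples α ξ = mk⇔ (to α ξ) (from α ξ)
  where
  to : ∀ {p} {P : Triple → Set p} {L} (α : Vec (ℕ × ℕ) L) (ξ : Word L) → All P (triples α ξ) → ∀ a → P (tripleAt α ξ a)
  to (c ∷ α) (s ∷ ξ) (p ∷ _)  zero    = p
  to (c ∷ α) (s ∷ ξ) (_ ∷ ps) (suc a) = to α ξ ps a
  from : ∀ {p} {P : Triple → Set p} {L} (α : Vec (ℕ × ℕ) L) (ξ : Word L) → (∀ a → P (tripleAt α ξ a)) → All P (triples α ξ)
  from []      []      h = []
  from (c ∷ α) (s ∷ ξ) h = h zero ∷ from α ξ (h ∘ suc)

AllPairs-triples : ∀ {L} (α : Vec (ℕ × ℕ) L) (ξ : Word L) → AllPairs _<₃_ (triples α ξ) ⇔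
  (∀ {a b} → a Fin.< b → tripleAt α ξ a <₃ tripleAt α ξ b)
AllPairs-triples α ξ = mk⇔ (to α ξ) (from α ξ)
  where
  to : ∀ {L} (α : Vec (ℕ × ℕ) L) (ξ : Word L) → AllPairs _<₃_ (triples α ξ) →
       ∀ {a b} → a Fin.< b → tripleAt α ξ a <₃ tripleAt α ξ b
  to (c ∷ α) (s ∷ ξ) (h ∷ _)  {zero}  {suc b} _         = to⇔ (All-triples α ξ) h b
  to (c ∷ α) (s ∷ ξ) (_ ∷ hs) {suc a} {suc b} (s≤s a<b) = to α ξ hs a<b
  from : ∀ {L} (α : Vec (ℕ × ℕ) L) (ξ : Word L) →
         (∀ {a b} → a Fin.< b → tripleAt α ξ a <₃ tripleAt α ξ b) → AllPairs _<₃_ (triples α ξ)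
  from []      []      h = []
  from (c ∷ α) (s ∷ ξ) h = from⇔ (All-triples α ξ) (λ b → h {zero} {suc b} (s≤s z≤n)) ∷ from α ξ (λ a<b → h (s≤s a<b))

Lex₃ : ∀ {n} → Word n → Word n → Word n → Fin n → Fin n → Set
Lex₃ u x v = Lex u (Lex x (LetterLt v))

-- If (u, x, v) is ordered like z then x is constant on the positions of each letter of z.
module _ {n} (u v : Word n) {z : Word n} (z-packed : Packed z) (z-u : WeaklyFiner z u) (z-v : WeaklyFiner z v) where
  open Letters z-packed

  lettersOver : Vec (ℕ × ℕ) L
  lettersOver = tabulate (λ a → lookup u (pos a) , lookup v (pos a))

  extend : Word L → Word n
  extend ξ = tabulate (λ j → lookup ξ (idx j))

  restrict : Word n → Word L
  restrict x = tabulate (λ a → lookup x (pos a))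

  restrict-extend : ∀ ξ → restrict (extend ξ) ≡ ξ
  restrict-extend ξ = lookup-ext λ a → ≡.trans (lookup∘tabulate _ a)
    (≡.trans (lookup∘tabulate _ (pos a)) (≡.cong (lookup ξ) (idx-pos a)))

  private
    at : Word n → Fin n → Triple
    at x j = lookup u j , (lookup x j , lookup v j)

    at-extend : ∀ ξ j → at (extend ξ) j ≡ tripleAt lettersOver ξ (idx j)
    at-extend ξ j = ≡.trans
      (≡.cong₂ (λ i sa → i , sa) (z-u _ _ (≡.sym (lookup-pos-idx j)))
        (≡.cong₂ _,_ (lookup∘tabulate _ j) (z-v _ _ (≡.sym (lookup-pos-idx j)))))
      (≡.cong (λ c → triple c (lookup ξ (idx j))) (≡.sym (lookup∘tabulate _ (idx j))))

  extend-restrict : ∀ x → Orders z (Lex₃ u x v) → extend (restrict x) ≡ x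
  extend-restrict x z~ = lookup-ext λ j → ≡.trans (lookup∘tabulate _ j)
    (≡.trans (lookup∘tabulate _ (idx j)) (eq (pos (idx j)) j (lookup-pos-idx j)))
    where
    eq : ∀ i j → lookup z i ≡ lookup z j → lookup x i ≡ lookup x j
    eq i j zi≡zj with <-cmp (lookup x i) (lookup x j)
    ... | tri≈ _ xi≡xj _ = xi≡xj
    ... | tri< lt _ _    = contradiction (from⇔ (z~ i j) (inj₂ (z-u i j zi≡zj , inj₁ lt))) (ℕₚ.<-irrefl zi≡zj)
    ... | tri> _ _ gt    = contradiction (from⇔ (z~ j i) (inj₂ (z-u j i (≡.sym zi≡zj) , inj₁ gt))) (ℕₚ.<-irrefl (≡.sym zi≡zj))

  -- Listed in the order of the letters of `z`, the positions give one triple per letter, so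
  -- agreement with `z` means that this list increases strictly. That a smaller triple forces a
  -- smaller letter then follows by comparing the letters of `z`.
  orders-extend⇔ : ∀ ξ → Orders z (Lex₃ u (extend ξ) v) ⇔ AllPairs _<₃_ (triples lettersOver ξ)
  orders-extend⇔ ξ = mk⇔ to from
    where
    to : Orders z (Lex₃ u (extend ξ) v) → AllPairs _<₃_ (triples lettersOver ξ)
    to z~ = from⇔ (AllPairs-triples lettersOver ξ) λ {a} {b} a<b →
      ≡.subst₂ _<₃_ (at-pos a) (at-pos b)
        (to⇔ (z~ (pos a) (pos b)) (≡.subst₂ _<_ (≡.sym (lookup-pos a)) (≡.sym (lookup-pos b)) (s≤s a<b)))
      where
      at-pos : ∀ a → at (extend ξ) (pos a) ≡ tripleAt lettersOver ξ a
      at-pos a = ≡.trans (at-extend ξ (pos a)) (≡.cong (tripleAt lettersOver ξ) (idx-pos a))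
    from : AllPairs _<₃_ (triples lettersOver ξ) → Orders z (Lex₃ u (extend ξ) v)
    from chain i j = mk⇔ (mono i j) reflect
      where
      mono : ∀ i j → lookup z i < lookup z j → at (extend ξ) i <₃ at (extend ξ) j
      mono i j zi<zj = ≡.subst₂ _<₃_ (≡.sym (at-extend ξ i)) (≡.sym (at-extend ξ j))
        (to⇔ (AllPairs-triples lettersOver ξ) chain
          (ℕ.s≤s⁻¹ (≡.subst₂ _<_ (≡.sym (suc-idx i)) (≡.sym (suc-idx j)) zi<zj)))
      reflect : at (extend ξ) i <₃ at (extend ξ) j → lookup z i < lookup z j
      reflect lt with <-cmp (lookup z i) (lookup z j)
      ... | tri< zi<zj _ _ = zi<zj
      ... | tri> _ _ zj<zi = contradiction (mono j i zj<zi) (T.asym lt)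
      ... | tri≈ _ zi≡zj _ = contradiction (≡.subst (_<₃ at (extend ξ) j) same lt) (<₃-irrefl (at (extend ξ) j))
        where
        same : at (extend ξ) i ≡ at (extend ξ) j
        same = ≡.trans (at-extend ξ i) (≡.trans (≡.cong (λ b → triple (lookup lettersOver b) (lookup ξ b))
          (Finₚ.toℕ-injective (ℕₚ.suc-injective (≡.trans (suc-idx i) (≡.trans zi≡zj (≡.sym (suc-idx j)))))))
          (≡.sym (at-extend ξ j)))

-- Counting increasing sequences of triples by a product of factors 1 + (i, a).

AllPairs-cartesianProduct : ∀ {a b r s} {A : Set a} {B : Set b} {R : A → A → Set r} {S : B → B → Set s} {xs ys} →
  AllPairs R xs → AllPairs S ys →
  AllPairs (λ p q → R (proj₁ p) (proj₁ q) ⊎ (proj₁ p ≡ proj₁ q × S (proj₂ p) (proj₂ q))) (List.cartesianProduct xs ys)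
AllPairs-cartesianProduct []       ss = []
AllPairs-cartesianProduct {xs = x ∷ xs} {ys} (rx ∷ rs) ss = AllPairsₚ.++⁺
  (AllPairsₚ.map⁺ (AllPairs.map (λ s → inj₂ (≡.refl , s)) ss))
  (AllPairs-cartesianProduct rs ss)
  (Allₚ.map⁺ (All.universal (λ y → Allₚ.cartesianProduct⁺ (≡.setoid _) (≡.setoid _) xs ys (λ x′∈ _ → inj₁ (All.lookup rx x′∈))) ys))

filter-∧ : ∀ {a p q} {A : Set a} {P : A → Set p} {Q : A → Set q} (P? : ∀ x → Dec (P x)) (Q? : ∀ x → Dec (Q x)) xs →
           List.filter Q? (List.filter P? xs) ≡ List.filter (λ x → P? x ×-dec Q? x) xs
filter-∧ P? Q? []       = ≡.refl
filter-∧ P? Q? (x ∷ xs) with does (P? x)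
... | false = filter-∧ P? Q? xs
... | true  with does (Q? x)
...   | true  = ≡.cong (x ∷_) (filter-∧ P? Q? xs)
...   | false = filter-∧ P? Q? xs

module Counting {c ℓ} (R : CommutativeRing c ℓ) where
  open CommutativeRing R hiding (zero)
  open Sums R
  _≟²_ : DecidableEquality (ℕ × ℕ)
  _≟²_ = ≡-dec _≟_ _≟_
  open FormalSeries R _≟²_
  open import Algebra.Properties.CommutativeSemigroup *-commutativeSemigroup using (x∙yz≈y∙xz)
  open import Relation.Binary.Reasoning.Setoid setoid

  ∑-packedWords : ∀ n (F : Word n → Carrier) → ∑ (packedWords n) (λ w → F (word w)) ≈ ∑ (packedList n) F
  ∑-packedWords n F = go packed? (wordsOver [1⋯ n ] n)
    where
    go : (P? : ∀ w → Dec (Packed w)) → ∀ ws →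
         ∑ (List.mapMaybe (λ w → Maybe.map (λ p → mkPacked w p) (dec⇒maybe (P? w))) ws) (λ w → F (word w))
         ≈ ∑ (List.filter P? ws) F
    go P? []       = refl
    go P? (w ∷ ws) with P? w
    ... | yes p = +-congˡ (go P? ws)
    ... | no _  = go P? ws

  -- The coefficient of α counts the increasing subsequences of T lying over α.
  chains : List Triple → Ser
  chains T = ∏ˢ T (λ t → 1+ (outer t))

  -- Expansion by the first element `t` of the subsequence. Since `T` increases, what may follow `t`
  -- is exactly what lies above it.
  chains-∷ : ∀ T → AllPairs _<₃_ T → ∀ c α →
    chains T (c ∷ α) ≈ ∑ T (λ t → 𝟙 (outer t ≟² c) * chains (List.filter (t <₃?_) T) α)
  chains-∷ []       []         c α = refl
  chains-∷ (t ∷ T) (t< ∷ inc) c α = begin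
    (1+ (outer t) ⋆ chains T) (c ∷ α)
      ≈⟨ 1+-⋆-∷ (outer t) (chains T) c α ⟩
    chains T (c ∷ α) + 𝟙 (outer t ≟² c) * chains T α
      ≈⟨ +-comm _ _ ⟩
    𝟙 (outer t ≟² c) * chains T α + chains T (c ∷ α)
      ≈⟨ +-cong (*-congˡ (reflexive (≡.cong (λ T → chains T α) (≡.sym first)))) (chains-∷ T inc c α) ⟩
    𝟙 (outer t ≟² c) * chains (List.filter (t <₃?_) (t ∷ T)) α + ∑ T (λ t′ → 𝟙 (outer t′ ≟² c) * chains (List.filter (t′ <₃?_) T) α)
      ≈⟨ +-congˡ (∑-cong-∈ T (λ {t′} t′∈ → *-congˡ (reflexive (≡.cong (λ T → chains T α)
           (≡.sym (Listₚ.filter-reject (t′ <₃?_) (T.asym (All.lookup t< t′∈)))))))) ⟩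
    ∑ (t ∷ T) (λ t′ → 𝟙 (outer t′ ≟² c) * chains (List.filter (t′ <₃?_) (t ∷ T)) α) ∎
    where
    first : List.filter (t <₃?_) (t ∷ T) ≡ T
    first = ≡.trans (Listₚ.filter-reject (t <₃?_) (<₃-irrefl t)) (Listₚ.filter-all (t <₃?_) t<)

  module _ {is ss as : List ℕ} (is< : AllPairs _<_ is) (ss< : AllPairs _<_ ss) (as< : AllPairs _<_ as) where

    grid : List Triple
    grid = List.cartesianProduct is (List.cartesianProduct ss as)

    grid-increasing : AllPairs _<₃_ grid
    grid-increasing = AllPairs-cartesianProduct is< (AllPairs-cartesianProduct ss< as<)

    ∑-grid : ∀ {i a} → i ∈ is → a ∈ as → (F : Triple → Carrier) →
             ∑ grid (λ t → 𝟙 (outer t ≟² (i , a)) * F t) ≈ ∑ ss (λ s → F (triple (i , a) s))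
    ∑-grid {i} {a} i∈ a∈ F = begin
      ∑ grid (λ t → 𝟙 (outer t ≟² (i , a)) * F t)
        ≈⟨ ∑-cartesianProductWith _,_ is (List.cartesianProduct ss as) _ ⟩
      ∑ is (λ i′ → ∑ (List.cartesianProduct ss as) (λ (s , a′) → 𝟙 ((i′ , a′) ≟² (i , a)) * F (i′ , (s , a′))))
        ≈⟨ ∑-cong is (λ i′ → trans (∑-cartesianProductWith _,_ ss as _) (∑-cong ss (λ s → inner i′ s))) ⟩
      ∑ is (λ i′ → ∑ ss (λ s → 𝟙 (i ≟ i′) * F (i′ , (s , a))))
        ≈⟨ ∑-cong is (λ i′ → ∑-*ˡ ss (𝟙 (i ≟ i′)) (λ s → F (i′ , (s , a)))) ⟩
      ∑ is (λ i′ → 𝟙 (i ≟ i′) * ∑ ss (λ s → F (i′ , (s , a))))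
        ≈⟨ ∑-δ _≟_ (λ i′ → ∑ ss (λ s → F (i′ , (s , a)))) (increasing⇒unique is<) i∈ ⟩
      ∑ ss (λ s → F (i , (s , a))) ∎
      where
      inner : ∀ i′ s → ∑ as (λ a′ → 𝟙 ((i′ , a′) ≟² (i , a)) * F (i′ , (s , a′))) ≈ 𝟙 (i ≟ i′) * F (i′ , (s , a))
      inner i′ s = trans
        (∑-cong as (λ a′ → trans (*-congʳ (trans
          (𝟙-cong ((i′ , a′) ≟² (i , a)) ((i ≟ i′) ×-dec (a ≟ a′))
            (λ { ≡.refl → ≡.refl , ≡.refl }) (λ { (≡.refl , ≡.refl) → ≡.refl }))
          (trans (𝟙-×-dec (i ≟ i′) (a ≟ a′)) (*-comm _ _)))) (*-assoc _ _ _)))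
        (∑-δ _≟_ (λ a′ → 𝟙 (i ≟ i′) * F (i′ , (s , a′))) (increasing⇒unique as<) a∈)

    AllIn : ∀ {L} → Vec (ℕ × ℕ) L → Set
    AllIn α = ∀ a → proj₁ (lookup α a) ∈ is × proj₂ (lookup α a) ∈ as

    -- The predicate makes the induction possible: once the first triple `t` is chosen, the
    -- remaining ones must satisfy `P` and lie above `t`, which is again a condition of the same
    -- kind.
    count-above : ∀ {p} {P : Triple → Set p} (P? : ∀ t → Dec (P t)) {L} (α : Vec (ℕ × ℕ) L) → AllIn α →
      ∑ (wordsOver ss L) (λ ξ → 𝟙 (All.all? P? (triples α ξ) ×-dec allPairs? _<₃?_ (triples α ξ)))
      ≈ chains (List.filter P? grid) (Vec.toList α)
    count-above P? []      _  = trans (+-identityʳ _) (sym (chains-[] (List.filter P? grid)))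
      where
      chains-[] : ∀ T → chains T [] ≈ 1#
      chains-[] []      = refl
      chains-[] (t ∷ T) = trans (*-identityˡ _) (chains-[] T)
    count-above {P = P} P? {suc L} (c@(i , a) ∷ α) α∈ = begin
      ∑ (wordsOver ss (suc L)) (λ ξ → 𝟙 (All.all? P? (triples (c ∷ α) ξ) ×-dec allPairs? _<₃?_ (triples (c ∷ α) ξ)))
        ≈⟨ ∑-cartesianProductWith _∷_ ss (wordsOver ss L) _ ⟩
      ∑ ss (λ s → ∑ (wordsOver ss L) (λ ξ → 𝟙 (All.all? P? (triple c s ∷ triples α ξ) ×-dec allPairs? _<₃?_ (triple c s ∷ triples α ξ))))
        ≈⟨ ∑-cong ss (λ s → trans (∑-cong (wordsOver ss L) (λ ξ → split (triple c s) (triples α ξ)))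
             (trans (∑-*ˡ (wordsOver ss L) _ _) (*-congˡ (count-above (λ t → P? t ×-dec (triple c s <₃? t)) α (α∈ ∘ suc))))) ⟩
      ∑ ss (λ s → 𝟙 (P? (triple c s)) * chains (List.filter (λ t → P? t ×-dec (triple c s <₃? t)) grid) (Vec.toList α))
        ≈⟨ ∑-grid (proj₁ (α∈ zero)) (proj₂ (α∈ zero)) (λ t₀ → 𝟙 (P? t₀) * chains (List.filter (λ t → P? t ×-dec (t₀ <₃? t)) grid) (Vec.toList α)) ⟨
      ∑ grid (λ t₀ → 𝟙 (outer t₀ ≟² c) * (𝟙 (P? t₀) * chains (List.filter (λ t → P? t ×-dec (t₀ <₃? t)) grid) (Vec.toList α)))
        ≈⟨ ∑-cong grid (λ t₀ → trans (x∙yz≈y∙xz _ _ _)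
             (*-congˡ (*-congˡ (reflexive (≡.cong (λ T → chains T (Vec.toList α)) (≡.sym (filter-∧ P? (t₀ <₃?_) grid))))))) ⟩
      ∑ grid (λ t₀ → 𝟙 (P? t₀) * (𝟙 (outer t₀ ≟² c) * chains (List.filter (t₀ <₃?_) (List.filter P? grid)) (Vec.toList α)))
        ≈⟨ ∑-filter P? grid _ ⟨
      ∑ (List.filter P? grid) (λ t₀ → 𝟙 (outer t₀ ≟² c) * chains (List.filter (t₀ <₃?_) (List.filter P? grid)) (Vec.toList α))
        ≈⟨ chains-∷ (List.filter P? grid) (AllPairsₚ.filter⁺ P? grid-increasing) c (Vec.toList α) ⟨
      chains (List.filter P? grid) (c ∷ Vec.toList α) ∎
      where
      split : ∀ t ts → 𝟙 (All.all? P? (t ∷ ts) ×-dec allPairs? _<₃?_ (t ∷ ts)) ≈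
                       𝟙 (P? t) * 𝟙 (All.all? (λ t′ → P? t′ ×-dec (t <₃? t′)) ts ×-dec allPairs? _<₃?_ ts)
      split t ts = trans
        (𝟙-cong (All.all? P? (t ∷ ts) ×-dec allPairs? _<₃?_ (t ∷ ts))
                (P? t ×-dec (All.all? (λ t′ → P? t′ ×-dec (t <₃? t′)) ts ×-dec allPairs? _<₃?_ ts))
                (λ { (p ∷ ps , t< ∷ inc) → p , (All.zip (ps , t<) , inc) })
                (λ { (p , (pts , inc)) → let ps , t< = All.unzip pts in p ∷ ps , t< ∷ inc }))
        (𝟙-×-dec (P? t) (All.all? (λ t′ → P? t′ ×-dec (t <₃? t′)) ts ×-dec allPairs? _<₃?_ ts))

    -- The series ∏ᵢ (∏ₐ (1 + (i, a)))ᵐ, where m is the length of `ss`: `outer` forgets the middle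
    -- letter, which therefore only repeats the inner product.
    box : Ser
    box = ∏ˢ is (λ i → ∏ˢ ss (λ _ → ∏ˢ as (λ a → 1+ (i , a))))

    chains-grid : chains grid ≈ˢ box
    chains-grid w = trans (∏ˢ-cartesianProduct is (List.cartesianProduct ss as) _ w)
      (∏ˢ-cong is (λ i → ∏ˢ-cartesianProduct ss as (λ (s , a) → 1+ (i , a))) w)

    count-chains : ∀ {L} (α : Vec (ℕ × ℕ) L) → AllIn α →
      ∑ (wordsOver ss L) (λ ξ → 𝟙 (allPairs? _<₃?_ (triples α ξ))) ≈ box (Vec.toList α)
    count-chains {L} α α∈ = begin
      ∑ (wordsOver ss L) (λ ξ → 𝟙 (allPairs? _<₃?_ (triples α ξ)))
        ≈⟨ ∑-cong (wordsOver ss L) (λ ξ → 𝟙-cong (allPairs? _<₃?_ (triples α ξ)) (All.all? ⊤? (triples α ξ) ×-dec allPairs? _<₃?_ (triples α ξ))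
             (λ inc → All.universal (λ _ → tt) _ , inc) proj₂) ⟩
      ∑ (wordsOver ss L) (λ ξ → 𝟙 (All.all? ⊤? (triples α ξ) ×-dec allPairs? _<₃?_ (triples α ξ)))
        ≈⟨ count-above ⊤? α α∈ ⟩
      chains (List.filter ⊤? grid) (Vec.toList α)
        ≡⟨ ≡.cong (λ T → chains T (Vec.toList α)) (Listₚ.filter-all ⊤? (All.universal (λ _ → tt) grid)) ⟩
      chains grid (Vec.toList α)
        ≈⟨ chains-grid (Vec.toList α) ⟩
      box (Vec.toList α) ∎
      where
      ⊤? : (t : Triple) → Dec ⊤
      ⊤? _ = yes tt

    -- The decidable `P` is left open because the order condition occurs in several guises: as an
    -- equation for the packing of one word, of two words or of three.
    count-orders : ∀ {n} (u v : Word n) {z : Word n} (z-packed : Packed z) (z-u : WeaklyFiner z u) (z-v : WeaklyFiner z v) →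
      (∀ j → lookup u j ∈ is) → (∀ j → lookup v j ∈ as) →
      ∀ {p} {P : Word n → Set p} (P? : ∀ x → Dec (P x)) → (∀ x → P x ⇔ Orders z (Lex₃ u x v)) →
      ∑ (wordsOver ss n) (λ x → 𝟙 (P? x)) ≈ box (Vec.toList (lettersOver u v z-packed z-u z-v))
    count-orders {n} u v {z} z-packed z-u z-v u∈ v∈ P? P⇔ = begin
      ∑ (wordsOver ss n) (λ x → 𝟙 (P? x))
        ≈⟨ ∑-reindex (Vecₚ.≡-dec _≟_) (wordsOver-unique ss! n) (wordsOver-unique ss! L)
             (extend u v z-packed z-u z-v) (restrict u v z-packed z-u z-v) (λ x → 𝟙 (P? x)) extend∈
             (λ {ξ} _ → restrict-extend u v z-packed z-u z-v ξ) support ⟩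
      ∑ (wordsOver ss L) (λ ξ → 𝟙 (P? (extend u v z-packed z-u z-v ξ)))
        ≈⟨ ∑-cong (wordsOver ss L) (λ ξ → 𝟙-cong (P? _) (allPairs? _<₃?_ (triples α ξ))
             (to⇔ (orders-extend⇔ u v z-packed z-u z-v ξ) ∘ to⇔ (P⇔ _))
             (from⇔ (P⇔ _) ∘ from⇔ (orders-extend⇔ u v z-packed z-u z-v ξ))) ⟩
      ∑ (wordsOver ss L) (λ ξ → 𝟙 (allPairs? _<₃?_ (triples α ξ)))
        ≈⟨ count-chains α α∈ ⟩
      box (Vec.toList α) ∎
      where
      open Letters z-packed
      ss! = increasing⇒unique ss<
      α = lettersOver u v z-packed z-u z-v
      α∈ : AllIn α
      α∈ a = ≡.subst (λ c → proj₁ c ∈ is × proj₂ c ∈ as) (≡.sym (lookup∘tabulate _ a)) (u∈ (pos a) , v∈ (pos a))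
      extend∈ : ∀ {ξ} → ξ ∈ wordsOver ss L → extend u v z-packed z-u z-v ξ ∈ wordsOver ss n
      extend∈ {ξ} ξ∈ = ∈-wordsOver⁺ _ (λ j → ≡.subst (_∈ ss) (≡.sym (lookup∘tabulate _ j)) (∈-wordsOver⁻ ξ∈ (idx j)))
      support : ∀ {x} → x ∈ wordsOver ss n → 𝟙 (P? x) ≈ 0# ⊎
                (restrict u v z-packed z-u z-v x ∈ wordsOver ss L × extend u v z-packed z-u z-v (restrict u v z-packed z-u z-v x) ≡ x)
      support {x} x∈ with P? x
      ... | no _  = inj₁ refl
      ... | yes p = inj₂ ( ∈-wordsOver⁺ _ (λ a → ≡.subst (_∈ ss) (≡.sym (lookup∘tabulate _ a)) (∈-wordsOver⁻ x∈ (pos a)))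
                         , extend-restrict u v z-packed z-u z-v x (to⇔ (P⇔ x) p))

-- Subwords over the letters of u and their refinement words.

increasing-unique : ∀ {xs ys} → AllPairs _<_ xs → AllPairs _<_ ys →
                    (∀ {x} → x ∈ xs → x ∈ ys) → (∀ {y} → y ∈ ys → y ∈ xs) → xs ≡ ys
increasing-unique []       []       _ _ = ≡.refl
increasing-unique []       (_ ∷ _)  _ ⊇ with () ← ⊇ (here ≡.refl)
increasing-unique (_ ∷ _)  []       ⊆ _ with () ← ⊆ (here ≡.refl)
increasing-unique {x ∷ xs} {y ∷ ys} (x< ∷ ix) (y< ∷ iy) ⊆ ⊇ =
  ≡.cong₂ _∷_ x≡y (increasing-unique ix iy
    (λ z∈ → tail (⊆ (there z∈)) (ℕₚ.<⇒≢ (≡.subst (_< _) x≡y (All.lookup x< z∈)) ∘ ≡.sym))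
    (λ z∈ → tail (⊇ (there z∈)) (ℕₚ.<⇒≢ (≡.subst (_< _) (≡.sym x≡y) (All.lookup y< z∈)) ∘ ≡.sym)))
  where
  head≤ : ∀ {z zs w} → All (z <_) zs → w ∈ z ∷ zs → z ≤ w
  head≤ z< (here ≡.refl) = ℕₚ.≤-refl
  head≤ z< (there w∈)    = ℕₚ.<⇒≤ (All.lookup z< w∈)
  x≡y : x ≡ y
  x≡y = ℕₚ.≤-antisym (head≤ x< (⊇ (here ≡.refl))) (head≤ y< (⊆ (here ≡.refl)))
  tail : ∀ {z w : ℕ} {zs} → z ∈ w ∷ zs → z ≢ w → z ∈ zs
  tail (here z≡w) z≢w = contradiction z≡w z≢w
  tail (there z∈) _   = z∈

AllPairs-map-∈ : ∀ {a r s} {A : Set a} {R : A → A → Set r} {S : A → A → Set s} {xs} →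
                 (∀ {x y} → x ∈ xs → y ∈ xs → R x y → S x y) → AllPairs R xs → AllPairs S xs
AllPairs-map-∈ f []       = []
AllPairs-map-∈ f (r ∷ rs) =
  All.tabulate (λ y∈ → f (here ≡.refl) (there y∈) (All.lookup r y∈)) ∷
  AllPairs-map-∈ (λ x∈ y∈ → f (there x∈) (there y∈)) rs

toList-tabulate-suc : ∀ m (h : ℕ → ℕ) → Vec.toList (tabulate {n = m} (λ i → h (suc (toℕ i)))) ≡ List.map h [1⋯ m ]
toList-tabulate-suc m h = ≡.trans (go m (h ∘ suc)) (≡.trans (≡.sym (Listₚ.map-upTo (h ∘ suc) m)) (Listₚ.map-∘ (List.upTo m)))
  where
  go : ∀ m (h : ℕ → ℕ) → Vec.toList (tabulate {n = m} (λ i → h (toℕ i))) ≡ List.applyUpTo h m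
  go zero    h = ≡.refl
  go (suc m) h = ≡.cong (h 0 ∷_) (go m (h ∘ suc))

-- `letterAbove` picks the first position of the letter; weak fineness makes the choice irrelevant.
letterAbove-lookup : ∀ {n} (v x : Word n) → WeaklyFiner x v → ∀ p → letterAbove v x (lookup x p) ≡ lookup v p
letterAbove-lookup v x x-v p = let q , xq , eq = first v x p in ≡.trans eq (x-v q p xq)
  where
  first : ∀ {n} (v x : Word n) p → ∃ λ q → lookup x q ≡ lookup x p × letterAbove v x (lookup x p) ≡ lookup v q
  first (a ∷ v) (b ∷ x) zero rewrite dec-true (b ≟ b) ≡.refl = zero , ≡.refl , ≡.refl
  first (a ∷ v) (b ∷ x) (suc p) with b ≟ lookup x p
  ... | yes eq rewrite dec-true (b ≟ lookup x p) eq = zero , eq , ≡.refl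
  ... | no neq rewrite dec-false (b ≟ lookup x p) neq = let q , xq , eq = first v x p in suc q , xq , eq

Finer⇒WeaklyFiner : ∀ {n} {w u : Word n} → Finer w u → WeaklyFiner w u
Finer⇒WeaklyFiner w-u i j eq = ℕₚ.≤-antisym (w-u i j (ℕₚ.≤-reflexive eq)) (w-u j i (ℕₚ.≤-reflexive (≡.sym eq)))

WeaklyFiner-trans : ∀ {n} {z w v : Word n} → WeaklyFiner z w → WeaklyFiner w v → WeaklyFiner z v
WeaklyFiner-trans z-w w-v i j = w-v i j ∘ z-w i j

Finer-trans : ∀ {n} {z w v : Word n} → Finer z w → Finer w v → Finer z v
Finer-trans z-w w-v i j = w-v i j ∘ z-w i j

module Subwords {n} (u : Word n) where

  occVec : ∀ i → Vec (Fin n) (length (occurrences u i))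
  occVec i = Vec.fromList (occurrences u i)

  occ : ∀ i → Fin (length (occurrences u i)) → Fin n
  occ i = lookup (occVec i)

  private
    fromList-lookup : ∀ {a} {A : Set a} {P : A → Set} (xs : List A) → All P xs → ∀ p → P (lookup (Vec.fromList xs) p)
    fromList-lookup (x ∷ xs) (px ∷ _)  zero    = px
    fromList-lookup (x ∷ xs) (_ ∷ pxs) (suc p) = fromList-lookup xs pxs p

    fromList-∈ : ∀ {a} {A : Set a} {x} (xs : List A) → x ∈ xs → ∃ λ p → lookup (Vec.fromList xs) p ≡ x
    fromList-∈ (x ∷ xs) (here ≡.refl) = zero , ≡.refl
    fromList-∈ (x ∷ xs) (there x∈)    = let p , eq = fromList-∈ xs x∈ in suc p , eq

  lookup-occ : ∀ i p → lookup u (occ i p) ≡ i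
  lookup-occ i = fromList-lookup (occurrences u i) (Allₚ.all-filter (λ j → lookup u j ≟ i) (List.allFin n))

  occ⁻ : ∀ i j → lookup u j ≡ i → ∃ λ p → occ i p ≡ j
  occ⁻ i j eq = fromList-∈ (occurrences u i) (∈-filter⁺ (λ j → lookup u j ≟ i) (∈-allFin j) eq)

  subword : ∀ i → Word n → Word (length (occurrences u i))
  subword i v = Vec.map (lookup v) (occVec i)

  lookup-subword : ∀ i v p → lookup (subword i v) p ≡ lookup v (occ i p)
  lookup-subword i v p = lookup-map p (lookup v) (occVec i)

  -- The renumbering behind `packedSubword`, as a function of the letter instead of the position in
  -- the subword, so that it can be applied at positions of the whole word.
  rankIn : ℕ → Word n → ℕ → ℕ
  rankIn i v = rank <-strictTotalOrder (subword i v)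

  rankIn-mono : ∀ i v {j k} → lookup u j ≡ i → lookup v j < k → rankIn i v (lookup v j) < rankIn i v k
  rankIn-mono i v {j} eq lt with occ⁻ i j eq
  ... | p , ≡.refl rewrite ≡.sym (lookup-subword i v p) = rank-mono <-strictTotalOrder (subword i v) {p} lt

  rankIn-reflects : ∀ i v {j k} → lookup u j ≡ i → lookup u k ≡ i →
                    rankIn i v (lookup v j) < rankIn i v (lookup v k) → lookup v j < lookup v k
  rankIn-reflects i v {j} {k} uj uk lt with <-cmp (lookup v j) (lookup v k)
  ... | tri< vj<vk _ _ = vj<vk
  ... | tri≈ _ eq _    = contradiction lt (ℕₚ.<-irrefl (≡.cong (rankIn i v) eq))
  ... | tri> _ _ gt    = contradiction lt (ℕₚ.<-asym (rankIn-mono i v uk gt))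

  rankIn-injective : ∀ i v {j k} → lookup u j ≡ i → lookup u k ≡ i →
                     rankIn i v (lookup v j) ≡ rankIn i v (lookup v k) → lookup v j ≡ lookup v k
  rankIn-injective i v {j} {k} uj uk eq with <-cmp (lookup v j) (lookup v k)
  ... | tri< lt _ _  = contradiction (rankIn-mono i v uj lt) (ℕₚ.<-irrefl eq)
  ... | tri≈ _ vj≡vk _ = vj≡vk
  ... | tri> _ _ gt  = contradiction (rankIn-mono i v uk gt) (ℕₚ.<-irrefl (≡.sym eq))

  lookup-packedSubword : ∀ i v p → lookup (packedSubword u i v) p ≡ rankIn i v (lookup v (occ i p))
  lookup-packedSubword i v p = ≡.trans (lookup-packOver <-strictTotalOrder (subword i v) p) (≡.cong (rankIn i v) (lookup-subword i v p))

  -- The word v with its letters renumbered separately at the positions of each letter of u.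
  blockwise : Word n → Word n
  blockwise v = tabulate (λ j → rankIn (lookup u j) v (lookup v j))

  module _ (v : Word n) where

    lookup-blockwise : ∀ {i} j → lookup u j ≡ i → lookup (blockwise v) j ≡ rankIn i v (lookup v j)
    lookup-blockwise j ≡.refl = lookup∘tabulate _ j

    blockwise-<⇔ : ∀ {j k} → lookup u j ≡ lookup u k → lookup (blockwise v) j < lookup (blockwise v) k ⇔ lookup v j < lookup v k
    blockwise-<⇔ {j} {k} eq rewrite lookup-blockwise j eq | lookup-blockwise k ≡.refl =
      mk⇔ (rankIn-reflects _ v eq ≡.refl) (rankIn-mono _ v eq)

    blockwise-injective : ∀ {j k} → lookup u j ≡ lookup u k → lookup (blockwise v) j ≡ lookup (blockwise v) k → lookup v j ≡ lookup v k
    blockwise-injective {j} {k} eq rewrite lookup-blockwise j eq | lookup-blockwise k ≡.refl =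
      rankIn-injective _ v eq ≡.refl

    blockwise-cong : ∀ {j k} → lookup u j ≡ lookup u k → lookup v j ≡ lookup v k → lookup (blockwise v) j ≡ lookup (blockwise v) k
    blockwise-cong {j} {k} eq vj≡vk rewrite lookup-blockwise j eq | lookup-blockwise k ≡.refl = ≡.cong (rankIn _ v) vj≡vk

    blockwise-positive : ∀ j → 1 ≤ lookup (blockwise v) j
    blockwise-positive j = ≡.subst (1 ≤_) (≡.sym (lookup-blockwise j ≡.refl)) (s≤s z≤n)

    -- The letters of `v` are consulted only where those of `u` agree, and there `blockwise v` has
    -- the same order as `v`.
    Lex₃-blockwise : ∀ x i j → Lex₃ u x v i j ⇔ Lex₃ u x (blockwise v) i j
    Lex₃-blockwise x i j = mk⇔
      (λ { (inj₁ lt) → inj₁ lt ; (inj₂ (eq , inj₁ lt)) → inj₂ (eq , inj₁ lt)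
         ; (inj₂ (eq , inj₂ (eq′ , lt))) → inj₂ (eq , inj₂ (eq′ , from⇔ (blockwise-<⇔ eq) lt)) })
      (λ { (inj₁ lt) → inj₁ lt ; (inj₂ (eq , inj₁ lt)) → inj₂ (eq , inj₁ lt)
         ; (inj₂ (eq , inj₂ (eq′ , lt))) → inj₂ (eq , inj₂ (eq′ , to⇔ (blockwise-<⇔ eq) lt)) })

    module _ {w : Word n} (w-packed : Packed w) (w-u : Finer w u) (w-v : WeaklyFiner w v) where
      private
        w-u′ : WeaklyFiner w u
        w-u′ = Finer⇒WeaklyFiner {w = w} {u} w-u

      WeaklyFiner-blockwise : WeaklyFiner w (blockwise v)
      WeaklyFiner-blockwise i j eq = blockwise-cong (w-u′ i j eq) (w-v i j eq)

      colour : ℕ → ℕ × ℕ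
      colour c = letterAbove u w c , letterAbove (blockwise v) w c

      colour-lookup : ∀ j → colour (lookup w j) ≡ (lookup u j , lookup (blockwise v) j)
      colour-lookup j = ≡.cong₂ _,_ (letterAbove-lookup u w w-u′ j) (letterAbove-lookup (blockwise v) w WeaklyFiner-blockwise j)

      letter-occurs : ∀ {c} → c ∈ [1⋯ maxW w ] → ∃ λ j → lookup w j ≡ c
      letter-occurs c∈ with ∈-[1⋯]⁻ c∈
      ... | s≤s {n = k} _ , c≤ = packed⇒letter w-packed k c≤

      letters-∈ : ∀ j → lookup w j ∈ [1⋯ maxW w ]
      letters-∈ j = ∈-[1⋯]⁺ (packed⇒positive w-packed j) (lookup≤max w j)

      module _ (i : ℕ) where
        private
          V X : Word (length (occurrences u i))
          V = packedSubword u i v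
          X = packedSubword u i w

          X-packed : Packed X
          X-packed = packOver-packed <-strictTotalOrder (subword i w)

          blockLetters : List ℕ
          blockLetters = List.filter (λ c → letterAbove u w c ≟ i) [1⋯ maxW w ]

          blockLetters⁻ : ∀ {c} → c ∈ blockLetters → ∃ λ p → lookup w (occ i p) ≡ c
          blockLetters⁻ c∈ with ∈-filter⁻ (λ c → letterAbove u w c ≟ i) {xs = [1⋯ maxW w ]} c∈
          ... | c∈ , eq with letter-occurs c∈
          ...   | j , ≡.refl =
            let p , q = occ⁻ i j (≡.trans (≡.sym (≡.cong proj₁ (colour-lookup j))) eq) in p , ≡.cong (lookup w) q

          blockLetters⁺ : ∀ p → lookup w (occ i p) ∈ blockLetters
          blockLetters⁺ p = ∈-filter⁺ (λ c → letterAbove u w c ≟ i) (letters-∈ (occ i p))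
            (≡.trans (≡.cong proj₁ (colour-lookup (occ i p))) (lookup-occ i p))

          -- The renumbering is increasing on the letters of this block and its values are the
          -- letters of the packed word `X`, so it lists them in order.
          ranks : List.map (rankIn i w) blockLetters ≡ [1⋯ maxW X ]
          ranks = increasing-unique
            (AllPairsₚ.map⁺ (AllPairs-map-∈ mono (AllPairsₚ.filter⁺ (λ c → letterAbove u w c ≟ i) ([1⋯]-increasing (maxW w)))))
            ([1⋯]-increasing (maxW X)) ⊆ ⊇
            where
            mono : ∀ {c d} → c ∈ blockLetters → d ∈ blockLetters → c < d → rankIn i w c < rankIn i w d
            mono c∈ _ c<d with blockLetters⁻ c∈
            ... | p , ≡.refl = rankIn-mono i w (lookup-occ i p) c<d
            ⊆ : ∀ {k} → k ∈ List.map (rankIn i w) blockLetters → k ∈ [1⋯ maxW X ]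
            ⊆ k∈ with ∈-map⁻ (rankIn i w) k∈
            ... | c , c∈ , ≡.refl with blockLetters⁻ c∈
            ...   | p , ≡.refl = ≡.subst (_∈ [1⋯ maxW X ]) (lookup-packedSubword i w p)
                                   (∈-[1⋯]⁺ (packed⇒positive X-packed p) (lookup≤max X p))
            ⊇ : ∀ {k} → k ∈ [1⋯ maxW X ] → k ∈ List.map (rankIn i w) blockLetters
            ⊇ k∈ with ∈-[1⋯]⁻ k∈
            ... | s≤s {n = k} _ , k≤ with packed⇒letter X-packed k k≤
            ...   | p , eq = ≡.subst (_∈ List.map (rankIn i w) blockLetters) (≡.trans (≡.sym (lookup-packedSubword i w p)) eq)
                               (∈-map⁺ (rankIn i w) (blockLetters⁺ p))

          X-V : WeaklyFiner X V
          X-V p q eq = ≡.trans (lookup-packedSubword i v p) (≡.trans (≡.cong (rankIn i v) (w-v _ _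
            (rankIn-injective i w (lookup-occ i p) (lookup-occ i q)
              (≡.trans (≡.sym (lookup-packedSubword i w p)) (≡.trans eq (lookup-packedSubword i w q))))))
            (≡.sym (lookup-packedSubword i v q)))

        -- The colours of 1, ..., max w form a single word that contains the refinement words of all
        -- `i` at once, each as the second components in colour `i`. This is what allows the product
        -- of Goldberg coefficients to become one coefficient.
        refinementWord-letters : Vec.toList (refinementWord V X) ≡
          List.map proj₂ (List.filter (λ c → proj₁ c ≟ i) (List.map colour [1⋯ maxW w ]))
        refinementWord-letters = begin
          Vec.toList (refinementWord V X)                                    ≡⟨ toList-tabulate-suc (maxW X) (letterAbove V X) ⟩
          List.map (letterAbove V X) [1⋯ maxW X ]                            ≡⟨ ≡.cong (List.map (letterAbove V X)) ranks ⟨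
          List.map (letterAbove V X) (List.map (rankIn i w) blockLetters)    ≡⟨ Listₚ.map-∘ blockLetters ⟨
          List.map (letterAbove V X ∘ rankIn i w) blockLetters               ≡⟨ map-cong-∈ blockLetters (λ c∈ → above c∈) ⟩
          List.map (letterAbove (blockwise v) w) blockLetters                ≡⟨ Listₚ.map-∘ blockLetters ⟩
          List.map proj₂ (List.map colour blockLetters)                      ≡⟨ ≡.cong (List.map proj₂) (filter-map [1⋯ maxW w ]) ⟨
          List.map proj₂ (List.filter (λ c → proj₁ c ≟ i) (List.map colour [1⋯ maxW w ])) ∎
          where
          open ≡.≡-Reasoning
          map-cong-∈ : ∀ {f h : ℕ → ℕ} xs → (∀ {x} → x ∈ xs → f x ≡ h x) → List.map f xs ≡ List.map h xs
          map-cong-∈ []       eq = ≡.refl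
          map-cong-∈ (x ∷ xs) eq = ≡.cong₂ _∷_ (eq (here ≡.refl)) (map-cong-∈ xs (eq ∘ there))
          above : ∀ {c} → c ∈ blockLetters → letterAbove V X (rankIn i w c) ≡ letterAbove (blockwise v) w c
          above c∈ with blockLetters⁻ c∈
          ... | p , ≡.refl = ≡.trans (≡.cong (letterAbove V X) (≡.sym (lookup-packedSubword i w p)))
            (≡.trans (letterAbove-lookup V X X-V p) (≡.trans (lookup-packedSubword i v p)
              (≡.trans (≡.sym (lookup-blockwise (occ i p) (lookup-occ i p))) (≡.sym (≡.cong proj₂ (colour-lookup (occ i p)))))))
          filter-map : ∀ xs → List.filter (λ c → proj₁ c ≟ i) (List.map colour xs) ≡
                       List.map colour (List.filter (λ c → letterAbove u w c ≟ i) xs)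
          filter-map []       = ≡.refl
          filter-map (x ∷ xs) with does (letterAbove u w x ≟ i)
          ... | true  = ≡.cong (colour x ∷_) (filter-map xs)
          ... | false = filter-map xs

-- Step words as codes for factorisations.

-- Words ψ = ψ₁ ⋯ ψ_L with ψ₁ = 1 and ψₐ₊₁ - ψₐ ∈ {0, 1}: the coarsenings of the packed word 12⋯L.

stepsFrom : ℕ → ∀ L → List (Word L)
stepsFrom c zero    = [] ∷ []
stepsFrom c (suc L) = List.map (c ∷_) (stepsFrom c L) ++ List.map (suc c ∷_) (stepsFrom (suc c) L)

steps : ∀ L → List (Word L)
steps zero    = [] ∷ []
steps (suc L) = List.map (1 ∷_) (stepsFrom 1 L)

data Step (c : ℕ) : ∀ {L} → Word L → Set where
  []   : Step c []
  same : ∀ {L} {ψ : Word L} → Step c ψ → Step c (c ∷ ψ)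
  next : ∀ {L} {ψ : Word L} → Step (suc c) ψ → Step c (suc c ∷ ψ)

∈-stepsFrom⁺ : ∀ {c L} {ψ : Word L} → Step c ψ → ψ ∈ stepsFrom c L
∈-stepsFrom⁺ []       = here ≡.refl
∈-stepsFrom⁺ (same s) = ∈-++⁺ˡ (∈-map⁺ (_ ∷_) (∈-stepsFrom⁺ s))
∈-stepsFrom⁺ {c} {suc L} (next s) = ∈-++⁺ʳ (List.map (c ∷_) (stepsFrom c L)) (∈-map⁺ (suc c ∷_) (∈-stepsFrom⁺ s))

∈-stepsFrom⁻ : ∀ {c L} {ψ : Word L} → ψ ∈ stepsFrom c L → Step c ψ
∈-stepsFrom⁻ {c} {zero}  (here ≡.refl) = []
∈-stepsFrom⁻ {c} {suc L} ψ∈ with ∈-++⁻ (List.map (c ∷_) (stepsFrom c L)) ψ∈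
... | inj₁ p with ∈-map⁻ (c ∷_) p
...   | ψ , q , ≡.refl = same (∈-stepsFrom⁻ q)
∈-stepsFrom⁻ {c} {suc L} ψ∈ | inj₂ p with ∈-map⁻ (suc c ∷_) p
...   | ψ , q , ≡.refl = next (∈-stepsFrom⁻ q)

stepsFrom-unique : ∀ c L → Unique (stepsFrom c L)
stepsFrom-unique c zero    = [] ∷ []
stepsFrom-unique c (suc L) = Uniqueₚ.++⁺
  (Uniqueₚ.map⁺ Vecₚ.∷-injectiveʳ (stepsFrom-unique c L))
  (Uniqueₚ.map⁺ Vecₚ.∷-injectiveʳ (stepsFrom-unique (suc c) L))
  λ (p , q) → let _ , _ , eq = ∈-map⁻ (c ∷_) p ; _ , _ , eq′ = ∈-map⁻ (suc c ∷_) q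
              in  ℕₚ.1+n≢n (≡.sym (Vecₚ.∷-injectiveˡ (≡.trans (≡.sym eq) eq′)))

steps-unique : ∀ L → Unique (steps L)
steps-unique zero    = [] ∷ []
steps-unique (suc L) = Uniqueₚ.map⁺ Vecₚ.∷-injectiveʳ (stepsFrom-unique 1 L)

Step-≥ : ∀ {c L} {ψ : Word L} → Step c ψ → ∀ a → c ≤ lookup ψ a
Step-≥ (same s) zero    = ℕₚ.≤-refl
Step-≥ (same s) (suc a) = Step-≥ s a
Step-≥ (next s) zero    = ℕₚ.n≤1+n _
Step-≥ (next s) (suc a) = ℕₚ.<⇒≤ (Step-≥ s a)

Step-monotone : ∀ {c L} {ψ : Word L} → Step c ψ → ∀ {a b} → a Fin.≤ b → lookup ψ a ≤ lookup ψ b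
Step-monotone (same s) {zero}  {zero}  _         = ℕₚ.≤-refl
Step-monotone (same s) {zero}  {suc b} _         = Step-≥ s b
Step-monotone (same s) {suc a} {suc b} (s≤s a≤b) = Step-monotone s a≤b
Step-monotone (next s) {zero}  {zero}  _         = ℕₚ.≤-refl
Step-monotone (next s) {zero}  {suc b} _         = Step-≥ s b
Step-monotone (next s) {suc a} {suc b} (s≤s a≤b) = Step-monotone s a≤b

Step-pred : ∀ {c L} {ψ : Word L} → Step c ψ → ∀ a k → lookup ψ a ≡ suc k → c ≤ k → k ≡ c ⊎ ∃ λ b → lookup ψ b ≡ k
Step-pred (same s) zero    k eq c≤k = contradiction (≡.subst (_≤ k) eq c≤k) ℕₚ.1+n≰n
Step-pred (same s) (suc a) k eq c≤k with Step-pred s a k eq c≤k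
... | inj₁ k≡c       = inj₁ k≡c
... | inj₂ (b , p)   = inj₂ (suc b , p)
Step-pred (next s) zero    k eq c≤k = inj₁ (≡.sym (ℕₚ.suc-injective eq))
Step-pred {c} (next s) (suc a) k eq c≤k with ℕₚ.m≤n⇒m<n∨m≡n c≤k
... | inj₂ c≡k = inj₁ (≡.sym c≡k)
... | inj₁ c<k with Step-pred s a k eq c<k
...   | inj₁ k≡c     = inj₂ (zero , ≡.sym k≡c)
...   | inj₂ (b , p) = inj₂ (suc b , p)

∈-steps⁻ : ∀ {L} {ψ : Word L} → ψ ∈ steps L → Step 0 ψ × (∀ a → 1 ≤ lookup ψ a)
∈-steps⁻ {zero}  (here ≡.refl) = [] , λ ()
∈-steps⁻ {suc L} ψ∈ with ∈-map⁻ (1 ∷_) ψ∈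
... | ψ , p , ≡.refl = next (∈-stepsFrom⁻ p) , λ { zero → ℕₚ.≤-refl ; (suc a) → Step-≥ (∈-stepsFrom⁻ p) a }

∈-steps⁺ : ∀ {L} {ψ : Word L} → Step 0 ψ → (∀ a → 1 ≤ lookup ψ a) → ψ ∈ steps L
∈-steps⁺ []       _   = here ≡.refl
∈-steps⁺ (same s) pos = contradiction (pos zero) λ ()
∈-steps⁺ (next s) pos = ∈-map⁺ (1 ∷_) (∈-stepsFrom⁺ s)

steps-packed : ∀ {L} {ψ : Word L} → ψ ∈ steps L → ∀ a k → lookup ψ a ≡ suc (suc k) → ∃ λ b → lookup ψ b ≡ suc k
steps-packed ψ∈ a k eq with Step-pred (proj₁ (∈-steps⁻ ψ∈)) a (suc k) eq z≤n
... | inj₂ p = p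

Step-intro : ∀ {c L} (ψ : Word L) → (∀ a → c ≤ lookup ψ a) → (∀ {a b} → a Fin.≤ b → lookup ψ a ≤ lookup ψ b) →
             (∀ a k → c < k → k ≤ lookup ψ a → ∃ λ b → lookup ψ b ≡ k) → Step c ψ
Step-intro []      _   _    _       = []
Step-intro {c} (d ∷ ψ) c≤ mono gapless with ℕₚ.m≤n⇒m<n∨m≡n (c≤ zero)
... | inj₂ ≡.refl = same (Step-intro ψ (c≤ ∘ suc) (λ a≤b → mono (s≤s a≤b)) tail)
  where
  tail : ∀ a k → c < k → k ≤ lookup ψ a → ∃ λ b → lookup ψ b ≡ k
  tail a k c<k k≤ with gapless (suc a) k c<k k≤
  ... | zero  , eq = contradiction c<k (ℕₚ.<-irrefl eq)
  ... | suc b , eq = b , eq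
... | inj₁ c<d = ≡.subst (λ d → Step c (d ∷ ψ)) (≡.sym d≡) (next (≡.subst (λ d → Step d ψ) d≡
    (Step-intro ψ (λ a → mono {zero} {suc a} z≤n) (λ a≤b → mono (s≤s a≤b)) tail)))
  where
  d≡ : d ≡ suc c
  d≡ = let b , eq = gapless zero (suc c) ℕₚ.≤-refl c<d in ℕₚ.≤-antisym (≡.subst (d ≤_) eq (mono {zero} {b} z≤n)) c<d
  tail : ∀ a k → d < k → k ≤ lookup ψ a → ∃ λ b → lookup ψ b ≡ k
  tail a k d<k k≤ with gapless (suc a) k (ℕₚ.<-trans c<d d<k) k≤
  ... | zero  , eq = contradiction d<k (ℕₚ.<-irrefl eq)
  ... | suc b , eq = b , eq

-- Equal letters of a step word are adjacent, so dropping each letter equal to its predecessor lists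
-- the distinct letters after `c`.
later : ℕ → ∀ {L} → Word L → List ℕ
later c []      = []
later c (d ∷ ψ) = if does (d ≟ c) then later c ψ else d ∷ later d ψ

stepLetters : ∀ {L} → Word L → List ℕ
stepLetters []      = []
stepLetters (d ∷ ψ) = d ∷ later d ψ

later-same : ∀ c {L} (ψ : Word L) → later c (c ∷ ψ) ≡ later c ψ
later-same c ψ rewrite dec-true (c ≟ c) ≡.refl = ≡.refl

later-next : ∀ c {L} (ψ : Word L) → later c (suc c ∷ ψ) ≡ suc c ∷ later (suc c) ψ
later-next c ψ rewrite dec-false (suc c ≟ c) ℕₚ.1+n≢n = ≡.refl

later-> : ∀ {c L} {ψ : Word L} → Step c ψ → All (c <_) (later c ψ)
later-> [] = []
later-> {c} {ψ = _ ∷ ψ} (same s) = ≡.subst (All (c <_)) (≡.sym (later-same c ψ)) (later-> s)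
later-> {c} {ψ = _ ∷ ψ} (next s) = ≡.subst (All (c <_)) (≡.sym (later-next c ψ))
  (ℕₚ.≤-refl ∷ All.map ℕₚ.<⇒≤ (later-> s))

later-increasing : ∀ {c L} {ψ : Word L} → Step c ψ → AllPairs _<_ (later c ψ)
later-increasing [] = []
later-increasing {c} {ψ = _ ∷ ψ} (same s) = ≡.subst (AllPairs _<_) (≡.sym (later-same c ψ)) (later-increasing s)
later-increasing {c} {ψ = _ ∷ ψ} (next s) = ≡.subst (AllPairs _<_) (≡.sym (later-next c ψ))
  (later-> s ∷ later-increasing s)

later-∈⁻ : ∀ {c L k} {ψ : Word L} → Step c ψ → k ∈ later c ψ → ∃ λ a → lookup ψ a ≡ k
later-∈⁻ {c} {ψ = _ ∷ ψ} (same s) k∈ =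
  let a , eq = later-∈⁻ s (≡.subst (_ ∈_) (later-same c ψ) k∈) in suc a , eq
later-∈⁻ {c} {ψ = _ ∷ ψ} (next s) k∈ with ≡.subst (_ ∈_) (later-next c ψ) k∈
... | here ≡.refl = zero , ≡.refl
... | there p     = let a , eq = later-∈⁻ s p in suc a , eq

later-∈⁺ : ∀ {c L} {ψ : Word L} → Step c ψ → ∀ a → lookup ψ a ∈ c ∷ later c ψ
later-∈⁺ (same s) zero = here ≡.refl
later-∈⁺ {c} {ψ = _ ∷ ψ} (same s) (suc a) = ≡.subst (λ ls → lookup ψ a ∈ c ∷ ls) (≡.sym (later-same c ψ)) (later-∈⁺ s a)
later-∈⁺ {c} {ψ = _ ∷ ψ} (next s) zero = ≡.subst (λ ls → suc c ∈ c ∷ ls) (≡.sym (later-next c ψ)) (there (here ≡.refl))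
later-∈⁺ {c} {ψ = _ ∷ ψ} (next s) (suc a) = ≡.subst (λ ls → lookup ψ a ∈ c ∷ ls) (≡.sym (later-next c ψ)) (there (later-∈⁺ s a))

stepLetters-≡ : ∀ {L} {ψ : Word L} → ψ ∈ steps L → ∀ {m} → (∀ a → lookup ψ a ≤ m) → (∀ k → k < m → ∃ λ a → lookup ψ a ≡ suc k) →
                stepLetters ψ ≡ [1⋯ m ]
stepLetters-≡ {zero}  {[]} ψ∈ {zero}  _ _ = ≡.refl
stepLetters-≡ {zero}  {[]} ψ∈ {suc m} _ occurs with () ← proj₁ (occurs 0 (s≤s z≤n))
stepLetters-≡ {suc L} ψ∈ ≤m occurs with ∈-map⁻ (1 ∷_) ψ∈
... | ψ , p , ≡.refl = increasing-unique (later-> s ∷ later-increasing s) ([1⋯]-increasing _) ⊆ ⊇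
  where
  s : Step 1 ψ
  s = ∈-stepsFrom⁻ p
  ⊆ : ∀ {k} → k ∈ 1 ∷ later 1 ψ → k ∈ [1⋯ _ ]
  ⊆ (here ≡.refl) = ∈-[1⋯]⁺ ℕₚ.≤-refl (≤m zero)
  ⊆ (there k∈) with later-∈⁻ s k∈
  ... | a , ≡.refl = ∈-[1⋯]⁺ (Step-≥ s a) (≤m (suc a))
  ⊇ : ∀ {k} → k ∈ [1⋯ _ ] → k ∈ 1 ∷ later 1 ψ
  ⊇ k∈ with ∈-[1⋯]⁻ k∈
  ... | s≤s {n = k} _ , k≤ with occurs k k≤
  ...   | zero  , ≡.refl = here ≡.refl
  ...   | suc a , eq     = ≡.subst (_∈ 1 ∷ later 1 ψ) eq (later-∈⁺ s a)

-- Iterated packing as lexicographic order of triples.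

Orders-cong : ∀ {n} {z : Word n} {R S : Fin n → Fin n → Set} → (∀ i j → R i j ⇔ S i j) → Orders z R ⇔ Orders z S
Orders-cong R⇔S = mk⇔
  (λ z~ i j → mk⇔ (to⇔ (R⇔S i j) ∘ to⇔ (z~ i j)) (from⇔ (z~ i j) ∘ from⇔ (R⇔S i j)))
  (λ z~ i j → mk⇔ (from⇔ (R⇔S i j) ∘ to⇔ (z~ i j)) (from⇔ (z~ i j) ∘ to⇔ (R⇔S i j)))

module _ {n} (u x v : Word n) where

  Orders-Lex₃⇒Finer : ∀ {z} → Orders z (Lex₃ u x v) → Finer z u
  Orders-Lex₃⇒Finer z~ i j zi≤zj = ℕₚ.≮⇒≥ (λ uj<ui → ℕₚ.<⇒≱ (from⇔ (z~ j i) (inj₁ uj<ui)) zi≤zj)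

  -- Equal letters of `z` make two triples incomparable, hence equal. Only equality survives for
  -- `v`, as it comes last in the comparison.
  Orders-Lex₃⇒WeaklyFiner : ∀ {z} → Orders z (Lex₃ u x v) → WeaklyFiner z v
  Orders-Lex₃⇒WeaklyFiner z~ i j zi≡zj with T.compare (lookup u i , (lookup x i , lookup v i)) (lookup u j , (lookup x j , lookup v j))
  ... | tri≈ _ (_ , _ , eq) _ = eq
  ... | tri< lt _ _           = contradiction (from⇔ (z~ i j) lt) (ℕₚ.<-irrefl zi≡zj)
  ... | tri> _ _ gt           = contradiction (from⇔ (z~ j i) gt) (ℕₚ.<-irrefl (≡.sym zi≡zj))

packBiword-pack-< : ∀ {n} (u x : Word n) i j →
  lookup (packBiword u (pack x)) i < lookup (packBiword u (pack x)) j ⇔ Lex u (LetterLt x) i j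
packBiword-pack-< u x i j = mk⇔
  (λ lt → case₁ (to⇔ (packBiword-orders u (pack x) i j) lt))
  (λ lt → from⇔ (packBiword-orders u (pack x) i j) (case₂ lt))
  where
  case₁ : Lex u (LetterLt (pack x)) i j → Lex u (LetterLt x) i j
  case₁ (inj₁ lt)        = inj₁ lt
  case₁ (inj₂ (eq , lt)) = inj₂ (eq , to⇔ (packOver-orders <-strictTotalOrder x i j) lt)
  case₂ : Lex u (LetterLt x) i j → Lex u (LetterLt (pack x)) i j
  case₂ (inj₁ lt)        = inj₁ lt
  case₂ (inj₂ (eq , lt)) = inj₂ (eq , from⇔ (packOver-orders <-strictTotalOrder x i j) lt)

-- Packing `x` changes neither its order nor its equalities. Thus `x` may range over all words on
-- {1, ..., m}, as the count requires.
packBiword-pack≡⇔ : ∀ {n} (u x v : Word n) {z} → Packed z →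
  packBiword (packBiword u (pack x)) v ≡ z ⇔ Orders z (Lex₃ u x v)
packBiword-pack≡⇔ u x v {z} z-packed = mk⇔ (to ∘ to⇔ E) (from⇔ E ∘ from)
  where
  E = packBiword≡⇔ (packBiword u (pack x)) v z-packed
  rel⇔ : ∀ i j → Lex (packBiword u (pack x)) (LetterLt v) i j ⇔ Lex₃ u x v i j
  rel⇔ i j = mk⇔ f g
    where
    eq⇔ = packBiword-≡⇔ u (pack x) i j
    f : Lex (packBiword u (pack x)) (LetterLt v) i j → Lex₃ u x v i j
    f (inj₁ lt) with to⇔ (packBiword-pack-< u x i j) lt
    ... | inj₁ ui<uj        = inj₁ ui<uj
    ... | inj₂ (eq , xi<xj) = inj₂ (eq , inj₁ xi<xj)
    f (inj₂ (eq , lt)) = let ui≡uj , pi≡pj = to⇔ eq⇔ eq in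
      inj₂ (ui≡uj , inj₂ (to⇔ (packOver-≡⇔ <-strictTotalOrder x i j) pi≡pj , lt))
    g : Lex₃ u x v i j → Lex (packBiword u (pack x)) (LetterLt v) i j
    g (inj₁ lt) = inj₁ (from⇔ (packBiword-pack-< u x i j) (inj₁ lt))
    g (inj₂ (eq , inj₁ lt)) = inj₁ (from⇔ (packBiword-pack-< u x i j) (inj₂ (eq , lt)))
    g (inj₂ (eq , inj₂ (eq′ , lt))) = inj₂ (from⇔ eq⇔ (eq , from⇔ (packOver-≡⇔ <-strictTotalOrder x i j) eq′) , lt)
  to = to⇔ (Orders-cong {z = z} rel⇔)
  from = from⇔ (Orders-cong {z = z} rel⇔)

-- Series in coloured letters, and the substitution as a sum over step words.

module ColouredSeries {c ℓ₁ ℓ₂} (K : HeytingField c ℓ₁ ℓ₂) (char0 : CharacteristicZero K) where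
  open Characteristic0 K char0
  open CommutativeRing R hiding (zero)
  open Sums R
  open Binomials K char0
  open Counting R using (_≟²_; box)
  open FormalSeries R _≟²_
  open LogExp K char0 _≟²_
  open Substitution l
  open import Relation.Binary.Reasoning.Setoid setoid
  private
    module S₁ = FormalSeries R _≟_
    module E₁ = LogExp K char0 _≟_
    module G = Goldberg K char0

  -- The series involves no letter from `P`; this form passes to products and derivatives.
  Vanishes : ∀ {p} → (ℕ × ℕ → Set p) → Ser → Set _
  Vanishes P f = ∀ {w} → Any P w → f w ≈ 0#

  vanishes-one : ∀ {p} {P : ℕ × ℕ → Set p} → Vanishes P one
  vanishes-one (here _)  = refl
  vanishes-one (there _) = refl

  vanishes-⋆ : ∀ {p} {P : ℕ × ℕ → Set p} {f g} → Vanishes P f → Vanishes P g → Vanishes P (f ⋆ g)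
  vanishes-⋆ {g = g} f0 g0 {a ∷ w} (here pa)  =
    trans (+-cong (trans (*-congˡ (g0 (here pa))) (zeroʳ _)) (⋆-zeroˡ g (λ v → f0 {a ∷ v} (here pa)) w)) (+-identityʳ _)
  vanishes-⋆ {f = f} f0 g0 {a ∷ w} (there p)  =
    trans (+-cong (trans (*-congˡ (g0 (there p))) (zeroʳ _)) (vanishes-⋆ {f = ∂ a f} (f0 ∘ there) g0 p)) (+-identityʳ _)

  vanishes-∏ˢ : ∀ {p i} {P : ℕ × ℕ → Set p} {I : Set i} (is : List I) {F : I → Ser} →
                 (∀ {i} → i ∈ is → Vanishes P (F i)) → Vanishes P (∏ˢ is F)
  vanishes-∏ˢ []       F0 = vanishes-one
  vanishes-∏ˢ (i ∷ is) F0 = vanishes-⋆ (F0 (here ≡.refl)) (vanishes-∏ˢ is (F0 ∘ there))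

  -- The letter (i , a) is thought of as the letter a in the colour i, a letter of u.
  Coloured : ℕ → Ser → Set _
  Coloured i = Vanishes (λ c → proj₁ c ≢ i)

  coloured-∏ˢ : ∀ i {j} {J : Set j} (js : List J) {F : J → Ser} → (∀ j → Coloured i (F j)) → Coloured i (∏ˢ js F)
  coloured-∏ˢ i js F0 = vanishes-∏ˢ js (λ {j} _ → F0 j)

  coloured-exp : ∀ i a → Coloured i (exp 0 (i , a))
  coloured-exp i a {w} any = trans (*-congʳ (𝟙-no (all≡? (i , a) w)
    (λ all → let p , q = All.lookupAny all any in q (≡.cong proj₁ p)))) (zeroˡ _)

  coloured-1+ : ∀ i a → Coloured i (1+ (i , a))
  coloured-1+ i a {c ∷ []}    (here c≢i) = 𝟙-no ((i , a) ≟² c) (λ eq → c≢i (≡.cong proj₁ (≡.sym eq)))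
  coloured-1+ i a {_ ∷ _ ∷ _} _          = refl

  segment : ℕ → List (ℕ × ℕ) → List (ℕ × ℕ)
  segment i = List.filter (λ c → proj₁ c ≟ i)

  rest : ℕ → List (ℕ × ℕ) → List (ℕ × ℕ)
  rest i = List.filter (λ c → ¬? (proj₁ c ≟ i))

  Sorted : List (ℕ × ℕ) → Set
  Sorted = AllPairs (_≤_ on proj₁)

  -- In a sorted word the letters of the least colour `i` come before all others. Any cut other than
  -- the one right after them leaves a foreign letter to `f` or a letter of colour `i` to `g`.
  ⋆-segment : ∀ i f g → Coloured i f → Vanishes (λ c → proj₁ c ≡ i) g → ∀ ρ → Sorted ρ → All (λ c → i ≤ proj₁ c) ρ →
              (f ⋆ g) ρ ≈ f (segment i ρ) * g (rest i ρ)
  ⋆-segment i f g f0 g0 []      _        _         = refl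
  ⋆-segment i f g f0 g0 (c ∷ ρ) (c≤ ∷ s) (i≤c ∷ i≤) with proj₁ c ≟ i
  ... | yes c≡i = trans
    (trans (+-cong (trans (*-congˡ (g0 (here c≡i))) (zeroʳ _)) (⋆-segment i (∂ c f) g (f0 ∘ there) g0 ρ s i≤)) (+-identityˡ _))
    (reflexive (≡.cong₂ (λ ρ₁ ρ₂ → f ρ₁ * g ρ₂)
      (≡.sym (Listₚ.filter-accept (λ c → proj₁ c ≟ i) c≡i))
      (≡.sym (Listₚ.filter-reject (λ c → ¬? (proj₁ c ≟ i)) (λ ¬p → ¬p c≡i)))))
  ... | no c≢i = trans
    (trans (+-congˡ (⋆-zeroˡ g (λ v → f0 {c ∷ v} (here c≢i)) ρ)) (+-identityʳ _))
    (reflexive (≡.cong₂ (λ ρ₁ ρ₂ → f ρ₁ * g ρ₂)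
      (≡.sym (Listₚ.filter-none (λ c → proj₁ c ≟ i) none))
      (≡.sym (Listₚ.filter-all (λ c → ¬? (proj₁ c ≟ i)) none))))
    where
    none : All (λ c → proj₁ c ≢ i) (c ∷ ρ)
    none = c≢i ∷ All.map (λ c≤d d≡i → c≢i (ℕₚ.≤-antisym (≡.subst (proj₁ c ≤_) d≡i c≤d) i≤c)) c≤

  ∏ˢ-segments : ∀ is → AllPairs _<_ is → (F : ℕ → Ser) → (∀ i → Coloured i (F i)) →
                ∀ ρ → Sorted ρ → All (λ c → proj₁ c ∈ is) ρ → ∏ˢ is F ρ ≈ ∏ is (λ i → F i (segment i ρ))
  ∏ˢ-segments []       _          F F0 []      _ _ = refl
  ∏ˢ-segments []       _          F F0 (c ∷ ρ) _ (() ∷ _)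
  ∏ˢ-segments (i ∷ is) (i< ∷ inc) F F0 ρ       s ρ∈ = begin
    (F i ⋆ ∏ˢ is F) ρ
      ≈⟨ ⋆-segment i (F i) (∏ˢ is F) (F0 i) others ρ s (All.map i≤ ρ∈) ⟩
    F i (segment i ρ) * ∏ˢ is F (rest i ρ)
      ≈⟨ *-congˡ (∏ˢ-segments is inc F F0 (rest i ρ) (AllPairsₚ.filter⁺ (λ c → ¬? (proj₁ c ≟ i)) s) rest∈) ⟩
    F i (segment i ρ) * ∏ is (λ j → F j (segment j (rest i ρ)))
      ≈⟨ *-congˡ (∏-cong-∈ is (λ {j} j∈ → reflexive (≡.cong (F j) (segment-rest (≢i j∈))))) ⟩
    F i (segment i ρ) * ∏ is (λ j → F j (segment j ρ)) ∎
    where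
    ≢i : ∀ {j} → j ∈ is → j ≢ i
    ≢i j∈ j≡i = ℕₚ.<⇒≢ (All.lookup i< j∈) (≡.sym j≡i)
    others : Vanishes (λ c → proj₁ c ≡ i) (∏ˢ is F)
    others = vanishes-∏ˢ is (λ {j} j∈ any → F0 j (Any.map (λ c≡i c≡j → ≢i j∈ (≡.trans (≡.sym c≡j) c≡i)) any))
    i≤ : ∀ {j} → j ∈ i ∷ is → i ≤ j
    i≤ (here eq) = ℕₚ.≤-reflexive (≡.sym eq)
    i≤ (there p) = ℕₚ.<⇒≤ (All.lookup i< p)
    tail : ∀ {j} → j ∈ i ∷ is × j ≢ i → j ∈ is
    tail (here eq , ≢) = contradiction eq ≢
    tail (there p , _) = p
    rest∈ : All (λ c → proj₁ c ∈ is) (rest i ρ)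
    rest∈ = All.map tail (All.zip (Allₚ.filter⁺ (λ c → ¬? (proj₁ c ≟ i)) ρ∈ , Allₚ.all-filter (λ c → ¬? (proj₁ c ≟ i)) ρ))
    segment-rest : ∀ {j} → j ≢ i → segment j (rest i ρ) ≡ segment j ρ
    segment-rest {j} j≢i = ≡.trans (filter-∧ (λ c → ¬? (proj₁ c ≟ i)) (λ c → proj₁ c ≟ j) ρ)
      (Listₚ.filter-≐ (λ c → ¬? (proj₁ c ≟ i) ×-dec (proj₁ c ≟ j)) (λ c → proj₁ c ≟ j)
        (proj₂ , λ {c} c≡j → (λ c≡i → j≢i (≡.trans (≡.sym c≡j) c≡i)) , c≡j) ρ)

  segment-letters : ∀ i ρ → segment i ρ ≡ List.map (i ,_) (List.map proj₂ (segment i ρ))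
  segment-letters i ρ = go (Allₚ.all-filter (λ c → proj₁ c ≟ i) ρ)
    where
    go : ∀ {σ} → All (λ c → proj₁ c ≡ i) σ → σ ≡ List.map (i ,_) (List.map proj₂ σ)
    go []             = ≡.refl
    go (≡.refl ∷ all) = ≡.cong (_ ∷_) (go all)

  -- Goldberg coefficients live on uncoloured words; this relates them to series in the letters of
  -- one colour.
  Colours : ℕ → S₁.Ser → Ser → Set _
  Colours i f F = ∀ w → F (List.map (i ,_) w) ≈ f w

  colours-one : ∀ i → Colours i S₁.one one
  colours-one i []      = refl
  colours-one i (_ ∷ _) = refl

  colours-⋆ : ∀ i {f g F G} → Colours i f F → Colours i g G → Colours i (f S₁.⋆ g) (F ⋆ G)
  colours-⋆ i f~ g~ []      = *-cong (f~ []) (g~ [])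
  colours-⋆ i f~ g~ (a ∷ w) = +-cong (*-cong (f~ []) (g~ (a ∷ w))) (colours-⋆ i (f~ ∘ (a ∷_)) g~ w)

  colours-∏ˢ : ∀ i {j} {J : Set j} (js : List J) {f : J → S₁.Ser} {F} → (∀ j → Colours i (f j) (F j)) → Colours i (S₁.∏ˢ js f) (∏ˢ js F)
  colours-∏ˢ i []       f~ = colours-one i
  colours-∏ˢ i (j ∷ js) f~ = colours-⋆ i (f~ j) (colours-∏ˢ i js f~)

  colours-exp : ∀ i a → Colours i (E₁.exp 0 a) (exp 0 (i , a))
  colours-exp i a w = *-cong
    (𝟙-cong (all≡? (i , a) (List.map (i ,_) w)) (E₁.all≡? a w)
      (λ all → All.map (≡.cong proj₂) (Allₚ.map⁻ all)) (λ all → Allₚ.map⁺ (All.map (≡.cong (i ,_)) all)))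
    (reflexive (≡.cong 1/! (Listₚ.length-map (i ,_) w)))

  -- The m-th power is written as a product over `[1⋯ m ]` to match the factors of `box` one by one.
  colouredExps : ℕ → ℕ → ℕ → Ser
  colouredExps m N i = ∏ˢ [1⋯ m ] (λ _ → ∏ˢ [1⋯ N ] (λ a → exp 0 (i , a)))

  coloured-colouredExps : ∀ m N i → Coloured i (colouredExps m N i)
  coloured-colouredExps m N i = coloured-∏ˢ i [1⋯ m ] (λ _ → coloured-∏ˢ i [1⋯ N ] (λ a → coloured-exp i a))

  colouredExps-segment : ∀ m N i ρ → colouredExps m N i (segment i ρ) ≈ S₁.power (G.exps N) m (List.map proj₂ (segment i ρ))
  colouredExps-segment m N i ρ = begin
    colouredExps m N i (segment i ρ)
      ≡⟨ ≡.cong (colouredExps m N i) (segment-letters i ρ) ⟩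
    colouredExps m N i (List.map (i ,_) (List.map proj₂ (segment i ρ)))
      ≈⟨ colours-∏ˢ i [1⋯ m ] (λ _ → colours-∏ˢ i [1⋯ N ] (λ a → colours-exp i a)) (List.map proj₂ (segment i ρ)) ⟩
    S₁.∏ˢ [1⋯ m ] (λ _ → G.exps N) (List.map proj₂ (segment i ρ))
      ≡⟨ ≡.cong (λ f → f (List.map proj₂ (segment i ρ))) (≡.trans (S₁.∏ˢ-const [1⋯ m ] (G.exps N)) (≡.cong (S₁.power (G.exps N)) (length-[1⋯] m))) ⟩
    S₁.power (G.exps N) m (List.map proj₂ (segment i ρ)) ∎

  -- ∏ᵢ (e^(i,1) ⋯ e^(i,N))ᵐ, which becomes the generating series of chains under the substitution.
  expBox : ℕ → ℕ → ℕ → Ser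
  expBox r m N = ∏ˢ [1⋯ r ] (colouredExps m N)

  sub-expBox : ∀ r m N → sub (expBox r m N) ≈ˢ box ([1⋯]-increasing r) ([1⋯]-increasing m) ([1⋯]-increasing N)
  sub-expBox r m N w = trans (sub-∏ˢ [1⋯ r ] (colouredExps m N) w) (∏ˢ-cong [1⋯ r ] (λ i w →
    trans (sub-∏ˢ [1⋯ m ] _ w) (∏ˢ-cong [1⋯ m ] (λ _ w →
      trans (sub-∏ˢ [1⋯ N ] _ w) (∏ˢ-cong [1⋯ N ] (λ a w → sub-exp (i , a) w) w)) w)) w)

  expBox-segments : ∀ r m N ρ → Sorted ρ → All (λ c → proj₁ c ∈ [1⋯ r ]) ρ →
    expBox r m N ρ ≈ ∏ [1⋯ r ] (λ i → S₁.power (G.exps N) m (List.map proj₂ (segment i ρ)))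
  expBox-segments r m N ρ s ρ∈ = trans
    (∏ˢ-segments [1⋯ r ] ([1⋯]-increasing r) (colouredExps m N) (coloured-colouredExps m N) ρ s ρ∈)
    (∏-cong-∈ [1⋯ r ] (λ {i} _ → colouredExps-segment m N i ρ))

  power-1+ : ∀ b m k → power (1+ b) m (replicate k b) ≈ choose m k
  power-1+ b zero    zero    = sym (choose-zero 0)
  power-1+ b zero    (suc k) = sym (choose-zero-suc k)
  power-1+ b (suc m) zero    = trans (*-identityˡ _) (trans (power-1+ b m 0) (trans (choose-zero m) (sym (choose-zero (suc m)))))
  power-1+ b (suc m) (suc k) = begin
    (1+ b ⋆ power (1+ b) m) (b ∷ replicate k b)
      ≈⟨ 1+-⋆-∷ b (power (1+ b) m) b (replicate k b) ⟩
    power (1+ b) m (replicate (suc k) b) + 𝟙 (b ≟² b) * power (1+ b) m (replicate k b)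
      ≈⟨ +-cong (power-1+ b m (suc k)) (trans (*-congʳ (𝟙-yes (b ≟² b) ≡.refl)) (trans (*-identityˡ _) (power-1+ b m k))) ⟩
    choose m (suc k) + choose m k
      ≈⟨ trans (+-comm _ _) (sym (pascal m k)) ⟩
    choose (suc m) (suc k) ∎

  -- With 1 as the only second letter, colour `i` contributes (1 + (i, 1))ᵐ, and sortedness
  -- separates the colours into independent binomial coefficients.
  box-single : ∀ r m ρ → Sorted ρ → All (λ c → proj₁ c ∈ [1⋯ r ]) ρ →
    (count : ℕ → ℕ) → (∀ i → segment i ρ ≡ replicate (count i) (i , 1)) →
    box ([1⋯]-increasing r) ([1⋯]-increasing m) ([1⋯]-increasing 1) ρ ≈ ∏ [1⋯ r ] (λ i → choose m (count i))
  box-single r m ρ s ρ∈ count seg≡ = trans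
    (∏ˢ-segments [1⋯ r ] ([1⋯]-increasing r) F (λ i → coloured-∏ˢ i [1⋯ m ] (λ _ → coloured-∏ˢ i [1⋯ 1 ] (λ a → coloured-1+ i a))) ρ s ρ∈)
    (∏-cong-∈ [1⋯ r ] (λ {i} _ → begin
      F i (segment i ρ)                              ≡⟨ ≡.cong (F i) (seg≡ i) ⟩
      F i (replicate (count i) (i , 1))              ≈⟨ ∏ˢ-cong [1⋯ m ] (λ _ → ⋆-identityʳ (1+ (i , 1))) _ ⟩
      ∏ˢ [1⋯ m ] (λ _ → 1+ (i , 1)) (replicate (count i) (i , 1))
        ≡⟨ ≡.cong (λ f → f (replicate (count i) (i , 1))) (≡.trans (∏ˢ-const [1⋯ m ] (1+ (i , 1))) (≡.cong (power (1+ (i , 1))) (length-[1⋯] m))) ⟩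
      power (1+ (i , 1)) m (replicate (count i) (i , 1)) ≈⟨ power-1+ (i , 1) m (count i) ⟩
      choose m (count i)                             ∎))
    where
    F : ℕ → Ser
    F i = ∏ˢ [1⋯ m ] (λ _ → ∏ˢ [1⋯ 1 ] (λ a → 1+ (i , a)))

  -- The contribution to run and sub of the factorisation of a word encoded by a step word.

  runAt : Ser → ℕ × ℕ → ℕ → ℕ → ∀ {L} → Word L → Vec (ℕ × ℕ) L → Carrier
  runAt f a k c []      []      = l k * f []
  runAt f a k c (d ∷ ψ) (b ∷ α) =
    if does (d ≟ c) then 𝟙 (a ≟² b) * runAt f a (suc k) c ψ α else l k * runAt (∂ b f) b 1 d ψ α

  subAt : Ser → ∀ {L} → Word L → Vec (ℕ × ℕ) L → Carrier
  subAt f []      []      = f []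
  subAt f (d ∷ ψ) (b ∷ α) = runAt (∂ b f) b 1 d ψ α

  runAt-same : ∀ f a k c {L} (ψ : Word L) b α → runAt f a k c (c ∷ ψ) (b ∷ α) ≡ 𝟙 (a ≟² b) * runAt f a (suc k) c ψ α
  runAt-same f a k c ψ b α rewrite dec-true (c ≟ c) ≡.refl = ≡.refl

  runAt-next : ∀ f a k c {L} (ψ : Word L) b α → runAt f a k c (suc c ∷ ψ) (b ∷ α) ≡ l k * runAt (∂ b f) b 1 (suc c) ψ α
  runAt-next f a k c ψ b α rewrite dec-false (suc c ≟ c) ℕₚ.1+n≢n = ≡.refl

  -- A step word either repeats `c` or passes to c + 1; these continuations are the two summands of
  -- `run`.
  ∑-runAt : ∀ f a k c {L} (α : Vec (ℕ × ℕ) L) → ∑ (stepsFrom c L) (λ ψ → runAt f a k c ψ α) ≈ run f a k (Vec.toList α)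
  ∑-runAt f a k c []              = +-identityʳ _
  ∑-runAt f a k c {suc L} (b ∷ α) = begin
    ∑ (stepsFrom c (suc L)) (λ ψ → runAt f a k c ψ (b ∷ α))
      ≈⟨ ∑-++ (List.map (c ∷_) (stepsFrom c L)) _ _ ⟩
    ∑ (List.map (c ∷_) (stepsFrom c L)) (λ ψ → runAt f a k c ψ (b ∷ α)) +
      ∑ (List.map (suc c ∷_) (stepsFrom (suc c) L)) (λ ψ → runAt f a k c ψ (b ∷ α))
      ≡⟨ ≡.cong₂ _+_ (∑-map (c ∷_) (stepsFrom c L) _) (∑-map (suc c ∷_) (stepsFrom (suc c) L) _) ⟩
    ∑ (stepsFrom c L) (λ ψ → runAt f a k c (c ∷ ψ) (b ∷ α)) + ∑ (stepsFrom (suc c) L) (λ ψ → runAt f a k c (suc c ∷ ψ) (b ∷ α))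
      ≈⟨ +-cong (trans (∑-cong (stepsFrom c L) (λ ψ → reflexive (runAt-same f a k c ψ b α)))
                  (trans (∑-*ˡ (stepsFrom c L) _ _) (*-congˡ (∑-runAt f a (suc k) c α))))
                (trans (∑-cong (stepsFrom (suc c) L) (λ ψ → reflexive (runAt-next f a k c ψ b α)))
                  (trans (∑-*ˡ (stepsFrom (suc c) L) _ _) (*-congˡ (∑-runAt (∂ b f) b 1 (suc c) α)))) ⟩
    𝟙 (a ≟² b) * run f a (suc k) (Vec.toList α) + l k * run (∂ b f) b 1 (Vec.toList α) ∎

  ∑-subAt : ∀ f {L} (α : Vec (ℕ × ℕ) L) → ∑ (steps L) (λ ψ → subAt f ψ α) ≈ sub f (Vec.toList α)
  ∑-subAt f []              = +-identityʳ _
  ∑-subAt f {suc L} (b ∷ α) = trans (reflexive (∑-map (1 ∷_) (stepsFrom 1 L) _)) (∑-runAt (∂ b f) b 1 1 α)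

  mult : ℕ → ∀ {L} → Word L → ℕ
  mult j ψ = length (List.filter (_≟ j) (Vec.toList ψ))

  mult-≡ : ∀ j {L} (ψ : Word L) → mult j (j ∷ ψ) ≡ suc (mult j ψ)
  mult-≡ j ψ = ≡.cong length (Listₚ.filter-accept (_≟ j) ≡.refl)

  mult-≢ : ∀ j {d L} (ψ : Word L) → d ≢ j → mult j (d ∷ ψ) ≡ mult j ψ
  mult-≢ j ψ d≢j = ≡.cong length (Listₚ.filter-reject (_≟ j) d≢j)

  mult-< : ∀ {c L} {ψ : Word L} j → j < c → Step c ψ → mult j ψ ≡ 0
  mult-< j j<c [] = ≡.refl
  mult-< {ψ = _ ∷ ψ} j j<c (same s) = ≡.trans (mult-≢ j ψ (ℕₚ.<⇒≢ j<c ∘ ≡.sym)) (mult-< j j<c s)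
  mult-< {ψ = _ ∷ ψ} j j<c (next s) = ≡.trans (mult-≢ j ψ (ℕₚ.<⇒≢ (ℕₚ.<-trans j<c ℕₚ.≤-refl) ∘ ≡.sym))
    (mult-< j (ℕₚ.<-trans j<c ℕₚ.≤-refl) s)

  ∏-later : ∀ {c L} {ψ : Word L} → Step c ψ →
            ∏ (later c ψ) (λ j → l (mult j ψ)) ≈ ∏ (later c ψ) (λ j → l (mult j (c ∷ ψ)))
  ∏-later {c} {ψ = ψ} s = ∏-cong-∈ (later c ψ) λ {j} j∈ →
    reflexive (≡.cong l (≡.sym (mult-≢ j ψ (ℕₚ.<⇒≢ (All.lookup (later-> s) j∈)))))

  module _ (colour : ℕ → ℕ × ℕ) where

    contribution : Ser → ℕ → ℕ → ∀ {L} → Word L → List ℕ → Carrier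
    contribution f k c ψ ls = l (k ℕ.+ mult c ψ) * (∏ ls (λ j → l (mult j ψ)) * f (List.map colour ls))

    -- Along a colouring of the letters of `ψ` every equality test succeeds, so each letter of `ψ`
    -- contributes `l` of its multiplicity. For `c` the `k` letters already read are added.
    runAt-constant : ∀ f k {c L} {ψ : Word L} → Step c ψ →
      runAt f (colour c) k c ψ (Vec.map colour ψ) ≈ contribution f k c ψ (later c ψ)
    runAt-constant f k [] = *-cong (reflexive (≡.cong l (≡.sym (ℕₚ.+-identityʳ k)))) (sym (*-identityˡ _))
    runAt-constant f k {c} {ψ = _ ∷ ψ} (same s) = begin
      runAt f (colour c) k c (c ∷ ψ) (colour c ∷ Vec.map colour ψ)
        ≡⟨ runAt-same f (colour c) k c ψ (colour c) (Vec.map colour ψ) ⟩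
      𝟙 (colour c ≟² colour c) * runAt f (colour c) (suc k) c ψ (Vec.map colour ψ)
        ≈⟨ trans (*-congʳ (𝟙-yes (colour c ≟² colour c) ≡.refl)) (*-identityˡ _) ⟩
      runAt f (colour c) (suc k) c ψ (Vec.map colour ψ)
        ≈⟨ runAt-constant f (suc k) s ⟩
      contribution f (suc k) c ψ (later c ψ)
        ≈⟨ *-cong
             (reflexive (≡.cong l (≡.trans (≡.sym (ℕₚ.+-suc k _)) (≡.cong (k ℕ.+_) (≡.sym (mult-≡ c ψ))))))
             (*-congʳ (∏-later s)) ⟩
      contribution f k c (c ∷ ψ) (later c ψ)
        ≡⟨ ≡.cong (contribution f k c (c ∷ ψ)) (later-same c ψ) ⟨
      contribution f k c (c ∷ ψ) (later c (c ∷ ψ)) ∎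
    runAt-constant f k {c} {ψ = _ ∷ ψ} (next s) = begin
      runAt f (colour c) k c (d ∷ ψ) (colour d ∷ Vec.map colour ψ)
        ≡⟨ runAt-next f (colour c) k c ψ (colour d) (Vec.map colour ψ) ⟩
      l k * runAt (∂ (colour d) f) (colour d) 1 d ψ (Vec.map colour ψ)
        ≈⟨ *-congˡ (runAt-constant (∂ (colour d) f) 1 s) ⟩
      l k * contribution (∂ (colour d) f) 1 d ψ (later d ψ)
        ≈⟨ *-cong
             (reflexive (≡.cong l (≡.sym (≡.trans (≡.cong (k ℕ.+_) zero-c) (ℕₚ.+-identityʳ k)))))
             (trans (sym (*-assoc _ _ _)) (*-congʳ (*-cong (reflexive (≡.cong l (≡.sym (mult-≡ d ψ)))) (∏-later s)))) ⟩
      contribution f k c (d ∷ ψ) (d ∷ later d ψ)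
        ≡⟨ ≡.cong (contribution f k c (d ∷ ψ)) (later-next c ψ) ⟨
      contribution f k c (d ∷ ψ) (later c (d ∷ ψ)) ∎
      where
      d = suc c
      zero-c : mult c (d ∷ ψ) ≡ 0
      zero-c = ≡.trans (mult-≢ c ψ ℕₚ.1+n≢n) (mult-< c ℕₚ.≤-refl s)

    subAt-constant : ∀ f {L} {ψ : Word L} → ψ ∈ steps L → subAt f ψ (Vec.map colour ψ) ≈
      ∏ (stepLetters ψ) (λ j → l (mult j ψ)) * f (List.map colour (stepLetters ψ))
    subAt-constant f {zero}  {[]} _ = sym (*-identityˡ _)
    subAt-constant f {suc L} ψ∈ with ∈-map⁻ (1 ∷_) ψ∈
    ... | ψ , p , ≡.refl = trans (runAt-constant (∂ (colour 1) f) 1 s)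
      (trans (sym (*-assoc _ _ _)) (*-congʳ (*-cong (reflexive (≡.cong l (≡.sym (mult-≡ 1 ψ)))) (∏-later s))))
      where
      s : Step 1 ψ
      s = ∈-stepsFrom⁻ p

  -- Either some equality test fails, which annihilates the product, or `α` is constant on each
  -- block of equal letters of `ψ` and so factors through `ψ`.
  runAt-zero : ∀ f a k {c L} {ψ : Word L} (α : Vec (ℕ × ℕ) L) → Step c ψ →
    runAt f a k c ψ α ≈ 0# ⊎ ∃ λ colour → colour c ≡ a × α ≡ Vec.map colour ψ
  runAt-zero f a k []      []       = inj₂ ((λ _ → a) , ≡.refl , ≡.refl)
  runAt-zero f a k {c} {ψ = _ ∷ ψ} (b ∷ α) (same s) = decide (a ≟² b) (runAt-zero f a (suc k) α s)
    where
    decide : Dec (a ≡ b) → runAt f a (suc k) c ψ α ≈ 0# ⊎ (∃ λ colour → colour c ≡ a × α ≡ Vec.map colour ψ) →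
             runAt f a k c (c ∷ ψ) (b ∷ α) ≈ 0# ⊎ ∃ λ colour → colour c ≡ a × b ∷ α ≡ Vec.map colour (c ∷ ψ)
    decide (no a≢b)     _         = inj₁ (trans (reflexive (runAt-same f a k c ψ b α)) (trans (*-congʳ (𝟙-no (a ≟² b) a≢b)) (zeroˡ _)))
    decide (yes _)      (inj₁ ≈0) = inj₁ (trans (reflexive (runAt-same f a k c ψ b α)) (trans (*-congˡ ≈0) (zeroʳ _)))
    decide (yes ≡.refl) (inj₂ (colour , p , q)) = inj₂ (colour , p , ≡.cong₂ _∷_ (≡.sym p) q)
  runAt-zero f a k {c} {ψ = _ ∷ ψ} (b ∷ α) (next s) with runAt-zero (∂ b f) b 1 α s
  ... | inj₁ ≈0 = inj₁ (trans (reflexive (runAt-next f a k c ψ b α)) (trans (*-congˡ ≈0) (zeroʳ _)))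
  ... | inj₂ (colour , p , q) = inj₂ (colour′ , at-c , ≡.cong₂ _∷_ (≡.trans (≡.sym p) (off-c ℕₚ.1+n≢n)) (≡.trans q (map-off s)))
    where
    -- The remaining letters of `ψ` all exceed `c`, so the colour of `c` can be reset to `a` without
    -- affecting them; `e` in `map-off` records by how much they exceed it.
    colour′ : ℕ → ℕ × ℕ
    colour′ j = if does (j ≟ c) then a else colour j
    at-c : colour′ c ≡ a
    at-c rewrite dec-true (c ≟ c) ≡.refl = ≡.refl
    off-c : ∀ {j} → j ≢ c → colour j ≡ colour′ j
    off-c {j} j≢c rewrite dec-false (j ≟ c) j≢c = ≡.refl
    map-off : ∀ {e L} {ψ : Word L} → Step (suc (e ℕ.+ c)) ψ → Vec.map colour ψ ≡ Vec.map colour′ ψ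
    map-off []           = ≡.refl
    map-off {e} (same s) = ≡.cong₂ _∷_ (off-c (ℕₚ.<⇒≢ (s≤s (ℕₚ.m≤n+m c e)) ∘ ≡.sym)) (map-off {e} s)
    map-off {e} (next s) = ≡.cong₂ _∷_ (off-c (ℕₚ.<⇒≢ (s≤s (ℕₚ.m≤n⇒m≤1+n (ℕₚ.m≤n+m c e))) ∘ ≡.sym)) (map-off {suc e} s)

  subAt-zero : ∀ f {L} {ψ : Word L} (α : Vec (ℕ × ℕ) L) → ψ ∈ steps L →
    subAt f ψ α ≈ 0# ⊎ ∃ λ colour → α ≡ Vec.map colour ψ
  subAt-zero f {zero}  {[]} []     _  = inj₂ ((λ _ → 0 , 0) , ≡.refl)
  subAt-zero f {suc L} (b ∷ α) ψ∈ with ∈-map⁻ (1 ∷_) ψ∈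
  ... | ψ , p , ≡.refl with runAt-zero (∂ b f) b 1 α (∈-stepsFrom⁻ p)
  ...   | inj₁ ≈0              = inj₁ ≈0
  ...   | inj₂ (colour , q , r) = inj₂ (colour , ≡.cong₂ _∷_ (≡.sym q) r)

-- Packings of two words as packings of three with a constant word.

word-packed : ∀ {n} (w : PackedWord n) → Packed (word w)
word-packed (mkPacked w p) = recompute (packed? w) p

toList-tabulate⁺ : ∀ {a p} {A : Set a} {P : A → Set p} {n} (f : Fin n → A) → (∀ i → P (f i)) → All P (Vec.toList (tabulate f))
toList-tabulate⁺ {n = zero}  f p = []
toList-tabulate⁺ {n = suc n} f p = p zero ∷ toList-tabulate⁺ (f ∘ suc) (p ∘ suc)

toList-tabulate-pairs : ∀ {a r} {A : Set a} {R : A → A → Set r} {n} (f : Fin n → A) → (∀ {i j} → i Fin.< j → R (f i) (f j)) →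
                        AllPairs R (Vec.toList (tabulate f))
toList-tabulate-pairs {n = zero}  f r = []
toList-tabulate-pairs {n = suc n} f r =
  toList-tabulate⁺ (f ∘ suc) (λ _ → r (s≤s z≤n)) ∷ toList-tabulate-pairs (f ∘ suc) (λ i<j → r (s≤s i<j))

-- The word 1⋯1, which does not influence the lexicographic order.
ones : ∀ n → Word n
ones n = Vec.replicate n 1

Lex₃-ones : ∀ {n} (u x : Word n) i j → Lex u (LetterLt x) i j ⇔ Lex₃ u x (ones n) i j
Lex₃-ones {n} u x i j = mk⇔
  (λ { (inj₁ lt) → inj₁ lt ; (inj₂ (eq , lt)) → inj₂ (eq , inj₁ lt) })
  (λ { (inj₁ lt) → inj₁ lt ; (inj₂ (eq , inj₁ lt)) → inj₂ (eq , lt)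
     ; (inj₂ (eq , inj₂ (_ , lt))) → contradiction lt (ℕₚ.<-irrefl (≡.trans (lookup-replicate i 1) (≡.sym (lookup-replicate j 1)))) })

Lex-ones : ∀ {n} (x : Word n) i j → LetterLt x i j ⇔ Lex (ones n) (LetterLt x) i j
Lex-ones {n} x i j = mk⇔ (λ lt → inj₂ (≡.trans (lookup-replicate i 1) (≡.sym (lookup-replicate j 1)) , lt))
  (λ { (inj₁ lt) → contradiction lt (ℕₚ.<-irrefl (≡.trans (lookup-replicate i 1) (≡.sym (lookup-replicate j 1)))) ; (inj₂ (_ , lt)) → lt })

WeaklyFiner-ones : ∀ {n} (z : Word n) → WeaklyFiner z (ones n)
WeaklyFiner-ones z i j _ = ≡.trans (lookup-replicate i 1) (≡.sym (lookup-replicate j 1))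

Lex-pack : ∀ {n} (u x : Word n) i j → Lex u (LetterLt (pack x)) i j ⇔ Lex u (LetterLt x) i j
Lex-pack u x i j = packBiword-pack-< u x i j ⇔-∘ mk⇔ (from⇔ E) (to⇔ E)
  where E = packBiword-orders u (pack x) i j

packBiword-pack-ones≡⇔ : ∀ {n} (w x : Word n) {z} → Packed z → packBiword w (pack x) ≡ z ⇔ Orders z (Lex₃ w x (ones n))
packBiword-pack-ones≡⇔ w x {z} z-packed =
  Orders-cong {z = z} (λ i j → Lex₃-ones w x i j ⇔-∘ Lex-pack w x i j) ⇔-∘ packBiword≡⇔ w (pack x) z-packed

-- Coordinates of the internal products and of the elements K_w.

module Coordinates {c ℓ₁ ℓ₂} (K : HeytingField c ℓ₁ ℓ₂) (char0 : CharacteristicZero K) where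
  open Characteristic0 K char0
  open CommutativeRing R hiding (zero)
  open Sums R
  open Evaluation R
  open Binomials K char0
  open Counting R using (∑-packedWords; box; count-orders)
  open ColouredSeries K char0
  open CharZero K char0
    using (binom; σᵗ; E; N; _∗_; WQSym*; const; coeff; _*ᵖ_; _≈ᵖ_; Poly; polyRing)
  open import Algebra.Properties.CommutativeSemigroup *-commutativeSemigroup using (x∙yz≈y∙xz)
  open import Relation.Binary.Reasoning.Setoid setoid
  private
    module L = InternalProduct (fieldRawRing K)
    module Sᵖ = FiniteSums polyRing
  open L using () renaming (N to Nᴷ; _∗_ to _∗ᴷ_)

  infix 4 _≟ʷ_
  _≟ʷ_ : ∀ {n} (x y : Word n) → Dec (x ≡ y)
  _≟ʷ_ = Vecₚ.≡-dec _≟_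

  ∑-packedList-δ : ∀ {n} {x : Word n} (F : Word n → Carrier) → Packed x → ∑ (packedList n) (λ y → 𝟙 (x ≟ʷ y) * F y) ≈ F x
  ∑-packedList-δ {n} F x-packed = ∑-δ _≟ʷ_ F (packedList-unique n) (∈-packedList⁺ x-packed)

  Nᴷ-∗ : ∀ {n} (x : Word n) → Packed x → (f : L.WQSym* n) → ∀ z →
    (Nᴷ x ∗ᴷ f) z ≈ ∑ (packedWords n) (λ v → f v * 𝟙 (packBiword x (word v) ≟ʷ word z))
  Nᴷ-∗ {n} x x-packed f z = begin
    ∑ (packedWords n) (λ u → ∑ (packedWords n) (λ v → (𝟙 (x ≟ʷ word u) * f v) * 𝟙 (packBiword (word u) (word v) ≟ʷ word z)))
      ≈⟨ ∑-packedWords n (λ u → ∑ (packedWords n) (λ v → (𝟙 (x ≟ʷ u) * f v) * 𝟙 (packBiword u (word v) ≟ʷ word z))) ⟩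
    ∑ (packedList n) (λ u → ∑ (packedWords n) (λ v → (𝟙 (x ≟ʷ u) * f v) * 𝟙 (packBiword u (word v) ≟ʷ word z)))
      ≈⟨ ∑-cong (packedList n) (λ u → trans (∑-cong (packedWords n) (λ v → *-assoc _ _ _)) (∑-*ˡ (packedWords n) _ _)) ⟩
    ∑ (packedList n) (λ u → 𝟙 (x ≟ʷ u) * ∑ (packedWords n) (λ v → f v * 𝟙 (packBiword u (word v) ≟ʷ word z)))
      ≈⟨ ∑-packedList-δ (λ u → ∑ (packedWords n) (λ v → f v * 𝟙 (packBiword u (word v) ≟ʷ word z))) x-packed ⟩
    ∑ (packedWords n) (λ v → f v * 𝟙 (packBiword x (word v) ≟ʷ word z)) ∎

  ∗-Nᴷ : ∀ {n} (x : Word n) → Packed x → (f : L.WQSym* n) → ∀ z →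
    (f ∗ᴷ Nᴷ x) z ≈ ∑ (packedWords n) (λ u → f u * 𝟙 (packBiword (word u) x ≟ʷ word z))
  ∗-Nᴷ {n} x x-packed f z = ∑-cong (packedWords n) (λ u → begin
    ∑ (packedWords n) (λ v → (f u * 𝟙 (x ≟ʷ word v)) * 𝟙 (packBiword (word u) (word v) ≟ʷ word z))
      ≈⟨ ∑-packedWords n (λ v → (f u * 𝟙 (x ≟ʷ v)) * 𝟙 (packBiword (word u) v ≟ʷ word z)) ⟩
    ∑ (packedList n) (λ v → (f u * 𝟙 (x ≟ʷ v)) * 𝟙 (packBiword (word u) v ≟ʷ word z))
      ≈⟨ ∑-cong (packedList n) (λ v → trans (*-congʳ (*-comm _ _)) (*-assoc _ _ _)) ⟩
    ∑ (packedList n) (λ v → 𝟙 (x ≟ʷ v) * (f u * 𝟙 (packBiword (word u) v ≟ʷ word z)))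
      ≈⟨ ∑-packedList-δ (λ v → f u * 𝟙 (packBiword (word u) v ≟ʷ word z)) x-packed ⟩
    f u * 𝟙 (packBiword (word u) x ≟ʷ word z) ∎)

  ∗ᴷ-cong : ∀ {n} {f f′ g g′ : L.WQSym* n} → (∀ w → f w ≈ f′ w) → (∀ w → g w ≈ g′ w) → ∀ z → (f ∗ᴷ g) z ≈ (f′ ∗ᴷ g′) z
  ∗ᴷ-cong {n} f≈ g≈ z = ∑-cong (packedWords n) (λ u → ∑-cong (packedWords n) (λ v → *-congʳ (*-cong (f≈ u) (g≈ v))))

  eval-N : ∀ {n} a (x : Word n) w → eval a (N x w) ≈ Nᴷ x w
  eval-N a x w with does (x ≟ʷ word w)
  ... | true  = eval-const a 1#
  ... | false = refl

  eval-∗ : ∀ {n} a (f g : WQSym* n) z → eval a ((f ∗ g) z) ≈ ((λ w → eval a (f w)) ∗ᴷ (λ w → eval a (g w))) z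
  eval-∗ {n} a f g z = trans
    (eval-∑ a (packedWords n) (λ u → Sᵖ.∑ (packedWords n) (λ v → (f u *ᵖ g v) *ᵖ N (packBiword (word u) (word v)) z)))
    (∑-cong (packedWords n) (λ u → trans
      (eval-∑ a (packedWords n) (λ v → (f u *ᵖ g v) *ᵖ N (packBiword (word u) (word v)) z))
      (∑-cong (packedWords n) (λ v → trans (eval-*ᵖ a (f u *ᵖ g v) _)
        (*-cong (eval-*ᵖ a (f u) (g v)) (eval-N a (packBiword (word u) (word v)) z))))))

  eval-σᵗ : ∀ m {n} (x : PackedWord n) → eval (ι m) (σᵗ n x) ≈ choose m (maxW (word x))
  eval-σᵗ m {n} x = begin
    eval (ι m) (σᵗ n x)
      ≈⟨ eval-∑ (ι m) (packedWords n) (λ u → binom (maxW (word u)) *ᵖ N (word u) x) ⟩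
    ∑ (packedWords n) (λ u → eval (ι m) (binom (maxW (word u)) *ᵖ N (word u) x))
      ≈⟨ ∑-cong (packedWords n) (λ u → trans (eval-*ᵖ (ι m) (binom (maxW (word u))) _) (*-congˡ (eval-N (ι m) (word u) x))) ⟩
    ∑ (packedWords n) (λ u → choose m (maxW (word u)) * 𝟙 (word u ≟ʷ word x))
      ≈⟨ ∑-packedWords n (λ u → choose m (maxW u) * 𝟙 (u ≟ʷ word x)) ⟩
    ∑ (packedList n) (λ u → choose m (maxW u) * 𝟙 (u ≟ʷ word x))
      ≈⟨ ∑-cong (packedList n) (λ u → trans (*-comm _ _) (*-congʳ (𝟙-cong (u ≟ʷ word x) (word x ≟ʷ u) ≡.sym ≡.sym))) ⟩
    ∑ (packedList n) (λ u → 𝟙 (word x ≟ʷ u) * choose m (maxW u))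
      ≈⟨ ∑-packedList-δ (λ u → choose m (maxW u)) (word-packed x) ⟩
    choose m (maxW (word x)) ∎

  σᵗ≈binom : ∀ {n} (x : PackedWord n) → σᵗ n x ≈ᵖ binom (maxW (word x))
  σᵗ≈binom {n} x = eval-injective (σᵗ n x) (binom (maxW (word x))) (λ m → eval-σᵗ m x)

  segment-single : ∀ i {L} (h : Fin L → ℕ) (g : Fin L → ℕ) → (∀ a → g a ≡ 1) →
    segment i (Vec.toList (tabulate (λ a → h a , g a))) ≡ replicate (mult i (tabulate h)) (i , 1)
  segment-single i {zero}  h g g≡1 = ≡.refl
  segment-single i {suc L} h g g≡1 with h zero ≟ i
  ... | yes eq rewrite Listₚ.filter-accept (λ c → proj₁ c ≟ i) {(h zero , g zero)} {Vec.toList (tabulate (λ a → h (suc a) , g (suc a)))} eq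
                     | Listₚ.filter-accept (_≟ i) {h zero} {Vec.toList (tabulate (h ∘ suc))} eq =
    ≡.cong₂ _∷_ (≡.cong₂ _,_ eq (g≡1 zero)) (segment-single i (h ∘ suc) (g ∘ suc) (g≡1 ∘ suc))
  ... | no ≢ rewrite Listₚ.filter-reject (λ c → proj₁ c ≟ i) {(h zero , g zero)} {Vec.toList (tabulate (λ a → h (suc a) , g (suc a)))} ≢
                   | Listₚ.filter-reject (_≟ i) {h zero} {Vec.toList (tabulate (h ∘ suc))} ≢ =
    segment-single i (h ∘ suc) (g ∘ suc) (g≡1 ∘ suc)

  ones-∈ : ∀ {n} j → lookup (ones n) j ∈ [1⋯ 1 ]
  ones-∈ j = ≡.subst (_∈ [1⋯ 1 ]) (≡.sym (lookup-replicate j 1)) (here ≡.refl)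

  -- The case of constant `v`. It serves twice: with constant `u` it interprets `choose`, and with
  -- `u` replaced by `w` it yields the coordinates of `N w ∗ σᵗ n`.
  count-single : ∀ m {r n} (u : Word n) {z : Word n} (z-packed : Packed z) (z-u : Finer z u) → (∀ j → lookup u j ∈ [1⋯ r ]) →
    ∀ {p} {P : Word n → Set p} (P? : ∀ x → Dec (P x)) → (∀ x → P x ⇔ Orders z (Lex₃ u x (ones n))) →
    ∑ (wordsOver [1⋯ m ] n) (λ x → 𝟙 (P? x)) ≈
    ∏ [1⋯ r ] (λ i → choose m (mult i (tabulate (λ a → lookup u (Letters.pos z-packed a)))))
  count-single m {r} {n} u {z} z-packed z-u u∈ P? P⇔ = trans
    (count-orders ([1⋯]-increasing r) ([1⋯]-increasing m) ([1⋯]-increasing 1) u (ones n) z-packed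
       (Finer⇒WeaklyFiner {w = z} {u} z-u) (WeaklyFiner-ones z) u∈ ones-∈ P? P⇔)
    (box-single r m _
      (toList-tabulate-pairs _ (λ {a} {b} a<b → z-u (pos a) (pos b)
        (ℕₚ.<⇒≤ (≡.subst₂ _<_ (≡.sym (lookup-pos a)) (≡.sym (lookup-pos b)) (s≤s a<b)))))
      (toList-tabulate⁺ _ (λ a → u∈ (pos a)))
      _ (λ i → segment-single i (λ a → lookup u (pos a)) _ (λ a → lookup-replicate (pos a) 1)))
    where open Letters z-packed

  -- With both outer words constant, the order of the triples is that of the middle word alone, and
  -- the product of binomials has a single factor.
  choose≈count : ∀ m {n} {x : Word n} → Packed x → choose m (maxW x) ≈ ∑ (wordsOver [1⋯ m ] n) (λ x′ → 𝟙 (pack x′ ≟ʷ x))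
  choose≈count m {n} {x} x-packed = sym (trans
    (count-single m {1} (ones n) x-packed (λ i j _ → ℕₚ.≤-reflexive (≡.trans (lookup-replicate i 1) (≡.sym (lookup-replicate j 1))))
      ones-∈ (λ x′ → pack x′ ≟ʷ x)
      (λ x′ → Orders-cong {z = x} (λ i j → Lex₃-ones (ones n) x′ i j ⇔-∘ Lex-ones x′ i j) ⇔-∘ pack≡⇔ x′ x-packed))
    (trans (*-identityʳ _) (reflexive (≡.cong (choose m) (count _ (λ a → lookup-replicate (Letters.pos x-packed a) 1))))))
    where
    count : ∀ {L} (h : Fin L → ℕ) → (∀ a → h a ≡ 1) → mult 1 (tabulate h) ≡ L
    count {zero}  h h≡1 = ≡.refl
    count {suc L} h h≡1 = ≡.trans (≡.cong length (Listₚ.filter-accept (_≟ 1) (h≡1 zero))) (≡.cong suc (count (h ∘ suc) (h≡1 ∘ suc)))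

  ∑-choose : ∀ m {n} (F : Word n → Carrier) → ∑ (packedWords n) (λ x → choose m (maxW (word x)) * F (word x)) ≈
             ∑ (wordsOver [1⋯ m ] n) (λ x → F (pack x))
  ∑-choose m {n} F = begin
    ∑ (packedWords n) (λ x → choose m (maxW (word x)) * F (word x))
      ≈⟨ ∑-packedWords n (λ x → choose m (maxW x) * F x) ⟩
    ∑ (packedList n) (λ x → choose m (maxW x) * F x)
      ≈⟨ ∑-cong-∈ (packedList n) (λ x∈ → trans (*-congʳ (choose≈count m (∈-packedList⁻ x∈))) (sym (∑-*ʳ (wordsOver [1⋯ m ] n) _ _))) ⟩
    ∑ (packedList n) (λ x → ∑ (wordsOver [1⋯ m ] n) (λ x′ → 𝟙 (pack x′ ≟ʷ x) * F x))
      ≈⟨ ∑-swap (packedList n) (wordsOver [1⋯ m ] n) _ ⟩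
    ∑ (wordsOver [1⋯ m ] n) (λ x′ → ∑ (packedList n) (λ x → 𝟙 (pack x′ ≟ʷ x) * F x))
      ≈⟨ ∑-cong (wordsOver [1⋯ m ] n) (λ x′ → ∑-packedList-δ F (packOver-packed <-strictTotalOrder x′)) ⟩
    ∑ (wordsOver [1⋯ m ] n) (λ x′ → F (pack x′)) ∎

  𝐊ʷ : ∀ {n} → Word n → L.WQSym* n
  𝐊ʷ {n} w = Nᴷ w ∗ᴷ E n (maxW w)

  module _ {n} {w : Word n} (w-packed : Packed w) (z : PackedWord n) where

    private
      z-packed : Packed (word z)
      z-packed = word-packed z

      -- The coordinate of `N w ∗ σᵗ n` at `z` as a polynomial in t; K_w is its coefficient at
      -- t^(max w).
      Q : Poly
      Q = Sᵖ.∑ (packedWords n) (λ x → const (𝟙 (packBiword w (word x) ≟ʷ word z)) *ᵖ binom (maxW (word x)))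

      𝐊≈coeff : 𝐊ʷ w z ≈ coeff Q (maxW w)
      𝐊≈coeff = trans (Nᴷ-∗ w w-packed (E n (maxW w)) z) (sym (trans
        (coeff-∑ (packedWords n) (λ x → const (𝟙 (packBiword w (word x) ≟ʷ word z)) *ᵖ binom (maxW (word x))) (maxW w))
        (∑-cong (packedWords n) (λ x → trans (coeff-const-*ᵖ _ (binom (maxW (word x))) (maxW w))
          (trans (*-comm _ _) (*-congʳ (sym (σᵗ≈binom x (maxW w)))))))))

      eval-Q : ∀ m → eval (ι m) Q ≈ ∑ (wordsOver [1⋯ m ] n) (λ x → 𝟙 (packBiword w (pack x) ≟ʷ word z))
      eval-Q m = trans
        (eval-∑ (ι m) (packedWords n) (λ x → const (𝟙 (packBiword w (word x) ≟ʷ word z)) *ᵖ binom (maxW (word x))))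
        (trans (∑-cong (packedWords n) (λ x → trans (eval-*ᵖ (ι m) (const _) (binom (maxW (word x))))
            (trans (*-congʳ (eval-const (ι m) _)) (*-comm _ _))))
          (∑-choose m (λ x → 𝟙 (packBiword w x ≟ʷ word z))))

    𝐊-support : ¬ Finer (word z) w → 𝐊ʷ w z ≈ 0#
    𝐊-support ¬z-w = trans (Nᴷ-∗ w w-packed (E n (maxW w)) z) (trans
      (∑-cong (packedWords n) (λ x → trans (*-congˡ (𝟙-no (packBiword w (word x) ≟ʷ word z) (λ eq → ¬z-w (finer x eq)))) (zeroʳ _)))
      (∑-zero (packedWords n)))
      where
      finer : ∀ x → packBiword w (word x) ≡ word z → Finer (word z) w
      finer x eq = Orders-Lex₃⇒Finer w (word x) (ones n) {word z}
        (to⇔ (Orders-cong {z = word z} (Lex₃-ones w (word x))) (to⇔ (packBiword≡⇔ w (word x) z-packed) eq))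

    -- At every natural number m the polynomial `Q` counts words, which gives the product of the
    -- `choose m (occ j)`. Hence `Q` is the product of the corresponding `binom`, and its
    -- coefficient at the number of factors is formed from their linear coefficients.
    𝐊-coordinate : Finer (word z) w →
      𝐊ʷ w z ≈ ∏ [1⋯ maxW w ] (λ j → l (mult j (tabulate (λ a → lookup w (Letters.pos z-packed a)))))
    𝐊-coordinate z-w = begin
      𝐊ʷ w z                       ≈⟨ 𝐊≈coeff ⟩
      coeff Q (maxW w)             ≈⟨ eval-injective Q (Sᵖ.∏ [1⋯ maxW w ] (binom ∘ occ)) evals (maxW w) ⟩
      coeff (Sᵖ.∏ [1⋯ maxW w ] (binom ∘ occ)) (maxW w)
        ≡⟨ ≡.cong (coeff (Sᵖ.∏ [1⋯ maxW w ] (binom ∘ occ))) (length-[1⋯] (maxW w)) ⟨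
      coeff (Sᵖ.∏ [1⋯ maxW w ] (binom ∘ occ)) (length [1⋯ maxW w ])
        ≈⟨ coeff-∏-low [1⋯ maxW w ] (binom ∘ occ) positive ⟩
      ∏ [1⋯ maxW w ] (λ j → l (occ j)) ∎
      where
      open Letters z-packed
      occ : ℕ → ℕ
      occ j = mult j (tabulate (λ a → lookup w (pos a)))
      evals : ∀ m → eval (ι m) Q ≈ eval (ι m) (Sᵖ.∏ [1⋯ maxW w ] (binom ∘ occ))
      evals m = trans (eval-Q m) (trans
        (count-single m w z-packed z-w (λ j → ∈-[1⋯]⁺ (packed⇒positive w-packed j) (lookup≤max w j))
          (λ x → packBiword w (pack x) ≟ʷ word z) (λ x → packBiword-pack-ones≡⇔ w x z-packed))
        (sym (eval-∏ (ι m) [1⋯ maxW w ] (binom ∘ occ))))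
      occurs : ∀ {k L} (h : Fin L → ℕ) a → h a ≡ k → mult k (tabulate h) ≢ 0
      occurs {k} h zero    eq none = contradiction (≡.trans (≡.sym (≡.cong length (Listₚ.filter-accept (_≟ k) eq))) none) λ ()
      occurs {k} h (suc a) eq none with h zero ≟ k
      ... | yes p = contradiction (≡.trans (≡.sym (≡.cong length (Listₚ.filter-accept (_≟ k) p))) none) λ ()
      ... | no ≢ = occurs (h ∘ suc) a eq (≡.trans (≡.sym (≡.cong length (Listₚ.filter-reject (_≟ k) ≢))) none)
      -- Every letter of `w` has some letter of `z` merged into it, so `occ j` is not 0 and the
      -- binomial has no constant term.
      positive : ∀ {j} → j ∈ [1⋯ maxW w ] → coeff (binom (occ j)) 0 ≈ 0#
      positive {j} j∈ with ∈-[1⋯]⁻ j∈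
      ... | s≤s {n = k} _ , k≤ with packed⇒letter w-packed k k≤
      ...   | p , wp≡ with occ (suc k) | occurs (λ a → lookup w (pos a)) (idx p)
                         (≡.trans (Finer⇒WeaklyFiner {w = word z} {w} z-w _ _ (lookup-pos-idx p)) wp≡)
      ...     | zero  | ≢0 = contradiction ≡.refl ≢0
      ...     | suc o | _  = coeff-binom-zero o

  eval-lhs : ∀ m {n} (u v : Word n) → Packed u → Packed v → ∀ z →
    eval (ι m) ((N u ∗ σᵗ n ∗ N v) z) ≈ ∑ (wordsOver [1⋯ m ] n) (λ x → 𝟙 (packBiword (packBiword u (pack x)) v ≟ʷ word z))
  eval-lhs m {n} u v u-packed v-packed z = begin
    eval (ι m) ((N u ∗ σᵗ n ∗ N v) z)
      ≈⟨ eval-∗ (ι m) (N u ∗ σᵗ n) (N v) z ⟩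
    ((λ y → eval (ι m) ((N u ∗ σᵗ n) y)) ∗ᴷ (λ y → eval (ι m) (N v y))) z
      ≈⟨ ∗ᴷ-cong inner (eval-N (ι m) v) z ⟩
    (F ∗ᴷ Nᴷ v) z
      ≈⟨ ∗-Nᴷ v v-packed F z ⟩
    ∑ (packedWords n) (λ y → F y * 𝟙 (packBiword (word y) v ≟ʷ word z))
      ≈⟨ ∑-packedWords n (λ y → ∑ X (λ x → 𝟙 (packBiword u (pack x) ≟ʷ y)) * 𝟙 (packBiword y v ≟ʷ word z)) ⟩
    ∑ (packedList n) (λ y → ∑ X (λ x → 𝟙 (packBiword u (pack x) ≟ʷ y)) * 𝟙 (packBiword y v ≟ʷ word z))
      ≈⟨ ∑-cong (packedList n) (λ y → ∑-*ʳ X (𝟙 (packBiword y v ≟ʷ word z)) _) ⟨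
    ∑ (packedList n) (λ y → ∑ X (λ x → 𝟙 (packBiword u (pack x) ≟ʷ y) * 𝟙 (packBiword y v ≟ʷ word z)))
      ≈⟨ ∑-swap (packedList n) X _ ⟩
    ∑ X (λ x → ∑ (packedList n) (λ y → 𝟙 (packBiword u (pack x) ≟ʷ y) * 𝟙 (packBiword y v ≟ʷ word z)))
      ≈⟨ ∑-cong X (λ x → ∑-packedList-δ (λ y → 𝟙 (packBiword y v ≟ʷ word z)) (packBiword-packed u (pack x))) ⟩
    ∑ X (λ x → 𝟙 (packBiword (packBiword u (pack x)) v ≟ʷ word z)) ∎
    where
    X = wordsOver [1⋯ m ] n
    F : L.WQSym* n
    F y = ∑ X (λ x → 𝟙 (packBiword u (pack x) ≟ʷ word y))
    inner : ∀ y → eval (ι m) ((N u ∗ σᵗ n) y) ≈ F y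
    inner y = begin
      eval (ι m) ((N u ∗ σᵗ n) y)
        ≈⟨ eval-∗ (ι m) (N u) (σᵗ n) y ⟩
      ((λ y → eval (ι m) (N u y)) ∗ᴷ (λ y → eval (ι m) (σᵗ n y))) y
        ≈⟨ ∗ᴷ-cong (eval-N (ι m) u) (eval-σᵗ m) y ⟩
      (Nᴷ u ∗ᴷ (λ y → choose m (maxW (word y)))) y
        ≈⟨ Nᴷ-∗ u u-packed _ y ⟩
      ∑ (packedWords n) (λ x → choose m (maxW (word x)) * 𝟙 (packBiword u (word x) ≟ʷ word y))
        ≈⟨ ∑-choose m (λ x → 𝟙 (packBiword u x ≟ʷ word y)) ⟩
      F y ∎

-- Comparison of the two sides, coordinate by coordinate.

module Expansion {c ℓ₁ ℓ₂} (K : HeytingField c ℓ₁ ℓ₂) (char0 : CharacteristicZero K) {n} (u v : PackedWord n) where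
  open Characteristic0 K char0
  open CommutativeRing R hiding (zero)
  open Sums R
  open Evaluation R
  open Binomials K char0
  open Counting R using (∑-packedWords; box; count-orders; _≟²_)
  open ColouredSeries K char0
  open Coordinates K char0
  open CharZero K char0
    using (σᵗ; 𝐊; N; _∗_; _≋_; WQSym*; ∑ᵂ; _•_; extendScalars; const; _*ᵖ_; Poly; polyRing; goldberg; gᵗ)
  open FormalSeries R _≟²_ using (module Substitution)
  open Substitution l using (sub)
  open import Relation.Binary.Reasoning.Setoid setoid
  private
    module Sᵖ = FiniteSums polyRing
    module S₁ = FormalSeries R _≟_
    module G = Goldberg K char0

  private
    u-packed = word-packed u
    v-packed = word-packed v
    r : ℕ
    r = maxW (word u)

  open Subwords (word u)

  v′ : Word n
  v′ = blockwise (word v)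

  -- A common bound for the letters of all refinement words, so that every colour uses the same
  -- product of exponentials.
  M : ℕ
  M = maxW v′

  private
    u∈ : ∀ j → lookup (word u) j ∈ [1⋯ r ]
    u∈ j = ∈-[1⋯]⁺ (packed⇒positive u-packed j) (lookup≤max (word u) j)

    v′∈ : ∀ j → lookup v′ j ∈ [1⋯ M ]
    v′∈ j = ∈-[1⋯]⁺ (blockwise-positive (word v) j) (lookup≤max v′ j)

  InW : Word n → Set
  InW w = Finer w (word u) × WeaklyFiner w (word v)

  inW? : ∀ w → Dec (InW w)
  inW? w = finer? w (word u) ×-dec weaklyFiner? w (word v)

  goldbergs : Word n → Poly
  goldbergs w = Sᵖ.∏ [1⋯ r ] (λ i → goldberg (refinementWord (packedSubword (word u) i (word v)) (packedSubword (word u) i w)))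

  -- Membership in W(u, v) is turned into a weight, so that the sum runs over all packed words and
  -- can be matched with the step words.
  summand : ℕ → PackedWord n → Word n → Carrier
  summand m z w = 𝟙 (inW? w) * (eval (ι m) (goldbergs w) * 𝐊ʷ w z)

  rhs : WQSym* n
  rhs = ∑ᵂ (W u v) (λ w → goldbergs (word w) • extendScalars (𝐊 w))

  eval-rhs : ∀ m z → eval (ι m) (rhs z) ≈ ∑ (packedList n) (summand m z)
  eval-rhs m z = begin
    eval (ι m) (rhs z)
      ≈⟨ eval-∑ (ι m) (W u v) (λ w → goldbergs (word w) *ᵖ const (𝐊 w z)) ⟩
    ∑ (W u v) (λ w → eval (ι m) (goldbergs (word w) *ᵖ const (𝐊 w z)))
      ≈⟨ ∑-cong (W u v) (λ w → trans (eval-*ᵖ (ι m) (goldbergs (word w)) (const (𝐊 w z))) (*-congˡ (eval-const (ι m) (𝐊 w z)))) ⟩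
    ∑ (W u v) (λ w → eval (ι m) (goldbergs (word w)) * 𝐊ʷ (word w) z)
      ≈⟨ ∑-filter (inW? ∘ word) (packedWords n) (λ w → eval (ι m) (goldbergs (word w)) * 𝐊ʷ (word w) z) ⟩
    ∑ (packedWords n) (summand m z ∘ word)
      ≈⟨ ∑-packedWords n (summand m z) ⟩
    ∑ (packedList n) (summand m z) ∎

  module _ {w : Word n} (w-packed : Packed w) (w∈W : InW w) where
    private
      w-u : Finer w (word u)
      w-u = proj₁ w∈W
      w-v : WeaklyFiner w (word v)
      w-v = proj₂ w∈W

    colourOf : ℕ → ℕ × ℕ
    colourOf = colour (word v) w-packed w-u w-v

    private
      colourOf-lookup : ∀ j → colourOf (lookup w j) ≡ (lookup (word u) j , lookup v′ j)
      colourOf-lookup = colour-lookup (word v) w-packed w-u w-v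

      occurs : ∀ {c} → c ∈ [1⋯ maxW w ] → ∃ λ j → lookup w j ≡ c
      occurs = letter-occurs (word v) w-packed w-u w-v

    -- The word of bases a₁ ⋯ aₛ: for every z finer than `w`, the word `α` of z arises from it by
    -- repeating each letter as often as letters of z are merged.
    ρ : List (ℕ × ℕ)
    ρ = List.map colourOf [1⋯ maxW w ]

    ρ-sorted : Sorted ρ
    ρ-sorted = AllPairsₚ.map⁺ (AllPairs-map-∈ mono ([1⋯]-increasing (maxW w)))
      where
      mono : ∀ {c d} → c ∈ [1⋯ maxW w ] → d ∈ [1⋯ maxW w ] → c < d → proj₁ (colourOf c) ≤ proj₁ (colourOf d)
      mono c∈ d∈ c<d with occurs c∈ | occurs d∈
      ... | j , ≡.refl | k , ≡.refl = ≡.subst₂ _≤_ (≡.sym (≡.cong proj₁ (colourOf-lookup j))) (≡.sym (≡.cong proj₁ (colourOf-lookup k)))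
        (w-u j k (ℕₚ.<⇒≤ c<d))

    ρ-bounded : All (λ c → proj₁ c ∈ [1⋯ r ] × proj₂ c ≤ M) ρ
    ρ-bounded = Allₚ.map⁺ (All.tabulate bounded)
      where
      bounded : ∀ {c} → c ∈ [1⋯ maxW w ] → proj₁ (colourOf c) ∈ [1⋯ r ] × proj₂ (colourOf c) ≤ M
      bounded c∈ with occurs c∈
      ... | j , ≡.refl = ≡.subst (λ c → proj₁ c ∈ [1⋯ r ] × proj₂ c ≤ M) (≡.sym (colourOf-lookup j)) (u∈ j , lookup≤max v′ j)

    -- Each Goldberg coefficient is a coefficient at one colour segment of `ρ`. Since `w` is finer
    -- than u, `ρ` is sorted by colour and the segments multiply to one coefficient.
    eval-goldbergs : ∀ m → eval (ι m) (goldbergs w) ≈ expBox r m M ρ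
    eval-goldbergs m = begin
      eval (ι m) (goldbergs w)
        ≈⟨ eval-∏ (ι m) [1⋯ r ] (λ i → gᵗ (Vec.toList (refine i))) ⟩
      ∏ [1⋯ r ] (λ i → eval (ι m) (gᵗ (Vec.toList (refine i))))
        ≈⟨ ∏-cong-∈ [1⋯ r ] (λ {i} _ → trans
             (reflexive (≡.cong (eval (ι m) ∘ gᵗ) (refinementWord-letters (word v) w-packed w-u w-v i)))
             (G.eval-gᵗ m (Allₚ.map⁺ (All.map proj₂ (Allₚ.filter⁺ (λ c → proj₁ c ≟ i) ρ-bounded))))) ⟩
      ∏ [1⋯ r ] (λ i → S₁.power (G.exps M) m (List.map proj₂ (segment i ρ)))
        ≈⟨ expBox-segments r m M ρ ρ-sorted (All.map proj₁ ρ-bounded) ⟨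
      expBox r m M ρ ∎
      where
      refine : ∀ i → Word (maxW (packedSubword (word u) i w))
      refine i = refinementWord (packedSubword (word u) i (word v)) (packedSubword (word u) i w)

  module _ (z : PackedWord n) (z∈W : InW (word z)) where
    private
      z-packed : Packed (word z)
      z-packed = word-packed z
      z-u : WeaklyFiner (word z) (word u)
      z-u = Finer⇒WeaklyFiner {w = word z} {word u} (proj₁ z∈W)
      z-v′ : WeaklyFiner (word z) v′
      z-v′ = WeaklyFiner-blockwise (word v) z-packed (proj₁ z∈W) (proj₂ z∈W)
      open Letters z-packed

    α : Vec (ℕ × ℕ) L
    α = lettersOver (word u) v′ z-packed z-u z-v′

    coarse : Word L → Word n
    coarse = extend (word u) v′ z-packed z-u z-v′

    steps-of : Word n → Word L
    steps-of = restrict (word u) v′ z-packed z-u z-v′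

    lookup-coarse : ∀ ψ j → lookup (coarse ψ) j ≡ lookup ψ (idx j)
    lookup-coarse ψ j = lookup∘tabulate _ j

    lookup-coarse-pos : ∀ ψ a → lookup (coarse ψ) (pos a) ≡ lookup ψ a
    lookup-coarse-pos ψ a = ≡.trans (lookup-coarse ψ (pos a)) (≡.cong (lookup ψ) (idx-pos a))

    -- Counting gives the coefficient of `α` in a product of factors 1 + (i, a), which is recognised
    -- as a substituted product of exponentials. Passing to `v′` leaves the order condition
    -- unchanged.
    eval-lhs-sub : ∀ m → eval (ι m) ((N (word u) ∗ σᵗ n ∗ N (word v)) z) ≈ sub (expBox r m M) (Vec.toList α)
    eval-lhs-sub m = trans (eval-lhs m (word u) (word v) u-packed v-packed z) (trans
      (count-orders ([1⋯]-increasing r) ([1⋯]-increasing m) ([1⋯]-increasing M) (word u) v′ z-packed z-u z-v′ u∈ v′∈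
        (λ x → packBiword (packBiword (word u) (pack x)) (word v) ≟ʷ word z)
        (λ x → Orders-cong {z = word z} (Lex₃-blockwise (word v) x) ⇔-∘ packBiword-pack≡⇔ (word u) x (word v) z-packed))
      (sym (sub-expBox r m M (Vec.toList α))))

    module _ {ψ : Word L} (ψ∈ : ψ ∈ steps L) where
      private
        w : Word n
        w = coarse ψ
        mono : ∀ {a b} → a Fin.≤ b → lookup ψ a ≤ lookup ψ b
        mono = Step-monotone (proj₁ (∈-steps⁻ ψ∈))

      coarse-packed : Packed w
      coarse-packed = packed-intro
        (λ j → ≡.subst (1 ≤_) (≡.sym (lookup-coarse ψ j)) (proj₂ (∈-steps⁻ ψ∈) (idx j)))
        (λ j k eq → let b , p = steps-packed ψ∈ (idx j) k (≡.trans (≡.sym (lookup-coarse ψ j)) eq)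
                    in  pos b , ≡.trans (lookup-coarse-pos ψ b) p)

      private
        idx-mono : ∀ {i j} → lookup (word z) i ≤ lookup (word z) j → idx i Fin.≤ idx j
        idx-mono {i} {j} zi≤zj = ℕ.s≤s⁻¹ (≡.subst₂ _≤_ (≡.sym (suc-idx i)) (≡.sym (suc-idx j)) zi≤zj)

      z-coarse : Finer (word z) w
      z-coarse i j zi≤zj = ≡.subst₂ _≤_ (≡.sym (lookup-coarse ψ i)) (≡.sym (lookup-coarse ψ j)) (mono (idx-mono {i} {j} zi≤zj))

      private
        letters≡ : stepLetters ψ ≡ [1⋯ maxW w ]
        letters≡ = stepLetters-≡ ψ∈
          (λ a → ≡.subst (_≤ maxW w) (lookup-coarse-pos ψ a) (lookup≤max w (pos a)))
          (λ k k< → let j , eq = packed⇒letter coarse-packed k k< in idx j , ≡.trans (≡.sym (lookup-coarse ψ j)) eq)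

        ψ≡ : tabulate (λ a → lookup w (pos a)) ≡ ψ
        ψ≡ = restrict-extend (word u) v′ z-packed z-u z-v′ ψ

        α-at : ∀ j → lookup α (idx j) ≡ (lookup (word u) j , lookup v′ j)
        α-at j = ≡.trans (lookup∘tabulate _ (idx j)) (≡.cong₂ _,_ (z-u _ _ (lookup-pos-idx j)) (z-v′ _ _ (lookup-pos-idx j)))

      -- A colouring says that equal letters of `w` lie over equal letters of u and `v′`. For
      -- strictly ordered letters of `w`, fineness with respect to u is inherited from `z`, which is
      -- finer than `w`.
      coloured⇒InW : ∀ (colour : ℕ → ℕ × ℕ) → α ≡ Vec.map colour ψ → InW w
      coloured⇒InW colour α≡ = w-u , λ i j eq → blockwise-injective (word v) (≡.cong proj₁ (agree i j eq)) (≡.cong proj₂ (agree i j eq))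
        where
        at : ∀ j → (lookup (word u) j , lookup v′ j) ≡ colour (lookup w j)
        at j = ≡.trans (≡.sym (α-at j)) (≡.trans (≡.cong (λ β → lookup β (idx j)) α≡)
          (≡.trans (lookup-map (idx j) colour ψ) (≡.cong colour (≡.sym (lookup-coarse ψ j)))))
        agree : ∀ i j → lookup w i ≡ lookup w j → (lookup (word u) i , lookup v′ i) ≡ (lookup (word u) j , lookup v′ j)
        agree i j eq = ≡.trans (at i) (≡.trans (≡.cong colour eq) (≡.sym (at j)))
        w-u : Finer w (word u)
        w-u i j wi≤wj with ℕₚ.m≤n⇒m<n∨m≡n wi≤wj
        ... | inj₂ eq = ℕₚ.≤-reflexive (≡.cong proj₁ (agree i j eq))
        ... | inj₁ wi<wj = proj₁ z∈W i j (ℕₚ.≮⇒≥ (λ zj<zi → ℕₚ.<⇒≱ wi<wj (z-coarse j i (ℕₚ.<⇒≤ zj<zi))))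

      -- Outside W(u, v) no colouring exists and the factorisation is not one into powers, so both
      -- sides vanish. Inside, the coordinate of K_w supplies the exponents and the Goldberg
      -- coefficients supply the bases.
      summand≈subAt : ∀ m → summand m z w ≈ subAt (expBox r m M) ψ α
      summand≈subAt m = decide (inW? w)
        where
        decide : (d : Dec (InW w)) → 𝟙 d * (eval (ι m) (goldbergs w) * 𝐊ʷ w z) ≈ subAt (expBox r m M) ψ α
        decide (no w∉W) with subAt-zero (expBox r m M) α ψ∈
        ... | inj₁ ≈0              = trans (zeroˡ _) (sym ≈0)
        ... | inj₂ (colour , α≡)   = contradiction (coloured⇒InW colour α≡) w∉W
        decide (yes w∈W) = begin
          1# * (eval (ι m) (goldbergs w) * 𝐊ʷ w z)
            ≈⟨ *-identityˡ _ ⟩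
          eval (ι m) (goldbergs w) * 𝐊ʷ w z
            ≈⟨ *-cong (eval-goldbergs coarse-packed w∈W m) (𝐊-coordinate coarse-packed z z-coarse) ⟩
          expBox r m M (List.map κ [1⋯ maxW w ]) * ∏ [1⋯ maxW w ] (λ j → l (mult j (tabulate (λ a → lookup w (pos a)))))
            ≈⟨ *-comm _ _ ⟩
          ∏ [1⋯ maxW w ] (λ j → l (mult j (tabulate (λ a → lookup w (pos a))))) * expBox r m M (List.map κ [1⋯ maxW w ])
            ≡⟨ ≡.cong₂ (λ ls χ → ∏ ls (λ j → l (mult j χ)) * expBox r m M (List.map κ ls)) (≡.sym letters≡) ψ≡ ⟩
          ∏ (stepLetters ψ) (λ j → l (mult j ψ)) * expBox r m M (List.map κ (stepLetters ψ))
            ≈⟨ subAt-constant κ (expBox r m M) ψ∈ ⟨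
          subAt (expBox r m M) ψ (Vec.map κ ψ)
            ≡⟨ ≡.cong (subAt (expBox r m M) ψ) α≡ ⟨
          subAt (expBox r m M) ψ α ∎
          where
          κ : ℕ → ℕ × ℕ
          κ = colourOf coarse-packed w∈W
          α≡ : α ≡ Vec.map κ ψ
          α≡ = lookup-ext λ a → ≡.trans (lookup∘tabulate _ a) (≡.trans
            (≡.sym (colour-lookup (word v) coarse-packed (proj₁ w∈W) (proj₂ w∈W) (pos a)))
            (≡.trans (≡.cong κ (lookup-coarse-pos ψ a)) (≡.sym (lookup-map a κ ψ))))

    -- Along the letters of `z` the letters of `w` rise weakly, and packedness leaves no gaps, so
    -- they rise by at most one at a time.
    restrict-steps : ∀ {w} → Packed w → Finer (word z) w → steps-of w ∈ steps L
    restrict-steps {w} w-packed z-w = ∈-steps⁺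
      (Step-intro (steps-of w) (λ _ → z≤n)
        (λ {a} {b} a≤b → ≡.subst₂ _≤_ (≡.sym (at a)) (≡.sym (at b))
          (z-w (pos a) (pos b) (≡.subst₂ _≤_ (≡.sym (lookup-pos a)) (≡.sym (lookup-pos b)) (s≤s a≤b))))
        gapless)
      (λ a → ≡.subst (1 ≤_) (≡.sym (at a)) (packed⇒positive w-packed (pos a)))
      where
      at : ∀ a → lookup (steps-of w) a ≡ lookup w (pos a)
      at a = lookup∘tabulate _ a
      gapless : ∀ a k → 0 < k → k ≤ lookup (steps-of w) a → ∃ λ b → lookup (steps-of w) b ≡ k
      gapless a (suc k) _ k≤ =
        let j , eq = packed⇒letter w-packed k (ℕₚ.≤-trans k≤ (≡.subst (_≤ maxW w) (≡.sym (at a)) (lookup≤max w (pos a))))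
        in  idx j , ≡.trans (at (idx j)) (≡.trans (Finer⇒WeaklyFiner {w = word z} {w} z-w _ _ (lookup-pos-idx j)) eq)

    eval-rhs-sub : ∀ m → ∑ (packedList n) (summand m z) ≈ sub (expBox r m M) (Vec.toList α)
    eval-rhs-sub m = begin
      ∑ (packedList n) (summand m z)
        ≈⟨ ∑-reindex _≟ʷ_ (packedList-unique n) (steps-unique L) coarse steps-of (summand m z)
             (λ ψ∈ → ∈-packedList⁺ (coarse-packed ψ∈)) (λ {ψ} _ → restrict-extend (word u) v′ z-packed z-u z-v′ ψ) support ⟩
      ∑ (steps L) (λ ψ → summand m z (coarse ψ))
        ≈⟨ ∑-cong-∈ (steps L) (λ ψ∈ → summand≈subAt ψ∈ m) ⟩
      ∑ (steps L) (λ ψ → subAt (expBox r m M) ψ α)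
        ≈⟨ ∑-subAt (expBox r m M) α ⟩
      sub (expBox r m M) (Vec.toList α) ∎
      where
      support : ∀ {w} → w ∈ packedList n → summand m z w ≈ 0# ⊎ (steps-of w ∈ steps L × coarse (steps-of w) ≡ w)
      support {w} w∈ with finer? (word z) w
      ... | no ¬z-w = inj₁ (trans (*-congˡ (trans (*-congˡ (𝐊-support (∈-packedList⁻ w∈) z ¬z-w)) (zeroʳ _))) (zeroʳ _))
      ... | yes z-w = inj₂ (restrict-steps (∈-packedList⁻ w∈) z-w , lookup-ext λ j → ≡.trans (lookup-coarse (steps-of w) j)
              (≡.trans (lookup∘tabulate _ (idx j)) (Finer⇒WeaklyFiner {w = word z} {w} z-w _ _ (lookup-pos-idx j))))

  module _ (z : PackedWord n) (z∉W : ¬ InW (word z)) where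

    eval-lhs-zero : ∀ m → eval (ι m) ((N (word u) ∗ σᵗ n ∗ N (word v)) z) ≈ 0#
    eval-lhs-zero m = trans (eval-lhs m (word u) (word v) u-packed v-packed z)
      (∑-zero-∈ (wordsOver [1⋯ m ] n) (λ {x} _ → 𝟙-no (packBiword (packBiword (word u) (pack x)) (word v) ≟ʷ word z) (λ eq →
        let z~ = to⇔ (packBiword-pack≡⇔ (word u) x (word v) (word-packed z)) eq
        in  z∉W (Orders-Lex₃⇒Finer (word u) x (word v) {word z} z~ , Orders-Lex₃⇒WeaklyFiner (word u) x (word v) {word z} z~))))

    -- A non-zero term would need `z` finer than some `w` in W(u, v), and then `z` would belong to
    -- W(u, v) by transitivity.
    summand-zero : ∀ m {w} → Packed w → summand m z w ≈ 0#
    summand-zero m {w} w-packed = decide (inW? w)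
      where
      decide : (d : Dec (InW w)) → 𝟙 d * (eval (ι m) (goldbergs w) * 𝐊ʷ w z) ≈ 0#
      decide (no _)            = zeroˡ _
      decide (yes (w-u , w-v)) = trans (*-congˡ (trans (*-congˡ (𝐊-support w-packed z λ z-w → z∉W
        ( Finer-trans {z = word z} {w} {word u} z-w w-u
        , WeaklyFiner-trans {z = word z} {w} {word v} (Finer⇒WeaklyFiner {w = word z} {w} z-w) w-v))) (zeroʳ _))) (zeroʳ _)

  expansion : N (word u) ∗ σᵗ n ∗ N (word v) ≋ rhs
  expansion z = eval-injective ((N (word u) ∗ σᵗ n ∗ N (word v)) z) (rhs z) (λ m → evals m (inW? (word z)))
    where
    evals : ∀ m → Dec (InW (word z)) → eval (ι m) ((N (word u) ∗ σᵗ n ∗ N (word v)) z) ≈ eval (ι m) (rhs z)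
    evals m (yes z∈W) = trans (eval-lhs-sub z z∈W m) (sym (trans (eval-rhs m z) (eval-rhs-sub z z∈W m)))
    evals m (no z∉W)  = trans (eval-lhs-zero z z∉W m) (sym (trans (eval-rhs m z)
      (∑-zero-∈ (packedList n) (λ w∈ → summand-zero z z∉W m (∈-packedList⁻ w∈)))))

mainTheorem7 : ∀ {c ℓ₁ ℓ₂} (K : HeytingField c ℓ₁ ℓ₂) (char0 : CharacteristicZero K) →
    let open CharZero K char0 in
    ∀ (n : ℕ) (u v : PackedWord n) →
    N (word u) ∗ σᵗ n ∗ N (word v)
    ≋ ∑ᵂ (W u v) (λ w →
    ∏ [1⋯ maxW (word u) ] (λ i →
    goldberg (refinementWord (packedSubword (word u) i (word v))
    (packedSubword (word u) i (word w))))
    • extendScalars (𝐊 w))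
mainTheorem7 K char0 n u v = Expansion.expansion K char0 u v
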